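{- Let $PD(n)$ denote the number of partitions of $n$ with designated summands. Then $$\sum_{n=0}^{\infty} PD(3n)q^n = \frac{1}{(q;q^6)_\infty^5 (q^3;q^6)_\infty^2 (q^5;q^6)_\infty^5}\left(\frac{(q^4;q^4)_\infty^6 (q^6;q^6)_\infty^4}{(q^2;q^2)_\infty^{10}(q^{12};q^{12})_\infty^2} + 3q^2\,\frac{(q^{12};q^{12})_\infty^6}{(q^2;q^2)_\infty^6 (q^4;q^4)_\infty^2}\right).$$
   Context: A partition of $n$ with designated summands is an ordinary partition of $n$ in which, for each part size that occurs, exactly one of the parts of that size is designated; if a size $t$ occurs $m_t$ times, the copies are regarded as ordered and the designation may be placed on any one of the $m_t$ positions, different positions giving different objects (e.g. $2'+2$ and $2+2'$ are distinct). $PD(n)$ is the number of such objects, $PD(0)=1$. Notation: $(a;q)_\infty=\prod_{n\ge1}(1-aq^{n-1})$; identities are of formal power series in $q$ (equivalently for $|q|<1$). -}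

module Defs where

open import Data.Nat as ℕ using (ℕ; zero; suc; _∸_)
open import Data.Integer as ℤ using (ℤ; +_; -_)
open import Data.List using (List; []; _∷_; map; upTo; zipWith; foldr; filter)
open import Relation.Nullary using (yes; no)

-- Partitions with designated summands.
-- A partition of n with multiplicities m_t (t a part size) admits
-- exactly ∏_{t : m_t > 0} m_t designations.  pdAux k n counts the
-- partitions of n into parts of size ≤ k, each weighted by this number
-- of designations, by choosing the multiplicity m of the largest
-- allowed part size k.

weight : ℕ → ℕ
weight zero    = 1
weight (suc m) = suc m

sumℕ : List ℕ → ℕ
sumℕ = foldr ℕ._+_ 0

pdAux : ℕ → ℕ → ℕ
pdAux zero zero    = 1
pdAux zero (suc n) = 0
pdAux (suc k) n =
  sumℕ (map (λ m → weight m ℕ.* pdAux k (n ∸ m ℕ.* suc k))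
            (filter (λ m → m ℕ.* suc k ℕ.≤? n) (upTo (suc n))))

PD : ℕ → ℕ
PD n = pdAux n n

FPS : Set
FPS = ℕ → ℤ

sumℤ : List ℤ → ℤ
sumℤ = foldr ℤ._+_ (+ 0)

oneS : FPS
oneS zero    = + 1
oneS (suc n) = + 0

mono : ℤ → ℕ → FPS
mono c k n with k ℕ.≟ n
... | yes _ = c
... | no  _ = + 0

_⊕_ : FPS → FPS → FPS
(f ⊕ g) n = f n ℤ.+ g n

_⊗_ : FPS → FPS → FPS
(f ⊗ g) n = sumℤ (map (λ i → f i ℤ.* g (n ∸ i)) (upTo (suc n)))

infixl 6 _⊕_
infixl 7 _⊗_

_^S_ : FPS → ℕ → FPS
f ^S zero    = oneS
f ^S (suc e) = f ⊗ (f ^S e)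

infixr 8 _^S_

-- Multiplicative inverse of a series with constant term 1:
-- g₀ = 1, gₙ = - Σ_{i=1}^{n} fᵢ g_{n-i}.
-- invList f n = [gₙ, …, g₀].
invList : FPS → ℕ → List ℤ
invList f zero    = + 1 ∷ []
invList f (suc n) =
  (- sumℤ (zipWith ℤ._*_ (map (λ j → f (suc j)) (upTo (suc n))) gs)) ∷ gs
  where gs = invList f n

headℤ : List ℤ → ℤ
headℤ []      = + 0
headℤ (x ∷ _) = x

invS : FPS → FPS
invS f n = headℤ (invList f n)

pochFin : ℕ → ℕ → ℕ → FPS
pochFin a b M = foldr (λ m acc → (oneS ⊕ mono (- + 1) (a ℕ.+ b ℕ.* m)) ⊗ acc)
                      oneS (upTo M)

-- (q^a ; q^b)_∞ = ∏_{m ≥ 0} (1 - q^{a + b m}),  for a ≥ 1.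
-- Since a + b m > n for m > n (a ≥ 1), the coefficient of q^n of the
-- infinite product equals that of the finite product over m ≤ n.
poch : ℕ → ℕ → FPS
poch a b n = pochFin a b (suc n) n

{-# OPTIONS --safe #-}
module Submission where

-- Write f_k = (q^k; q^k)_∞. Choosing the multiplicities of the part sizes one at a time gives
-- ∑ PD(n) qⁿ = f₆ / (f₁ f₂ f₃), and f₁ f₂ = φ(−q) ψ(q). By the triple product, φ(−q) and ψ(q) have
-- trisections φ(−q) = P(q³) − 2q Q(q³) and ψ(q) = R(q³) + q S(q³) with P, Q, R, S eta quotients,
-- which gives the subseries ∑ PD(3n) qⁿ up to the norms P³ − 8q Q³ and R³ + q S³. The norm from
-- ℤ[[q]] to ℤ[[q³]] is multiplicative, so it is computed on the factors of f₁ and f₂; this also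
-- yields two three-term relations of level 6. The identity of level 12 that remains follows from
-- these relations, and from their images under q ↦ q², by solving a cubic equation.

open import Defs
open import Algebra.Bundles using (CommutativeRing)
import Algebra.Solver.Ring as RingSolver
open import Algebra.Solver.Ring.AlmostCommutativeRing
  using (AlmostCommutativeRing; fromCommutativeRing; _-Raw-AlmostCommutative⟶_)
open import Algebra.Structures using (IsCommutativeRing)
open import Data.Integer as ℤ using (ℤ; +_)
import Data.Integer.Properties as ℤ
open import Data.Integer.Solver using (module +-*-Solver)
open import Data.List using ([]; _∷_; _++_; foldr; map; upTo; zipWith; filter)
import Data.List.Properties as List
open import Data.Maybe using (Maybe; just; nothing)
open import Data.Nat as ℕ using (ℕ; zero; suc; _∸_; z≤n; s≤s)
import Data.Nat.Properties as ℕ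
open import Data.Product using (_,_)
open import Data.Sum using (inj₁; inj₂)
open import Data.Vec as Vec using (Vec; []; _∷_)
open import Function using (_∘_)
open import Level using (0ℓ)
open import Relation.Binary using (Setoid)
open import Relation.Binary.PropositionalEquality
  using (_≡_; _≢_; refl; sym; trans; cong; cong₂; subst; module ≡-Reasoning)
import Relation.Binary.Reasoning.Setoid as SetoidReasoning
open import Relation.Nullary using (yes; no; contradiction; ¬_)

-- Rationalising 1/(φ(-q) ψ(q)) by the conjugates of both factors leaves, over the two norms, P²R² +
-- 2q·PQS² - 4q·Q²RS, and the coincidence PS = QR merges the last two terms. After division by the
-- prefactor of the claim this is u² - 2rv, where u and v are eta quotients and r is q times one,
-- while the claimed side becomes 1 + 3r². The obstacle is that u = 1 + r and v = 1 - r, from which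
-- equality is immediate, do not come directly from a norm. The norms show only that 1 - 8x and 1 +
-- x are eta quotients, with the same x = qQ³/P³ = qS³/R³. Comparing exponents gives x = rv/u², and
-- the relation for 1 + x(q²) gives uv = 1 - r². Together with the eta quotients for 1 - 8x and 1 -
-- 8x(q²) this makes u³ algebraic over the polynomials in r, and constant terms single out the right
-- root. Cube roots of unity never occur: conjugates and norms are integral polynomials in the three
-- sections of a series. Negative powers of q are avoided too, each two-sided theta series being a
-- pair of one-sided ones.

infix 4 _≈_

-- A record rather than a synonym for the pointwise equality, so that Agda can
-- infer both series from an equation.
record _≈_ (f g : FPS) : Set where
  constructor mk≈
  field at : ∀ n → f n ≡ g n
open _≈_

≈-refl : ∀ {f} → f ≈ f
≈-refl = mk≈ λ _ → refl

≈-sym : ∀ {f g} → f ≈ g → g ≈ f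
≈-sym p = mk≈ λ n → sym (at p n)

≈-trans : ∀ {f g h} → f ≈ g → g ≈ h → f ≈ h
≈-trans p q = mk≈ λ n → trans (at p n) (at q n)

zeroS : FPS
zeroS _ = + 0

const : ℤ → FPS
const c zero    = c
const c (suc _) = + 0

tail : FPS → FPS
tail f n = f (suc n)

scale : ℤ → FPS → FPS
scale c f n = c ℤ.* f n

-- Cauchy products and the ring of formal power series

sumUpTo-suc : ∀ F n → sumℤ (map F (upTo (suc n))) ≡ F 0 ℤ.+ sumℤ (map (F ∘ suc) (upTo n))
sumUpTo-suc F n = cong (λ xs → F 0 ℤ.+ sumℤ xs)
  (trans (List.map-applyUpTo suc F n) (sym (List.map-upTo (F ∘ suc) n)))

⊗-zero : ∀ f g → (f ⊗ g) 0 ≡ f 0 ℤ.* g 0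
⊗-zero f g = ℤ.+-identityʳ _

⊗-suc : ∀ f g n → (f ⊗ g) (suc n) ≡ f 0 ℤ.* g (suc n) ℤ.+ (tail f ⊗ g) n
⊗-suc f g n = sumUpTo-suc (λ i → f i ℤ.* g (suc n ∸ i)) (suc n)

private
  module ℤS = +-*-Solver

-- The mirror image of `⊗-suc`: exchanging the factors exchanges the two recursions, which is what
-- commutativity needs.
⊗-sucʳ : ∀ f g n → (f ⊗ g) (suc n) ≡ f (suc n) ℤ.* g 0 ℤ.+ (f ⊗ tail g) n
⊗-sucʳ f g zero = trans (⊗-suc f g 0)
  (trans (cong (λ x → f 0 ℤ.* g 1 ℤ.+ x) (⊗-zero (tail f) g))
  (trans (ℤ.+-comm (f 0 ℤ.* g 1) _) (cong (λ x → f 1 ℤ.* g 0 ℤ.+ x) (sym (⊗-zero f (tail g))))))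
⊗-sucʳ f g (suc n) = begin
  (f ⊗ g) (2 ℕ.+ n)
    ≡⟨ ⊗-suc f g (suc n) ⟩
  f 0 ℤ.* g (2 ℕ.+ n) ℤ.+ (tail f ⊗ g) (suc n)
    ≡⟨ cong (λ x → f 0 ℤ.* g (2 ℕ.+ n) ℤ.+ x) (⊗-sucʳ (tail f) g n) ⟩
  f 0 ℤ.* g (2 ℕ.+ n) ℤ.+ (f (2 ℕ.+ n) ℤ.* g 0 ℤ.+ (tail f ⊗ tail g) n)
    ≡⟨ ℤS.solve 3 (λ a b c → a ℤS.:+ (b ℤS.:+ c) ℤS.:= b ℤS.:+ (a ℤS.:+ c)) refl
         (f 0 ℤ.* g (2 ℕ.+ n)) (f (2 ℕ.+ n) ℤ.* g 0) ((tail f ⊗ tail g) n) ⟩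
  f (2 ℕ.+ n) ℤ.* g 0 ℤ.+ (f 0 ℤ.* g (2 ℕ.+ n) ℤ.+ (tail f ⊗ tail g) n)
    ≡⟨ cong (λ x → f (2 ℕ.+ n) ℤ.* g 0 ℤ.+ x) (⊗-suc f (tail g) n) ⟨
  f (2 ℕ.+ n) ℤ.* g 0 ℤ.+ (f ⊗ tail g) (suc n) ∎
  where open ≡-Reasoning

-- Coefficient n of a product sees only coefficients up to n. This serves both as congruence and,
-- later, for comparing partial products with their limits.
⊗-agree : ∀ {f f′ g g′} n → (∀ k → k ℕ.≤ n → f k ≡ f′ k) → (∀ k → k ℕ.≤ n → g k ≡ g′ k) →
          (f ⊗ g) n ≡ (f′ ⊗ g′) n
⊗-agree {f} {f′} {g} {g′} zero p q =
  trans (⊗-zero f g) (trans (cong₂ ℤ._*_ (p 0 z≤n) (q 0 z≤n)) (sym (⊗-zero f′ g′)))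
⊗-agree {f} {f′} {g} {g′} (suc n) p q =
  trans (⊗-suc f g n) (trans (cong₂ ℤ._+_ (cong₂ ℤ._*_ (p 0 z≤n) (q (suc n) ℕ.≤-refl))
    (⊗-agree n (λ k k≤n → p (suc k) (s≤s k≤n)) (λ k k≤n → q k (ℕ.m≤n⇒m≤1+n k≤n))))
    (sym (⊗-suc f′ g′ n)))

⊗-cong : ∀ {f f′ g g′} → f ≈ f′ → g ≈ g′ → f ⊗ g ≈ f′ ⊗ g′
⊗-cong p q = mk≈ λ n → ⊗-agree n (λ k _ → at p k) (λ k _ → at q k)

⊗-comm : ∀ f g → f ⊗ g ≈ g ⊗ f
⊗-comm f g = mk≈ (go f g)
  where
  go : ∀ f g n → (f ⊗ g) n ≡ (g ⊗ f) n
  go f g zero    = trans (⊗-zero f g) (trans (ℤ.*-comm (f 0) (g 0)) (sym (⊗-zero g f)))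
  go f g (suc n) = trans (⊗-suc f g n)
    (trans (cong₂ ℤ._+_ (ℤ.*-comm (f 0) (g (suc n))) (go (tail f) g n)) (sym (⊗-sucʳ g f n)))

⊗-distribʳ : ∀ h f g → (f ⊕ g) ⊗ h ≈ f ⊗ h ⊕ g ⊗ h
⊗-distribʳ h f g = mk≈ (go f g)
  where
  go : ∀ f g n → ((f ⊕ g) ⊗ h) n ≡ (f ⊗ h) n ℤ.+ (g ⊗ h) n
  go f g zero = trans (⊗-zero (f ⊕ g) h) (trans (ℤ.*-distribʳ-+ (h 0) (f 0) (g 0))
    (sym (cong₂ ℤ._+_ (⊗-zero f h) (⊗-zero g h))))
  go f g (suc n) = trans (⊗-suc (f ⊕ g) h n)
    (trans (cong (λ x → (f 0 ℤ.+ g 0) ℤ.* h (suc n) ℤ.+ x) (go (tail f) (tail g) n))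
    (trans (ℤS.solve 5 (λ a b c d e → (a ℤS.:+ b) ℤS.:* c ℤS.:+ (d ℤS.:+ e) ℤS.:=
              (a ℤS.:* c ℤS.:+ d) ℤS.:+ (b ℤS.:* c ℤS.:+ e)) refl
              (f 0) (g 0) (h (suc n)) ((tail f ⊗ h) n) ((tail g ⊗ h) n))
    (sym (cong₂ ℤ._+_ (⊗-suc f h n) (⊗-suc g h n)))))

scale-⊗ : ∀ c f g n → (scale c f ⊗ g) n ≡ c ℤ.* (f ⊗ g) n
scale-⊗ c f g zero = trans (⊗-zero (scale c f) g)
  (trans (ℤ.*-assoc c (f 0) (g 0)) (cong (c ℤ.*_) (sym (⊗-zero f g))))
scale-⊗ c f g (suc n) = trans (⊗-suc (scale c f) g n)
  (trans (cong₂ ℤ._+_ (ℤ.*-assoc c (f 0) (g (suc n))) (scale-⊗ c (tail f) g n))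
  (trans (sym (ℤ.*-distribˡ-+ c _ _)) (cong (c ℤ.*_) (sym (⊗-suc f g n)))))

tail-⊗ : ∀ f g → tail (f ⊗ g) ≈ scale (f 0) (tail g) ⊕ tail f ⊗ g
tail-⊗ f g = mk≈ (⊗-suc f g)

⊗-assoc : ∀ f g h → (f ⊗ g) ⊗ h ≈ f ⊗ (g ⊗ h)
⊗-assoc f g h = mk≈ (go f)
  where
  go : ∀ f n → ((f ⊗ g) ⊗ h) n ≡ (f ⊗ (g ⊗ h)) n
  go f zero = trans (⊗-zero (f ⊗ g) h) (trans (cong (ℤ._* h 0) (⊗-zero f g))
    (trans (ℤ.*-assoc (f 0) (g 0) (h 0))
    (sym (trans (⊗-zero f (g ⊗ h)) (cong (f 0 ℤ.*_) (⊗-zero g h))))))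
  go f (suc n) = begin
    ((f ⊗ g) ⊗ h) (suc n)
      ≡⟨ ⊗-suc (f ⊗ g) h n ⟩
    (f ⊗ g) 0 ℤ.* h (suc n) ℤ.+ (tail (f ⊗ g) ⊗ h) n
      ≡⟨ cong₂ ℤ._+_ (cong (ℤ._* h (suc n)) (⊗-zero f g))
           (trans (at (⊗-cong (tail-⊗ f g) (≈-refl {h})) n)
             (trans (at (⊗-distribʳ h (scale (f 0) (tail g)) (tail f ⊗ g)) n)
               (cong₂ ℤ._+_ (scale-⊗ (f 0) (tail g) h n) (go (tail f) n)))) ⟩
    f 0 ℤ.* g 0 ℤ.* h (suc n) ℤ.+ (f 0 ℤ.* (tail g ⊗ h) n ℤ.+ (tail f ⊗ (g ⊗ h)) n)
      ≡⟨ ℤS.solve 5 (λ a b c d e → a ℤS.:* b ℤS.:* c ℤS.:+ (a ℤS.:* d ℤS.:+ e) ℤS.:=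
              a ℤS.:* (b ℤS.:* c ℤS.:+ d) ℤS.:+ e) refl
              (f 0) (g 0) (h (suc n)) ((tail g ⊗ h) n) ((tail f ⊗ (g ⊗ h)) n) ⟩
    f 0 ℤ.* (g 0 ℤ.* h (suc n) ℤ.+ (tail g ⊗ h) n) ℤ.+ (tail f ⊗ (g ⊗ h)) n
      ≡⟨ cong (λ x → f 0 ℤ.* x ℤ.+ (tail f ⊗ (g ⊗ h)) n) (⊗-suc g h n) ⟨
    f 0 ℤ.* (g ⊗ h) (suc n) ℤ.+ (tail f ⊗ (g ⊗ h)) n
      ≡⟨ ⊗-suc f (g ⊗ h) n ⟨
    (f ⊗ (g ⊗ h)) (suc n) ∎
    where open ≡-Reasoning

const-⊗ : ∀ c f n → (const c ⊗ f) n ≡ c ℤ.* f n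
const-⊗ c f zero    = ⊗-zero (const c) f
const-⊗ c f (suc n) = trans (⊗-suc (const c) f n)
  (trans (cong (λ x → c ℤ.* f (suc n) ℤ.+ x) (vanish n)) (ℤ.+-identityʳ _))
  where
  vanish : ∀ n → (zeroS ⊗ f) n ≡ + 0
  vanish zero    = ⊗-zero zeroS f
  vanish (suc n) = trans (⊗-suc zeroS f n) (trans (ℤ.+-identityˡ _) (vanish n))

oneS≈const : oneS ≈ const (+ 1)
oneS≈const = mk≈ λ { zero → refl ; (suc _) → refl }

⊗-identityˡ : ∀ f → oneS ⊗ f ≈ f
⊗-identityˡ f = ≈-trans (⊗-cong {g = f} oneS≈const ≈-refl)
  (mk≈ λ n → trans (const-⊗ (+ 1) f n) (ℤ.*-identityˡ (f n)))

infixl 6 _+_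
infixl 7 _*_
infix  8 -_
infixr 9 _^_

-- Opaque copies of the ring operations: the originals unfold under η-expansion of series,
-- which defeats unification.
opaque
  _+_ _*_ : FPS → FPS → FPS
  _+_ = _⊕_
  _*_ = _⊗_

  -_ : FPS → FPS
  (- f) n = ℤ.- f n

  +-at : ∀ f g n → (f + g) n ≡ f n ℤ.+ g n
  +-at f g n = refl

  -‿at : ∀ f n → (- f) n ≡ ℤ.- f n
  -‿at f n = refl

  ⊕≈+ : ∀ f g → f ⊕ g ≈ f + g
  ⊕≈+ f g = ≈-refl

  ⊗≈* : ∀ f g → f ⊗ g ≈ f * g
  ⊗≈* f g = ≈-refl

  isCommutativeRing : IsCommutativeRing _≈_ _+_ _*_ -_ zeroS oneS
  isCommutativeRing = record
    { isRing = record
      { +-isAbelianGroup = record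
        { isGroup = record
          { isMonoid = record
            { isSemigroup = record
              { isMagma = record
                { isEquivalence = record { refl = ≈-refl ; sym = ≈-sym ; trans = ≈-trans }
                ; ∙-cong = λ p q → mk≈ λ n → cong₂ ℤ._+_ (at p n) (at q n) }
              ; assoc = λ f g h → mk≈ λ n → ℤ.+-assoc (f n) (g n) (h n) }
            ; identity = (λ f → mk≈ λ n → ℤ.+-identityˡ (f n)) , (λ f → mk≈ λ n → ℤ.+-identityʳ (f n)) }
          ; inverse = (λ f → mk≈ λ n → ℤ.+-inverseˡ (f n)) , (λ f → mk≈ λ n → ℤ.+-inverseʳ (f n))
          ; ⁻¹-cong = λ p → mk≈ λ n → cong ℤ.-_ (at p n) }
        ; comm = λ f g → mk≈ λ n → ℤ.+-comm (f n) (g n) }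
      ; *-cong = ⊗-cong
      ; *-assoc = ⊗-assoc
      ; *-identity = ⊗-identityˡ , λ f → ≈-trans (⊗-comm f oneS) (⊗-identityˡ f)
      ; distrib = (λ h f g → ≈-trans (⊗-comm h (f ⊕ g)) (≈-trans (⊗-distribʳ h f g)
                     (mk≈ λ n → cong₂ ℤ._+_ (at (⊗-comm f h) n) (at (⊗-comm g h) n))))
                , ⊗-distribʳ }
    ; *-comm = ⊗-comm }

FPS-commutativeRing : CommutativeRing 0ℓ 0ℓ
FPS-commutativeRing = record { isCommutativeRing = isCommutativeRing }

open CommutativeRing FPS-commutativeRing public
  using (*-assoc; *-comm; *-identityˡ; *-identityʳ; +-cong; *-cong; -‿cong; zeroˡ; zeroʳ)

*-head : ∀ f g → (f * g) 0 ≡ f 0 ℤ.* g 0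
*-head f g = trans (sym (at (⊗≈* f g) 0)) (⊗-zero f g)

*-suc : ∀ f g n → (f * g) (suc n) ≡ f 0 ℤ.* g (suc n) ℤ.+ (tail f * g) n
*-suc f g n = trans (sym (at (⊗≈* f g) (suc n))) (trans (⊗-suc f g n)
  (cong (λ x → f 0 ℤ.* g (suc n) ℤ.+ x) (at (⊗≈* (tail f) g) n)))

*-agree : ∀ {f f′ g g′} n → (∀ k → k ℕ.≤ n → f k ≡ f′ k) → (∀ k → k ℕ.≤ n → g k ≡ g′ k) →
          (f * g) n ≡ (f′ * g′) n
*-agree {f} {f′} {g} {g′} n p q =
  trans (sym (at (⊗≈* f g) n)) (trans (⊗-agree n p q) (at (⊗≈* f′ g′) n))

_^_ : FPS → ℕ → FPS
f ^ zero  = oneS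
f ^ suc n = f * f ^ n

-- Constant series, with κ (+ 0) and κ (+ 1) reducing to the zero and the unit of the
-- ring, so that the numerals of the ring solver are literally those of Defs.
κ : ℤ → FPS
κ (+ 0) = zeroS
κ (+ 1) = oneS
κ c     = const c

κ≈const : ∀ c → κ c ≈ const c
κ≈const (+ 0)                = mk≈ λ { zero → refl ; (suc _) → refl }
κ≈const (+ 1)                = oneS≈const
κ≈const (+ (suc (suc _)))    = ≈-refl
κ≈const (ℤ.-[1+ _ ])         = ≈-refl

κ-* : ∀ c f n → (κ c * f) n ≡ c ℤ.* f n
κ-* c f n = trans (sym (at (⊗≈* (κ c) f) n))
  (trans (at (⊗-cong {g = f} (κ≈const c) ≈-refl) n) (const-⊗ c f n))

private
  ℤ-rawRing = AlmostCommutativeRing.rawRing (fromCommutativeRing ℤ.+-*-commutativeRing)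

  κ-homo : ℤ-rawRing -Raw-AlmostCommutative⟶ fromCommutativeRing FPS-commutativeRing
  κ-homo = record
    { ⟦_⟧    = κ
    ; +-homo = λ a b → ≈-trans (κ≈const (a ℤ.+ b))
        (mk≈ λ { zero → sym (trans (+-at (κ a) (κ b) 0) (cong₂ ℤ._+_ (at (κ≈const a) 0) (at (κ≈const b) 0)))
               ; (suc n) → sym (trans (+-at (κ a) (κ b) (suc n))
                   (cong₂ ℤ._+_ (at (κ≈const a) (suc n)) (at (κ≈const b) (suc n)))) })
    ; *-homo = λ a b → ≈-trans (κ≈const (a ℤ.* b))
        (mk≈ λ { zero → sym (trans (κ-* a (κ b) 0) (cong (a ℤ.*_) (at (κ≈const b) 0)))
               ; (suc n) → sym (trans (κ-* a (κ b) (suc n))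
                   (trans (cong (a ℤ.*_) (at (κ≈const b) (suc n))) (ℤ.*-zeroʳ a))) })
    ; -‿homo = λ a → ≈-trans (κ≈const (ℤ.- a))
        (mk≈ λ { zero → sym (trans (-‿at (κ a) 0) (cong ℤ.-_ (at (κ≈const a) 0)))
               ; (suc n) → sym (trans (-‿at (κ a) (suc n)) (cong ℤ.-_ (at (κ≈const a) (suc n)))) })
    ; 0-homo = ≈-refl
    ; 1-homo = ≈-refl }

  κ≟ : ∀ a b → Maybe (κ a ≈ κ b)
  κ≟ a b with a ℤ.≟ b
  ... | yes refl = just ≈-refl
  ... | no _     = nothing

open RingSolver ℤ-rawRing (fromCommutativeRing FPS-commutativeRing) κ-homo κ≟ public
  using (Polynomial; solve; con; _:+_; _:*_; _:-_; :-_; _:=_)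

≈-setoid : Setoid 0ℓ 0ℓ
≈-setoid = CommutativeRing.setoid FPS-commutativeRing

module ≈R = SetoidReasoning ≈-setoid

-- Powers and the variable

^-cong : ∀ {f g} n → f ≈ g → f ^ n ≈ g ^ n
^-cong zero    p = ≈-refl
^-cong (suc n) p = *-cong p (^-cong n p)

^-+ : ∀ f m n → f ^ (m ℕ.+ n) ≈ f ^ m * f ^ n
^-+ f zero    n = ≈-sym (*-identityˡ (f ^ n))
^-+ f (suc m) n = ≈-trans (*-cong ≈-refl (^-+ f m n)) (≈-sym (*-assoc f (f ^ m) (f ^ n)))

*-^ : ∀ f g n → (f * g) ^ n ≈ f ^ n * g ^ n
*-^ f g zero    = ≈-sym (*-identityˡ oneS)
*-^ f g (suc n) = ≈-trans (*-cong ≈-refl (*-^ f g n))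
  (solve 4 (λ f g a b → f :* g :* (a :* b) := f :* a :* (g :* b)) ≈-refl f g (f ^ n) (g ^ n))

^-* : ∀ f m n → f ^ (m ℕ.* n) ≈ (f ^ n) ^ m
^-* f zero    n = ≈-refl
^-* f (suc m) n = ≈-trans (^-+ f n (m ℕ.* n)) (*-cong ≈-refl (^-* f m n))

X : FPS
X = mono (+ 1) 1

mono-suc : ∀ c k n → mono c (suc k) (suc n) ≡ mono c k n
mono-suc c k n with k ℕ.≟ n | suc k ℕ.≟ suc n
... | yes _ | yes _ = refl
... | yes p | no ¬p = contradiction (cong suc p) ¬p
... | no ¬p | yes p = contradiction (ℕ.suc-injective p) ¬p
... | no _  | no _  = refl

X-suc : ∀ n → X (suc n) ≡ oneS n
X-suc n = trans (mono-suc (+ 1) 0 n) (lemma n)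
  where
  lemma : ∀ n → mono (+ 1) 0 n ≡ oneS n
  lemma zero    = refl
  lemma (suc n) = refl

*-zero-head : ∀ f g → f 0 ≡ + 0 → (f * g) 0 ≡ + 0
*-zero-head f g p = trans (*-head f g) (cong (ℤ._* g 0) p)

X*-suc : ∀ f n → (X * f) (suc n) ≡ f n
X*-suc f n = trans (*-suc X f n) (trans (ℤ.+-identityˡ _)
  (trans (at (*-cong (mk≈ X-suc) ≈-refl) n) (at (*-identityˡ f) n)))

X*-tail : ∀ f → f 0 ≡ + 0 → f ≈ X * tail f
X*-tail f f0 = mk≈ λ { zero → trans f0 (sym (*-zero-head X (tail f) refl)) ; (suc n) → sym (X*-suc (tail f) n) }

mono≈ : ∀ c k → mono c k ≈ κ c * X ^ k
mono≈ c k = ≈-trans (mk≈ (go k))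
  (≈-sym (≈-trans (*-comm (κ c) (X ^ k)) (*-cong ≈-refl (κ≈const c))))
  where
  go : ∀ k n → mono c k n ≡ (X ^ k * const c) n
  go zero zero       = sym (at (*-identityˡ (const c)) 0)
  go zero (suc n)    = sym (at (*-identityˡ (const c)) (suc n))
  go (suc k) zero    = sym (*-zero-head (X ^ suc k) (const c) (*-zero-head X (X ^ k) refl))
  go (suc k) (suc n) = trans (mono-suc c k n) (trans (go k n)
    (sym (trans (at (*-assoc X (X ^ k) (const c)) (suc n)) (X*-suc (X ^ k * const c) n))))

-- Agreement of the first coefficients

infix 4 _≈[_]_

record _≈[_]_ (f : FPS) (n : ℕ) (g : FPS) : Set where
  constructor mk≈[]
  field below : ∀ k → k ℕ.< n → f k ≡ g k
open _≈[_]_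

≈⇒≈[] : ∀ {n f g} → f ≈ g → f ≈[ n ] g
≈⇒≈[] p = mk≈[] λ k _ → at p k

≈[]⇒≈ : ∀ {f g} → (∀ n → f ≈[ n ] g) → f ≈ g
≈[]⇒≈ p = mk≈ λ n → below (p (suc n)) n ℕ.≤-refl

≈[]-setoid : ℕ → Setoid 0ℓ 0ℓ
≈[]-setoid n = record { Carrier = FPS ; _≈_ = _≈[ n ]_ ; isEquivalence = record
  { refl  = mk≈[] λ _ _ → refl
  ; sym   = λ p → mk≈[] λ k k<n → sym (below p k k<n)
  ; trans = λ p q → mk≈[] λ k k<n → trans (below p k k<n) (below q k k<n) } }

module ≈[]R n = SetoidReasoning (≈[]-setoid n)
module ≈[]E {n} = Setoid (≈[]-setoid n) using (refl; sym; trans)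

≈[]-weaken : ∀ {m n f g} → m ℕ.≤ n → f ≈[ n ] g → f ≈[ m ] g
≈[]-weaken m≤n p = mk≈[] λ k k<m → below p k (ℕ.≤-trans k<m m≤n)

*-cong[] : ∀ {n f f′ g g′} → f ≈[ n ] f′ → g ≈[ n ] g′ → f * g ≈[ n ] f′ * g′
*-cong[] p q = mk≈[] λ k k<n → *-agree k (λ i i≤k → below p i (ℕ.≤-<-trans i≤k k<n))
                                           (λ i i≤k → below q i (ℕ.≤-<-trans i≤k k<n))

+-cong[] : ∀ {n f f′ g g′} → f ≈[ n ] f′ → g ≈[ n ] g′ → f + g ≈[ n ] f′ + g′
+-cong[] {f = f} {f′} {g} {g′} p q = mk≈[] λ k k<n → trans (+-at f g k)
  (trans (cong₂ ℤ._+_ (below p k k<n) (below q k k<n)) (sym (+-at f′ g′ k)))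

-‿cong[] : ∀ {n f f′} → f ≈[ n ] f′ → - f ≈[ n ] - f′
-‿cong[] {f = f} {f′} p = mk≈[] λ k k<n →
  trans (-‿at f k) (trans (cong ℤ.-_ (below p k k<n)) (sym (-‿at f′ k)))

-- Orders of vanishing add: q^m divides `f` and q^n divides the error in `g`. The triple product
-- depends on this gain, since neither error is small enough by itself.
*-order : ∀ m n {f g g′} → f ≈[ m ] zeroS → g ≈[ n ] g′ → f * g ≈[ m ℕ.+ n ] f * g′
*-order zero    n p q = *-cong[] ≈[]E.refl q
*-order (suc m) n {f} {g} {g′} p q = mk≈[] λ
  { zero    _         → trans (*-zero-head f g (below p 0 (s≤s z≤n))) (sym (*-zero-head f g′ (below p 0 (s≤s z≤n))))
  ; (suc k) (s≤s k<n) → trans (lemma g (suc k)) (trans (X*-suc _ k)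
      (trans (below (*-order m n {tail f} (mk≈[] λ j j<m → below p (suc j) (s≤s j<m)) q) k k<n)
      (sym (trans (lemma g′ (suc k)) (X*-suc _ k))))) }
  where
  lemma : ∀ g n → (f * g) n ≡ (X * (tail f * g)) n
  lemma g n = at (≈-trans (*-cong (X*-tail f (below p 0 (s≤s z≤n))) ≈-refl)
                          (*-assoc X (tail f) g)) n

zero[]-* : ∀ {n f} g → f ≈[ n ] zeroS → g * f ≈[ n ] zeroS
zero[]-* g p = ≈[]E.trans (*-cong[] ≈[]E.refl p)
  (≈⇒≈[] (solve 1 (λ g → g :* con (+ 0) := con (+ 0)) ≈-refl g))

^-order : ∀ {f} n → f 0 ≡ + 0 → f ^ n ≈[ n ] zeroS
^-order zero p = mk≈[] λ _ ()
^-order {f} (suc n) p = ≈[]E.trans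
  (*-order 1 n {f} (mk≈[] λ { zero _ → p ; (suc _) (s≤s ()) }) (^-order n p))
  (zero[]-* f ≈[]E.refl)

-- Cancellation

-- A nonzero constant term suffices because ℤ has no zero divisors: `g` starts with 0, and q can be
-- stripped from it again and again. Hence factors with constant term 2 or 3, which are not units,
-- can be cancelled as well.
*-cancel-zero : ∀ f g → f 0 ≢ + 0 → f * g ≈ zeroS → g ≈ zeroS
*-cancel-zero f g f0 p = mk≈ (λ n → go n g p)
  where
  go : ∀ n g → f * g ≈ zeroS → g n ≡ + 0
  head0 : ∀ g → f * g ≈ zeroS → g 0 ≡ + 0
  head0 g p with ℤ.i*j≡0⇒i≡0∨j≡0 (f 0) (trans (sym (*-head f g)) (at p 0))
  ... | inj₁ q = contradiction q f0
  ... | inj₂ q = q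
  go zero    g p = head0 g p
  go (suc n) g p = go n (tail g) (mk≈ λ k → trans (sym (X*-suc (f * tail g) k))
    (trans (at (≈-trans (solve 3 (λ X f g → X :* (f :* g) := f :* (X :* g)) ≈-refl X f (tail g))
      (*-cong ≈-refl (≈-sym (X*-tail g (head0 g p))))) (suc k)) (at p (suc k))))

-- Inverses

-- The list runs from the newest coefficient down, so zipping it with f₁, f₂, ... pairs f_(j+1) with
-- g_(n-j): the recursion in `invS` is a Cauchy product with `tail f`.
invList≡ : ∀ f n → invList f n ≡ map (λ i → invS f (n ∸ i)) (upTo (suc n))
invList≡ f zero    = refl
invList≡ f (suc n) = cong (invS f (suc n) ∷_) (trans (invList≡ f n)
  (trans (List.map-upTo (λ i → invS f (n ∸ i)) (suc n))
         (sym (List.map-applyUpTo suc (λ i → invS f (suc n ∸ i)) (suc n)))))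

zipWith-map : ∀ (F G : ℕ → ℤ) xs → zipWith ℤ._*_ (map F xs) (map G xs) ≡ map (λ i → F i ℤ.* G i) xs
zipWith-map F G []       = refl
zipWith-map F G (x ∷ xs) = cong (F x ℤ.* G x ∷_) (zipWith-map F G xs)

invS-suc : ∀ f n → invS f (suc n) ≡ ℤ.- (tail f * invS f) n
invS-suc f n = trans (cong (λ xs → ℤ.- sumℤ xs)
  (trans (cong (zipWith ℤ._*_ (map (tail f) (upTo (suc n)))) (invList≡ f n))
         (zipWith-map (tail f) (λ i → invS f (n ∸ i)) (upTo (suc n)))))
  (cong ℤ.-_ (at (⊗≈* (tail f) (invS f)) n))

*-invS : ∀ f → f 0 ≡ + 1 → f * invS f ≈ oneS
*-invS f f0 = mk≈ λ
  { zero    → trans (*-head f (invS f)) (cong (ℤ._* + 1) f0)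
  ; (suc n) → trans (*-suc f (invS f) n) (trans (cong (λ x → x ℤ.+ (tail f * invS f) n)
      (trans (cong (ℤ._* invS f (suc n)) f0) (trans (ℤ.*-identityˡ _) (invS-suc f n))))
      (ℤ.+-inverseˡ ((tail f * invS f) n))) }

-- Stretched series: stretch e k f is q^k f(q^(e+1)).

stretch : ℕ → ℕ → FPS → FPS
stretch e zero    f zero    = f 0
stretch e zero    f (suc n) = stretch e e (tail f) n
stretch e (suc k) f zero    = + 0
stretch e (suc k) f (suc n) = stretch e k f n

stretch-agree : ∀ e k {f g} n → (∀ i → i ℕ.≤ n → f i ≡ g i) → stretch e k f n ≡ stretch e k g n
stretch-agree e zero    zero    p = p 0 z≤n
stretch-agree e zero    (suc n) p = stretch-agree e e n (λ i i≤n → p (suc i) (s≤s i≤n))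
stretch-agree e (suc k) zero    p = refl
stretch-agree e (suc k) (suc n) p = stretch-agree e k n (λ i i≤n → p i (ℕ.m≤n⇒m≤1+n i≤n))

stretch-suc : ∀ e k f → stretch e (suc k) f ≈ X * stretch e k f
stretch-suc e k f = mk≈ λ { zero → sym (*-zero-head X (stretch e k f) refl) ; (suc n) → sym (X*-suc (stretch e k f) n) }

stretch-+ : ∀ e k f g → stretch e k (f + g) ≈ stretch e k f + stretch e k g
stretch-+ e k f g = mk≈ (go k f g)
  where
  sum : ℕ → FPS → FPS → ℕ → ℤ
  sum k f g n = stretch e k f n ℤ.+ stretch e k g n
  ⊕≡ : ∀ k f g n → stretch e k (f ⊕ g) n ≡ sum k f g n
  ⊕≡ zero    f g zero    = refl
  ⊕≡ zero    f g (suc n) = ⊕≡ e (tail f) (tail g) n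
  ⊕≡ (suc k) f g zero    = refl
  ⊕≡ (suc k) f g (suc n) = ⊕≡ k f g n
  go : ∀ k f g n → stretch e k (f + g) n ≡ (stretch e k f + stretch e k g) n
  go k f g n = trans (stretch-agree e k n (λ i _ → +-at f g i))
    (trans (⊕≡ k f g n) (sym (+-at (stretch e k f) (stretch e k g) n)))

stretch-scale : ∀ e k c f n → stretch e k (scale c f) n ≡ c ℤ.* stretch e k f n
stretch-scale e zero    c f zero    = refl
stretch-scale e zero    c f (suc n) = stretch-scale e e c (tail f) n
stretch-scale e (suc k) c f zero    = sym (ℤ.*-zeroʳ c)
stretch-scale e (suc k) c f (suc n) = stretch-scale e k c f n

-- The delay `k` is general because the induction uses it up one coefficient at a time; it sits on
-- the left factor only, a product of delays being their sum.
stretch-* : ∀ e k f g → stretch e k (f * g) ≈ stretch e k f * stretch e 0 g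
stretch-* e k f g = mk≈ (go k f)
  where
  go : ∀ k f n → stretch e k (f * g) n ≡ (stretch e k f * stretch e 0 g) n
  go zero f zero = trans (*-head f g) (sym (*-head (stretch e 0 f) (stretch e 0 g)))
  go zero f (suc n) = begin
    stretch e e (tail (f * g)) n
      ≡⟨ stretch-agree e e n (λ i _ → trans (*-suc f g i)
           (sym (+-at (scale (f 0) (tail g)) (tail f * g) i))) ⟩
    stretch e e (scale (f 0) (tail g) + tail f * g) n
      ≡⟨ trans (at (stretch-+ e e (scale (f 0) (tail g)) (tail f * g)) n)
           (+-at (stretch e e (scale (f 0) (tail g))) (stretch e e (tail f * g)) n) ⟩
    stretch e e (scale (f 0) (tail g)) n ℤ.+ stretch e e (tail f * g) n
      ≡⟨ cong₂ ℤ._+_ (stretch-scale e e (f 0) (tail g) n) (go e (tail f) n) ⟩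
    f 0 ℤ.* stretch e e (tail g) n ℤ.+ (stretch e e (tail f) * stretch e 0 g) n
      ≡⟨ *-suc (stretch e 0 f) (stretch e 0 g) n ⟨
    (stretch e 0 f * stretch e 0 g) (suc n) ∎
    where open ≡-Reasoning
  go (suc k) f zero    = sym (*-zero-head (stretch e (suc k) f) (stretch e 0 g) refl)
  go (suc k) f (suc n) = trans (go k f n)
    (sym (trans (*-suc (stretch e (suc k) f) (stretch e 0 g) n) (ℤ.+-identityˡ _)))

-- D d f is f(q^d), for d ≥ 1.
D : ℕ → FPS → FPS
D d = stretch (ℕ.pred d) 0

D-cong[] : ∀ d {n f g} → f ≈[ n ] g → D d f ≈[ n ] D d g
D-cong[] d p = mk≈[] λ k k<n → stretch-agree _ 0 k (λ i i≤k → below p i (ℕ.≤-<-trans i≤k k<n))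

D-cong : ∀ d {f g} → f ≈ g → D d f ≈ D d g
D-cong d p = mk≈ λ k → stretch-agree _ 0 k (λ i _ → at p i)

D-* : ∀ d f g → D d (f * g) ≈ D d f * D d g
D-* d = stretch-* _ 0

D-+ : ∀ d f g → D d (f + g) ≈ D d f + D d g
D-+ d = stretch-+ _ 0

stretch-zero : ∀ e k n → stretch e k zeroS n ≡ + 0
stretch-zero e zero    zero    = refl
stretch-zero e zero    (suc n) = stretch-zero e e n
stretch-zero e (suc k) zero    = refl
stretch-zero e (suc k) (suc n) = stretch-zero e k n

D-κ : ∀ d c → D d (κ c) ≈ κ c
D-κ d c = ≈-trans (D-cong d (κ≈const c)) (≈-trans
  (mk≈ λ { zero → refl ; (suc n) → stretch-zero (ℕ.pred d) (ℕ.pred d) n }) (≈-sym (κ≈const c)))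

D-‿- : ∀ d f → D d (- f) ≈ - D d f
D-‿- d f = begin
  D d (- f)                 ≈⟨ D-cong d (solve 1 (λ f → :- f := con (ℤ.- + 1) :* f) ≈-refl f) ⟩
  D d (κ (ℤ.- + 1) * f)       ≈⟨ D-* d (κ (ℤ.- + 1)) f ⟩
  D d (κ (ℤ.- + 1)) * D d f   ≈⟨ *-cong (D-κ d (ℤ.- + 1)) ≈-refl ⟩
  κ (ℤ.- + 1) * D d f         ≈⟨ solve 1 (λ f → con (ℤ.- + 1) :* f := :- f) ≈-refl (D d f) ⟩
  - D d f                   ∎
  where open ≈R

D-^ : ∀ d f n → D d (f ^ n) ≈ D d f ^ n
D-^ d f zero    = D-κ d (+ 1)
D-^ d f (suc n) = ≈-trans (D-* d f (f ^ n)) (*-cong ≈-refl (D-^ d f n))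

D-X : ∀ d → D (suc d) X ≈ X ^ (suc d)
D-X d = mk≈ λ
  { zero    → sym (*-zero-head X (X ^ d) refl)
  ; (suc n) → trans (stretch-agree d d n (λ i _ → X-suc i))
                    (trans (at (lemma d) n) (sym (X*-suc (X ^ d) n))) }
  where
  lemma : ∀ k → stretch d k oneS ≈ X ^ k
  lemma zero    = D-κ (suc d) (+ 1)
  lemma (suc k) = ≈-trans (stretch-suc d k oneS) (*-cong ≈-refl (lemma k))

-- Limits and infinite products

-- Agreement `≈[ n ]` is strict, so coefficient n is settled only from `F (suc n)` on. The same
-- indexing is used by `poch`.
lim : (ℕ → FPS) → FPS
lim F n = F (suc n) n

≈[]-lim : ∀ F → (∀ n → F n ≈[ n ] F (suc n)) → ∀ n → F n ≈[ n ] lim F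
≈[]-lim F cauchy n = mk≈[] λ k k<n → sym (trans (below (up (suc k) (n ∸ suc k)) k ℕ.≤-refl)
  (cong (λ m → F m k) (ℕ.m∸n+n≡m k<n)))
  where
  up : ∀ m j → F m ≈[ m ] F (j ℕ.+ m)
  up m zero    = ≈[]E.refl
  up m (suc j) = ≈[]E.trans (up m j) (≈[]-weaken (ℕ.m≤n+m m j) (cauchy (j ℕ.+ m)))

prod : FPS → FPS → ℕ → FPS
prod z Q zero    = oneS
prod z Q (suc M) = prod z Q M * (oneS + z * Q ^ M)

opaque
  ∏ : FPS → FPS → FPS
  ∏ z Q = lim (prod z Q)

  ∏-at : ∀ z Q n → ∏ z Q n ≡ prod z Q (suc n) n
  ∏-at z Q n = refl

  prod≈[]∏ : ∀ z Q → Q 0 ≡ + 0 → ∀ n → prod z Q n ≈[ n ] ∏ z Q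
  prod≈[]∏ z Q Q0 = ≈[]-lim (prod z Q) λ n → ≈[]E.trans
    (≈⇒≈[] (solve 1 (λ p → p := p :* (con (+ 1) :+ con (+ 0))) ≈-refl (prod z Q n)))
    (*-cong[] ≈[]E.refl (+-cong[] ≈[]E.refl (≈[]E.sym (zero[]-* z (^-order n Q0)))))

prod-cong : ∀ {z z′ Q Q′} → z ≈ z′ → Q ≈ Q′ → ∀ M → prod z Q M ≈ prod z′ Q′ M
prod-cong p q zero    = ≈-refl
prod-cong p q (suc M) = *-cong (prod-cong p q M) (+-cong ≈-refl (*-cong p (^-cong M q)))

∏-cong : ∀ {z z′ Q Q′} → z ≈ z′ → Q ≈ Q′ → ∏ z Q ≈ ∏ z′ Q′
∏-cong {z} {z′} {Q} {Q′} p q = mk≈ λ n →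
  trans (∏-at z Q n) (trans (at (prod-cong p q (suc n)) n) (sym (∏-at z′ Q′ n)))

prod-head : ∀ z Q → z 0 ≡ + 0 → ∀ M → prod z Q M 0 ≡ + 1
prod-head z Q z0 zero    = refl
prod-head z Q z0 (suc M) = trans (*-head (prod z Q M) _) (cong₂ ℤ._*_ (prod-head z Q z0 M)
  (trans (+-at oneS (z * Q ^ M) 0) (cong (λ x → + 1 ℤ.+ x) (*-zero-head z (Q ^ M) z0))))

∏-head : ∀ z Q → z 0 ≡ + 0 → ∏ z Q 0 ≡ + 1
∏-head z Q z0 = trans (∏-at z Q 0) (prod-head z Q z0 1)

-- Recursive rather than `2 * n` and `3 * n`, so that a step of `n` reduces to two or three
-- successors by computation.
double triple : ℕ → ℕ
double zero    = 0
double (suc n) = 2 ℕ.+ double n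
triple zero    = 0
triple (suc n) = 3 ℕ.+ triple n

n≤double : ∀ n → n ℕ.≤ double n
n≤double zero    = z≤n
n≤double (suc n) = s≤s (ℕ.m≤n⇒m≤1+n (n≤double n))

n≤triple : ∀ n → n ℕ.≤ triple n
n≤triple zero    = z≤n
n≤triple (suc n) = s≤s (ℕ.m≤n⇒m≤1+n (ℕ.m≤n⇒m≤1+n (n≤triple n)))

^-double : ∀ f n → f ^ double n ≈ f ^ n * f ^ n
^-double f zero    = ≈-sym (*-identityˡ oneS)
^-double f (suc n) = ≈-trans (*-cong ≈-refl (*-cong ≈-refl (^-double f n)))
  (solve 2 (λ f a → f :* (f :* (a :* a)) := f :* a :* (f :* a)) ≈-refl f (f ^ n))

^-triple : ∀ f n → f ^ triple n ≈ f ^ n * f ^ n * f ^ n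
^-triple f zero    = solve 0 (con (+ 1) := con (+ 1) :* con (+ 1) :* con (+ 1)) ≈-refl
^-triple f (suc n) = ≈-trans (*-cong ≈-refl (*-cong ≈-refl (*-cong ≈-refl (^-triple f n))))
  (solve 2 (λ f a → f :* (f :* (f :* (a :* a :* a))) := f :* a :* (f :* a) :* (f :* a)) ≈-refl f (f ^ n))

prod-double : ∀ z Q M → prod z Q (double M) ≈ prod z (Q * Q) M * prod (z * Q) (Q * Q) M
prod-double z Q zero    = ≈-sym (*-identityˡ oneS)
prod-double z Q (suc M) = ≈-trans
  (*-cong (*-cong (prod-double z Q M) (+-cong ≈-refl (*-cong ≈-refl Q^)))
          (+-cong ≈-refl (*-cong ≈-refl (*-cong ≈-refl Q^))))
  (solve 5 (λ a b z Q y → a :* b :* (con (+ 1) :+ z :* y) :* (con (+ 1) :+ z :* (Q :* y)) :=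
     a :* (con (+ 1) :+ z :* y) :* (b :* (con (+ 1) :+ z :* Q :* y))) ≈-refl
     (prod z (Q * Q) M) (prod (z * Q) (Q * Q) M) z Q ((Q * Q) ^ M))
  where
  Q^ : Q ^ double M ≈ (Q * Q) ^ M
  Q^ = ≈-trans (^-double Q M) (≈-sym (*-^ Q Q M))

prod-triple : ∀ z Q M → prod z Q (triple M) ≈
  prod z (Q * Q * Q) M * prod (z * Q) (Q * Q * Q) M * prod (z * Q * Q) (Q * Q * Q) M
prod-triple z Q zero    = solve 0 (con (+ 1) := con (+ 1) :* con (+ 1) :* con (+ 1)) ≈-refl
prod-triple z Q (suc M) = ≈-trans
  (*-cong (*-cong (*-cong (prod-triple z Q M) (+-cong ≈-refl (*-cong ≈-refl Q^)))
          (+-cong ≈-refl (*-cong ≈-refl (*-cong ≈-refl Q^))))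
          (+-cong ≈-refl (*-cong ≈-refl (*-cong ≈-refl (*-cong ≈-refl Q^)))))
  (solve 6 (λ a b c z Q y →
     a :* b :* c :* (con (+ 1) :+ z :* y) :* (con (+ 1) :+ z :* (Q :* y))
       :* (con (+ 1) :+ z :* (Q :* (Q :* y))) :=
     a :* (con (+ 1) :+ z :* y) :* (b :* (con (+ 1) :+ z :* Q :* y))
       :* (c :* (con (+ 1) :+ z :* Q :* Q :* y))) ≈-refl
     (prod z (Q * Q * Q) M) (prod (z * Q) (Q * Q * Q) M) (prod (z * Q * Q) (Q * Q * Q) M)
     z Q ((Q * Q * Q) ^ M))
  where
  Q^ : Q ^ triple M ≈ (Q * Q * Q) ^ M
  Q^ = ≈-trans (^-triple Q M) (≈-sym (≈-trans (*-^ (Q * Q) Q M) (*-cong (*-^ Q Q M) ≈-refl)))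

∏-double : ∀ z Q → Q 0 ≡ + 0 → ∏ z Q ≈ ∏ z (Q * Q) * ∏ (z * Q) (Q * Q)
∏-double z Q Q0 = ≈[]⇒≈ λ n → ≈[]E.trans
  (≈[]E.sym (≈[]-weaken (n≤double n) (prod≈[]∏ z Q Q0 (double n))))
  (≈[]E.trans (≈⇒≈[] (prod-double z Q n))
    (*-cong[] (prod≈[]∏ z (Q * Q) Q²0 n) (prod≈[]∏ (z * Q) (Q * Q) Q²0 n)))
  where Q²0 = *-zero-head Q Q Q0

∏-triple : ∀ z Q → Q 0 ≡ + 0 →
  ∏ z Q ≈ ∏ z (Q * Q * Q) * ∏ (z * Q) (Q * Q * Q) * ∏ (z * Q * Q) (Q * Q * Q)
∏-triple z Q Q0 = ≈[]⇒≈ λ n → ≈[]E.trans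
  (≈[]E.sym (≈[]-weaken (n≤triple n) (prod≈[]∏ z Q Q0 (triple n))))
  (≈[]E.trans (≈⇒≈[] (prod-triple z Q n))
    (*-cong[] (*-cong[] (prod≈[]∏ z Q³ Q³0 n) (prod≈[]∏ (z * Q) Q³ Q³0 n)) (prod≈[]∏ (z * Q * Q) Q³ Q³0 n)))
  where
  Q³ = Q * Q * Q
  Q³0 = *-zero-head (Q * Q) Q (*-zero-head Q Q Q0)

prod-conjugate : ∀ z Q M → prod z Q M * prod (- z) Q M ≈ prod (- (z * z)) (Q * Q) M
prod-conjugate z Q zero    = *-identityˡ oneS
prod-conjugate z Q (suc M) = ≈-trans
  (solve 4 (λ a b z y → a :* (con (+ 1) :+ z :* y) :* (b :* (con (+ 1) :+ :- z :* y)) :=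
     a :* b :* (con (+ 1) :+ :- (z :* z) :* (y :* y))) ≈-refl (prod z Q M) (prod (- z) Q M) z (Q ^ M))
  (*-cong (prod-conjugate z Q M) (+-cong ≈-refl (*-cong ≈-refl (≈-sym (*-^ Q Q M)))))

∏-conjugate : ∀ z Q → Q 0 ≡ + 0 → ∏ z Q * ∏ (- z) Q ≈ ∏ (- (z * z)) (Q * Q)
∏-conjugate z Q Q0 = ≈[]⇒≈ λ n → ≈[]E.trans
  (≈[]E.sym (*-cong[] (prod≈[]∏ z Q Q0 n) (prod≈[]∏ (- z) Q Q0 n)))
  (≈[]E.trans (≈⇒≈[] (prod-conjugate z Q n))
    (prod≈[]∏ (- (z * z)) (Q * Q) (*-zero-head Q Q Q0) n))

D-prod : ∀ d z Q M → D d (prod z Q M) ≈ prod (D d z) (D d Q) M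
D-prod d z Q zero    = D-κ d (+ 1)
D-prod d z Q (suc M) = ≈-trans (D-* d (prod z Q M) (oneS + z * Q ^ M))
  (*-cong (D-prod d z Q M) (≈-trans (D-+ d oneS (z * Q ^ M)) (+-cong (D-κ d (+ 1))
    (≈-trans (D-* d z (Q ^ M)) (*-cong ≈-refl (D-^ d Q M))))))

D-∏ : ∀ d z Q → Q 0 ≡ + 0 → D d (∏ z Q) ≈ ∏ (D d z) (D d Q)
D-∏ d z Q Q0 = ≈[]⇒≈ λ n → ≈[]E.trans (D-cong[] d (≈[]E.sym (prod≈[]∏ z Q Q0 n)))
  (≈[]E.trans (≈⇒≈[] (D-prod d z Q n)) (prod≈[]∏ (D d z) (D d Q) Q0 n))

-- The products of Defs

E : ℕ → ℕ → FPS
E a b = ∏ (- X ^ a) (X ^ b)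

-- The fold puts new factors innermost, whereas `prod` appends them on the right; associativity
-- moves the last factor out.
pochFin-suc : ∀ a b M → pochFin a b (suc M) ≈ pochFin a b M * (oneS + - X ^ (a ℕ.+ b ℕ.* M))
pochFin-suc a b M = ≈-trans (mk≈ λ n → cong (λ xs → foldr step oneS xs n) (sym (List.upTo-∷ʳ M)))
  (≈-trans (snoc (upTo M)) (≈-trans (⊗≈* _ _) (*-cong ≈-refl (≈-trans (⊕≈+ _ _) (+-cong ≈-refl
    (≈-trans (mono≈ (ℤ.- + 1) e) (solve 1 (λ x → con (ℤ.- + 1) :* x := :- x) ≈-refl (X ^ e))))))))
  where
  e = a ℕ.+ b ℕ.* M
  factor : ℕ → FPS
  factor m = oneS ⊕ mono (ℤ.- + 1) (a ℕ.+ b ℕ.* m)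
  step : ℕ → FPS → FPS
  step m acc = factor m ⊗ acc
  snoc : ∀ xs → foldr step oneS (xs ++ M ∷ []) ≈ foldr step oneS xs ⊗ factor M
  snoc []       = ⊗-comm (factor M) oneS
  snoc (x ∷ xs) = ≈-trans (⊗-cong {factor x} ≈-refl (snoc xs)) (≈-sym (⊗-assoc (factor x) (foldr step oneS xs) (factor M)))

pochFin≈prod : ∀ a b M → pochFin a b M ≈ prod (- X ^ a) (X ^ b) M
pochFin≈prod a b zero    = ≈-refl
pochFin≈prod a b (suc M) = ≈-trans (pochFin-suc a b M) (*-cong (pochFin≈prod a b M) (+-cong ≈-refl
  (≈-trans (-‿cong (≈-trans (^-+ X a (b ℕ.* M))
    (*-cong ≈-refl (≈-trans (mk≈ λ n → cong (λ k → (X ^ k) n) (ℕ.*-comm b M)) (^-* X M b)))))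
  (solve 2 (λ x y → :- (x :* y) := :- x :* y) ≈-refl (X ^ a) ((X ^ b) ^ M)))))

poch≈E : ∀ a b → poch a b ≈ E a b
poch≈E a b = mk≈ λ n → trans (at (pochFin≈prod a b (suc n)) n) (sym (∏-at (- X ^ a) (X ^ b) n))

X^-head : ∀ a → (X ^ suc a) 0 ≡ + 0
X^-head a = *-zero-head X (X ^ a) refl

-X^-head : ∀ a → (- X ^ suc a) 0 ≡ + 0
-X^-head a = trans (-‿at (X ^ suc a) 0) (cong ℤ.-_ (X^-head a))

E-head : ∀ a b → E (suc a) b 0 ≡ + 1
E-head a b = ∏-head (- X ^ suc a) (X ^ b) (-X^-head a)

D-X^ : ∀ d n → D (suc d) (X ^ n) ≈ X ^ (n ℕ.* suc d)
D-X^ d n = ≈-trans (D-^ (suc d) X n) (≈-trans (^-cong n (D-X d)) (≈-sym (^-* X n (suc d))))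

D-E : ∀ d a b → D (suc d) (E a (suc b)) ≈ E (a ℕ.* suc d) (suc b ℕ.* suc d)
D-E d a b = ≈-trans (D-∏ (suc d) (- X ^ a) (X ^ suc b) (X^-head b))
  (∏-cong (≈-trans (D-‿- (suc d) (X ^ a)) (-‿cong (D-X^ d a))) (D-X^ d (suc b)))

private
  -X^-* : ∀ a b → - X ^ a * X ^ b ≈ - X ^ (a ℕ.+ b)
  -X^-* a b = ≈-trans (solve 2 (λ x y → :- x :* y := :- (x :* y)) ≈-refl (X ^ a) (X ^ b))
                      (-‿cong (≈-sym (^-+ X a b)))

E-double : ∀ a b → E a (suc b) ≈ E a (suc b ℕ.+ suc b) * E (a ℕ.+ suc b) (suc b ℕ.+ suc b)
E-double a b = ≈-trans (∏-double (- X ^ a) (X ^ suc b) (X^-head b))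
  (*-cong (∏-cong ≈-refl Q²) (∏-cong (-X^-* a (suc b)) Q²))
  where Q² = ≈-sym (^-+ X (suc b) (suc b))

E-triple : ∀ a b → let c = suc b ℕ.+ suc b ℕ.+ suc b in
  E a (suc b) ≈ E a c * E (a ℕ.+ suc b) c * E (a ℕ.+ suc b ℕ.+ suc b) c
E-triple a b = ≈-trans (∏-triple (- X ^ a) (X ^ suc b) (X^-head b))
  (*-cong (*-cong (∏-cong ≈-refl Q³) (∏-cong (-X^-* a (suc b)) Q³))
    (∏-cong (≈-trans (*-cong (-X^-* a (suc b)) ≈-refl) (-X^-* (a ℕ.+ suc b) (suc b))) Q³))
  where Q³ = ≈-sym (≈-trans (^-+ X (suc b ℕ.+ suc b) (suc b)) (*-cong (^-+ X (suc b) (suc b)) ≈-refl))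

-- Trisection of series: weave A B C = A(q³) + q B(q³) + q² C(q³).

weave : FPS → FPS → FPS → FPS
weave A B C = D 3 A + X * D 3 B + X * X * D 3 C

sect : ℕ → FPS → FPS
sect i f n = f (i ℕ.+ triple n)

private
  -- `weave` with the powers of q absorbed into the delays of `stretch`. Three coefficients further
  -- on it reduces to itself on the tails, so sections are read off by plain recursion.
  w : FPS → FPS → FPS → ℕ → ℤ
  w A B C n = stretch 2 0 A n ℤ.+ stretch 2 1 B n ℤ.+ stretch 2 2 C n

  weave≡w : ∀ A B C n → weave A B C n ≡ w A B C n
  weave≡w A B C n = trans (at (+-cong (+-cong ≈-refl (≈-sym (stretch-suc 2 0 B)))
      (≈-sym (≈-trans (stretch-suc 2 1 C) (≈-trans (*-cong ≈-refl (stretch-suc 2 0 C)) (≈-sym (*-assoc X X (D 3 C))))))) n)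
    (trans (+-at (D 3 A + stretch 2 1 B) (stretch 2 2 C) n)
      (cong (λ x → x ℤ.+ stretch 2 2 C n) (+-at (D 3 A) (stretch 2 1 B) n)))

  split≡w : ∀ f n → f n ≡ w (sect 0 f) (sect 1 f) (sect 2 f) n
  split≡w f zero                = sym (trans (ℤ.+-identityʳ _) (ℤ.+-identityʳ _))
  split≡w f (suc zero)          = sym (trans (ℤ.+-identityʳ _) (ℤ.+-identityˡ _))
  split≡w f (suc (suc zero))    = sym (ℤ.+-identityˡ _)
  split≡w f (suc (suc (suc n))) = split≡w (tail (tail (tail f))) n

  w-0 : ∀ A B C n → w A B C (triple n) ≡ A n
  w-0 A B C zero    = trans (ℤ.+-identityʳ _) (ℤ.+-identityʳ _)
  w-0 A B C (suc n) = w-0 (tail A) (tail B) (tail C) n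

  w-1 : ∀ A B C n → w A B C (1 ℕ.+ triple n) ≡ B n
  w-1 A B C zero    = trans (ℤ.+-identityʳ _) (ℤ.+-identityˡ _)
  w-1 A B C (suc n) = w-1 (tail A) (tail B) (tail C) n

  w-2 : ∀ A B C n → w A B C (2 ℕ.+ triple n) ≡ C n
  w-2 A B C zero    = ℤ.+-identityˡ _
  w-2 A B C (suc n) = w-2 (tail A) (tail B) (tail C) n

≈weave-sect : ∀ f → f ≈ weave (sect 0 f) (sect 1 f) (sect 2 f)
≈weave-sect f = mk≈ λ n → trans (split≡w f n) (sym (weave≡w _ _ _ n))

module _ {f A B C : FPS} (p : f ≈ weave A B C) where
  sect₀ : sect 0 f ≈ A
  sect₀ = mk≈ λ n → trans (at p (triple n)) (trans (weave≡w A B C (triple n)) (w-0 A B C n))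

  sect₁ : sect 1 f ≈ B
  sect₁ = mk≈ λ n → trans (at p (1 ℕ.+ triple n)) (trans (weave≡w A B C (1 ℕ.+ triple n)) (w-1 A B C n))

  sect₂ : sect 2 f ≈ C
  sect₂ = mk≈ λ n → trans (at p (2 ℕ.+ triple n)) (trans (weave≡w A B C (2 ℕ.+ triple n)) (w-2 A B C n))

weave-0 : ∀ A → D 3 A ≈ weave A zeroS zeroS
weave-0 A = ≈-sym (≈-trans (+-cong (+-cong ≈-refl (*-cong ≈-refl (D-κ 3 (+ 0)))) (*-cong ≈-refl (D-κ 3 (+ 0))))
  (solve 2 (λ a x → a :+ x :* con (+ 0) :+ x :* x :* con (+ 0) := a) ≈-refl (D 3 A) X))

D-injective : ∀ {A B} → D 3 A ≈ D 3 B → A ≈ B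
D-injective {A} {B} p = ≈-trans (≈-sym (sect₀ (weave-0 A))) (sect₀ (≈-trans p (weave-0 B)))

sect-cong[] : ∀ i {n f g} → i ℕ.≤ 2 → f ≈[ triple n ] g → sect i f ≈[ n ] sect i g
sect-cong[] i {n} i≤2 p = mk≈[] λ k k<n → below p (i ℕ.+ triple k)
  (ℕ.≤-trans (s≤s (ℕ.+-monoˡ-≤ (triple k) i≤2)) (triple-mono k<n))
  where
  triple-mono : ∀ {k n} → k ℕ.< n → 3 ℕ.+ triple k ℕ.≤ triple n
  triple-mono {zero}  (s≤s z≤n) = s≤s (s≤s (s≤s z≤n))
  triple-mono {suc k} (s≤s (s≤s p)) = s≤s (s≤s (s≤s (triple-mono (s≤s p))))

sect-cong : ∀ i {f g} → f ≈ g → sect i f ≈ sect i g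
sect-cong i p = mk≈ λ n → at p (i ℕ.+ triple n)

D-X³ : D 3 X ≈ X * X * X
D-X³ = ≈-trans (D-X 2) (solve 1 (λ x → x :* (x :* (x :* con (+ 1))) := x :* x :* x) ≈-refl X)

private
  D-+³ : ∀ A B C → D 3 (A + B + C) ≈ D 3 A + D 3 B + D 3 C
  D-+³ A B C = ≈-trans (D-+ 3 (A + B) C) (+-cong (D-+ 3 A B) ≈-refl)

  D-X* : ∀ A B → D 3 (X * (A * B)) ≈ X * X * X * (D 3 A * D 3 B)
  D-X* A B = ≈-trans (D-* 3 X (A * B)) (*-cong D-X³ (D-* 3 A B))

weave-* : ∀ A B C A′ B′ C′ → weave A B C * weave A′ B′ C′ ≈
  weave (A * A′ + X * (B * C′) + X * (C * B′)) (A * B′ + B * A′ + X * (C * C′)) (A * C′ + B * B′ + C * A′)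
weave-* A B C A′ B′ C′ = ≈-trans
  (solve 7 (λ X a b c a′ b′ c′ →
     (a :+ X :* b :+ X :* X :* c) :* (a′ :+ X :* b′ :+ X :* X :* c′) :=
     (a :* a′ :+ X :* X :* X :* (b :* c′) :+ X :* X :* X :* (c :* b′))
     :+ X :* (a :* b′ :+ b :* a′ :+ X :* X :* X :* (c :* c′))
     :+ X :* X :* (a :* c′ :+ b :* b′ :+ c :* a′)) ≈-refl X (D 3 A) (D 3 B) (D 3 C) (D 3 A′) (D 3 B′) (D 3 C′))
  (≈-sym (+-cong (+-cong
    (≈-trans (D-+³ _ _ _) (+-cong (+-cong (D-* 3 A A′) (D-X* B C′)) (D-X* C B′)))
    (*-cong ≈-refl (≈-trans (D-+³ _ _ _) (+-cong (+-cong (D-* 3 A B′) (D-* 3 B A′)) (D-X* C C′)))))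
    (*-cong ≈-refl (≈-trans (D-+³ _ _ _) (+-cong (+-cong (D-* 3 A C′) (D-* 3 B B′)) (D-* 3 C A′))))))

weave-cong : ∀ {A A′ B B′ C C′} → A ≈ A′ → B ≈ B′ → C ≈ C′ → weave A B C ≈ weave A′ B′ C′
weave-cong p q r = +-cong (+-cong (D-cong 3 p) (*-cong ≈-refl (D-cong 3 q))) (*-cong ≈-refl (D-cong 3 r))

-- Extracting the exponents divisible by 3 is linear over series in q³. This is why a denominator
-- should first be turned into such a series.
sect₀-D* : ∀ A f → sect 0 (D 3 A * f) ≈ A * sect 0 f
sect₀-D* A f = ≈-trans (sect₀ (≈-trans (*-cong (weave-0 A) (≈weave-sect f)) (weave-* _ _ _ _ _ _)))
  (solve 5 (λ X a f g h → a :* f :+ X :* (con (+ 0) :* h) :+ X :* (con (+ 0) :* g) := a :* f) ≈-refl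
    X A (sect 0 f) (sect 1 f) (sect 2 f))

-- The norm from ℤ[[q]] to ℤ[[q³]], as a series in q³; conj f is the product of the two
-- conjugates f(ωq) and f(ω²q).

normOf : FPS → FPS → FPS → FPS
normOf A B C = A * A * A + X * (B * B * B) + X * X * (C * C * C) + - (κ (+ 3) * X * (A * B * C))

norm : FPS → FPS
norm f = normOf (sect 0 f) (sect 1 f) (sect 2 f)

-- With a = A(q³), b = qB(q³), c = q²C(q³), the product (a + ωb + ω²c)(a + ω²b + ωc) equals a² + b²
-- + c² - ab - bc - ca, free of ω. Sorting by exponents modulo 3 gives the three entries.
conjOf : FPS → FPS → FPS → FPS
conjOf A B C = weave (A * A + - (X * (B * C))) (X * (C * C) + - (A * B)) (B * B + - (A * C))

conj : FPS → FPS
conj f = conjOf (sect 0 f) (sect 1 f) (sect 2 f)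

conjOf-cong : ∀ {A A′ B B′ C C′} → A ≈ A′ → B ≈ B′ → C ≈ C′ → conjOf A B C ≈ conjOf A′ B′ C′
conjOf-cong p q r = weave-cong (+-cong (*-cong p p) (-‿cong (*-cong ≈-refl (*-cong q r))))
  (+-cong (*-cong ≈-refl (*-cong r r)) (-‿cong (*-cong p q))) (+-cong (*-cong q q) (-‿cong (*-cong p r)))

normOf-cong : ∀ {A A′ B B′ C C′} → A ≈ A′ → B ≈ B′ → C ≈ C′ → normOf A B C ≈ normOf A′ B′ C′
normOf-cong p q r = +-cong (+-cong (+-cong (*-cong (*-cong p p) p) (*-cong ≈-refl (*-cong (*-cong q q) q)))
  (*-cong ≈-refl (*-cong (*-cong r r) r))) (-‿cong (*-cong ≈-refl (*-cong (*-cong p q) r)))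

norm-weave : ∀ {f A B C} → f ≈ weave A B C → norm f ≈ normOf A B C
norm-weave p = normOf-cong (sect₀ p) (sect₁ p) (sect₂ p)

norm-cong : ∀ {f g} → f ≈ g → norm f ≈ norm g
norm-cong p = normOf-cong (sect-cong 0 p) (sect-cong 1 p) (sect-cong 2 p)

*-conj : ∀ f → f * conj f ≈ D 3 (norm f)
*-conj f = ≈-trans (*-cong (≈weave-sect f) ≈-refl) (≈-trans (weave-* A B C _ _ _) (≈-trans
  (weave-cong
    (solve 4 (λ X A B C → A :* (A :* A :- X :* (B :* C)) :+ X :* (B :* (B :* B :- A :* C)) :+
       X :* (C :* (X :* (C :* C) :- A :* B)) :=
       A :* A :* A :+ X :* (B :* B :* B) :+ X :* X :* (C :* C :* C) :- con (+ 3) :* X :* (A :* B :* C)) ≈-refl X A B C)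
    (solve 4 (λ X A B C → A :* (X :* (C :* C) :- A :* B) :+ B :* (A :* A :- X :* (B :* C)) :+
       X :* (C :* (B :* B :- A :* C)) := con (+ 0)) ≈-refl X A B C)
    (solve 4 (λ X A B C → A :* (B :* B :- A :* C) :+ B :* (X :* (C :* C) :- A :* B) :+
       C :* (A :* A :- X :* (B :* C)) := con (+ 0)) ≈-refl X A B C))
  (≈-sym (weave-0 (norm f)))))
  where
  A = sect 0 f
  B = sect 1 f
  C = sect 2 f

conj-* : ∀ f g → conj (f * g) ≈ conj f * conj g
conj-* f g = ≈-trans (conjOf-cong (sect₀ fg) (sect₁ fg) (sect₂ fg)) (≈-trans
  (weave-cong
    (solve 7 (λ X A B C a b c →
      (A :* a :+ X :* (B :* c) :+ X :* (C :* b)) :* (A :* a :+ X :* (B :* c) :+ X :* (C :* b))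
        :- X :* ((A :* b :+ B :* a :+ X :* (C :* c)) :* (A :* c :+ B :* b :+ C :* a)) :=
      (A :* A :- X :* (B :* C)) :* (a :* a :- X :* (b :* c))
        :+ X :* ((X :* (C :* C) :- A :* B) :* (b :* b :- a :* c))
        :+ X :* ((B :* B :- A :* C) :* (X :* (c :* c) :- a :* b))) ≈-refl X A B C a b c)
    (solve 7 (λ X A B C a b c →
      X :* ((A :* c :+ B :* b :+ C :* a) :* (A :* c :+ B :* b :+ C :* a))
        :- (A :* a :+ X :* (B :* c) :+ X :* (C :* b)) :* (A :* b :+ B :* a :+ X :* (C :* c)) :=
      (A :* A :- X :* (B :* C)) :* (X :* (c :* c) :- a :* b)
        :+ (X :* (C :* C) :- A :* B) :* (a :* a :- X :* (b :* c))
        :+ X :* ((B :* B :- A :* C) :* (b :* b :- a :* c))) ≈-refl X A B C a b c)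
    (solve 7 (λ X A B C a b c →
      (A :* b :+ B :* a :+ X :* (C :* c)) :* (A :* b :+ B :* a :+ X :* (C :* c))
        :- (A :* a :+ X :* (B :* c) :+ X :* (C :* b)) :* (A :* c :+ B :* b :+ C :* a) :=
      (A :* A :- X :* (B :* C)) :* (b :* b :- a :* c)
        :+ (X :* (C :* C) :- A :* B) :* (X :* (c :* c) :- a :* b)
        :+ (B :* B :- A :* C) :* (a :* a :- X :* (b :* c))) ≈-refl X A B C a b c))
  (≈-sym (weave-* _ _ _ _ _ _)))
  where
  A = sect 0 f
  B = sect 1 f
  C = sect 2 f
  a = sect 0 g
  b = sect 1 g
  c = sect 2 g
  fg : f * g ≈ weave (A * a + X * (B * c) + X * (C * b)) (A * b + B * a + X * (C * c)) (A * c + B * b + C * a)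
  fg = ≈-trans (*-cong (≈weave-sect f) (≈weave-sect g)) (weave-* A B C a b c)

-- Multiplicativity of the conjugate and injectivity of q ↦ q³ reduce this to rearranging four
-- factors; the cubic forms themselves are never expanded.
norm-* : ∀ f g → norm (f * g) ≈ norm f * norm g
norm-* f g = D-injective (begin
  D 3 (norm (f * g))                  ≈⟨ *-conj (f * g) ⟨
  f * g * conj (f * g)                ≈⟨ *-cong ≈-refl (conj-* f g) ⟩
  f * g * (conj f * conj g)           ≈⟨ solve 4 (λ f g a b → f :* g :* (a :* b) := f :* a :* (g :* b)) ≈-refl f g (conj f) (conj g) ⟩
  f * conj f * (g * conj g)           ≈⟨ *-cong (*-conj f) (*-conj g) ⟩
  D 3 (norm f) * D 3 (norm g)         ≈⟨ D-* 3 (norm f) (norm g) ⟨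
  D 3 (norm f * norm g)               ∎)
  where open ≈R

norm-cong[] : ∀ {n f g} → f ≈[ triple n ] g → norm f ≈[ n ] norm g
norm-cong[] {n} {f} {g} p = +-cong[] (+-cong[] (+-cong[] (*-cong[] (*-cong[] a a) a)
  (*-cong[] ≈[]E.refl (*-cong[] (*-cong[] b b) b))) (*-cong[] ≈[]E.refl (*-cong[] (*-cong[] c c) c)))
  (-‿cong[] (*-cong[] ≈[]E.refl (*-cong[] (*-cong[] a b) c)))
  where
  a : sect 0 f ≈[ n ] sect 0 g
  a = sect-cong[] 0 z≤n p
  b : sect 1 f ≈[ n ] sect 1 g
  b = sect-cong[] 1 (s≤s z≤n) p
  c : sect 2 f ≈[ n ] sect 2 g
  c = sect-cong[] 2 (s≤s (s≤s z≤n)) p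

norm-one : norm oneS ≈ oneS
norm-one = ≈-trans (norm-weave (≈-trans (≈-sym (D-κ 3 (+ 1))) (weave-0 oneS)))
  (solve 1 (λ X → con (+ 1) :* con (+ 1) :* con (+ 1) :+ X :* (con (+ 0) :* con (+ 0) :* con (+ 0))
     :+ X :* X :* (con (+ 0) :* con (+ 0) :* con (+ 0)) :- con (+ 3) :* X :* (con (+ 1) :* con (+ 0) :* con (+ 0))
     := con (+ 1)) ≈-refl X)

norm-D : ∀ A → norm (D 3 A) ≈ A * A * A
norm-D A = ≈-trans (norm-weave (weave-0 A))
  (solve 2 (λ X a → a :* a :* a :+ X :* (con (+ 0) :* con (+ 0) :* con (+ 0))
     :+ X :* X :* (con (+ 0) :* con (+ 0) :* con (+ 0)) :- con (+ 3) :* X :* (a :* con (+ 0) :* con (+ 0))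
     := a :* a :* a) ≈-refl X A)

-- Holds for z = −q^j with 3 ∤ j.
record Inert (z : FPS) : Set where
  constructor inert
  field norm-factor : ∀ Y → norm (oneS + z * D 3 Y) ≈ oneS + z * (Y * Y * Y)
open Inert

Inert-resp : ∀ {z z′} → z ≈ z′ → Inert z → Inert z′
Inert-resp p (inert h) = inert λ Y → ≈-trans (norm-cong (+-cong ≈-refl (*-cong (≈-sym p) ≈-refl)))
  (≈-trans (h Y) (+-cong ≈-refl (*-cong p ≈-refl)))

private
  inert-by-weave : ∀ {z} (B C : FPS → FPS) → (∀ Y → oneS + z * D 3 Y ≈ D 3 oneS + X * D 3 (B Y) + X * X * D 3 (C Y)) →
                   (∀ Y → normOf oneS (B Y) (C Y) ≈ oneS + z * (Y * Y * Y)) → Inert z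
  inert-by-weave B C p q = inert λ Y → ≈-trans (norm-weave (p Y)) (q Y)

-- With y = Y(q³), the factors 1 - qy, 1 - ωqy and 1 - ω²qy multiply to 1 - q³y³; read as a series
-- in q³ this is 1 - qY³.
inert-X : Inert (- X)
inert-X = inert-by-weave (λ Y → - Y) (λ _ → zeroS)
  (λ Y → ≈-trans (solve 2 (λ x y → con (+ 1) :+ :- x :* y := con (+ 1) :+ x :* :- y :+ x :* x :* con (+ 0)) ≈-refl X (D 3 Y))
    (≈-sym (+-cong (+-cong (D-κ 3 (+ 1)) (*-cong ≈-refl (D-‿- 3 Y))) (*-cong ≈-refl (D-κ 3 (+ 0))))))
  (λ Y → solve 2 (λ X y → con (+ 1) :* con (+ 1) :* con (+ 1) :+ X :* (:- y :* :- y :* :- y)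
     :+ X :* X :* (con (+ 0) :* con (+ 0) :* con (+ 0)) :- con (+ 3) :* X :* (con (+ 1) :* :- y :* con (+ 0))
     := con (+ 1) :+ :- X :* (y :* y :* y)) ≈-refl X Y)

inert-X² : Inert (- (X * X))
inert-X² = inert-by-weave (λ _ → zeroS) (λ Y → - Y)
  (λ Y → ≈-trans (solve 2 (λ x y → con (+ 1) :+ :- (x :* x) :* y := con (+ 1) :+ x :* con (+ 0) :+ x :* x :* :- y) ≈-refl X (D 3 Y))
    (≈-sym (+-cong (+-cong (D-κ 3 (+ 1)) (*-cong ≈-refl (D-κ 3 (+ 0)))) (*-cong ≈-refl (D-‿- 3 Y)))))
  (λ Y → solve 2 (λ X y → con (+ 1) :* con (+ 1) :* con (+ 1) :+ X :* (con (+ 0) :* con (+ 0) :* con (+ 0))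
     :+ X :* X :* (:- y :* :- y :* :- y) :- con (+ 3) :* X :* (con (+ 1) :* con (+ 0) :* :- y)
     := con (+ 1) :+ :- (X :* X) :* (y :* y :* y)) ≈-refl X Y)

-- The exponent 4 = 1 + 3 lies in class 1, and the extra q³ becomes a factor `X` inside the section.
inert-X⁴ : Inert (- (X * X * X * X))
inert-X⁴ = inert-by-weave (λ Y → - (X * Y)) (λ _ → zeroS)
  (λ Y → ≈-trans (solve 2 (λ x y → con (+ 1) :+ :- (x :* x :* x :* x) :* y :=
       con (+ 1) :+ x :* :- (x :* x :* x :* y) :+ x :* x :* con (+ 0)) ≈-refl X (D 3 Y))
    (≈-sym (+-cong (+-cong (D-κ 3 (+ 1)) (*-cong ≈-refl (≈-trans (D-‿- 3 (X * Y))
      (-‿cong (≈-trans (D-* 3 X Y) (*-cong D-X³ ≈-refl)))))) (*-cong ≈-refl (D-κ 3 (+ 0))))))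
  (λ Y → solve 2 (λ X y → con (+ 1) :* con (+ 1) :* con (+ 1) :+ X :* (:- (X :* y) :* :- (X :* y) :* :- (X :* y))
     :+ X :* X :* (con (+ 0) :* con (+ 0) :* con (+ 0)) :- con (+ 3) :* X :* (con (+ 1) :* :- (X :* y) :* con (+ 0))
     := con (+ 1) :+ :- (X :* X :* X :* X) :* (y :* y :* y)) ≈-refl X Y)

-- Norms of infinite products

norm-prod-inert : ∀ {z} Q → Inert z → ∀ M → norm (prod z (D 3 Q) M) ≈ prod z (Q * Q * Q) M
norm-prod-inert Q h zero    = norm-one
norm-prod-inert {z} Q h (suc M) = ≈-trans (norm-* (prod z (D 3 Q) M) _) (*-cong (norm-prod-inert Q h M)
  (≈-trans (norm-cong (+-cong ≈-refl (*-cong ≈-refl (≈-sym (D-^ 3 Q M)))))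
  (≈-trans (norm-factor h (Q ^ M)) (+-cong ≈-refl (*-cong ≈-refl
    (≈-sym (≈-trans (*-^ (Q * Q) Q M) (*-cong (*-^ Q Q M) ≈-refl))))))))

cube : FPS → FPS
cube f = f * f * f

norm-prod-D : ∀ z Q M → norm (prod (D 3 z) (D 3 Q) M) ≈ cube (prod z Q M)
norm-prod-D z Q M = ≈-trans (norm-cong (≈-sym (D-prod 3 z Q M))) (norm-D (prod z Q M))

-- Distribute the factors over the classes z, zQ, zQ² modulo Q³. The first two classes are inert and
-- their products reappear unchanged; the third is a series in q³, so its norm is a cube. That third
-- class is also `D 3 (∏ z Q)`, and multiplying by it completes the splitting of `∏ z Q`.
norm-∏ : ∀ {z Q} → Q 0 ≡ + 0 → D 3 Q ≈ Q * Q * Q → D 3 z ≈ z * Q * Q → Inert z → Inert (z * Q) →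
  norm (∏ z Q) * D 3 (∏ z Q) ≈ cube (∏ z Q) * ∏ z Q
norm-∏ {z} {Q} Q0 DQ Dz inert₁ inert₂ = begin
  norm (∏ z Q) * D 3 (∏ z Q)
    ≈⟨ *-cong (≈[]⇒≈ norm≈) (≈-trans (D-∏ 3 z Q Q0) (∏-cong Dz DQ)) ⟩
  ∏ z Q³ * ∏ (z * Q) Q³ * cube (∏ z Q) * ∏ (z * Q * Q) Q³
    ≈⟨ solve 4 (λ a b c d → a :* b :* c :* d := c :* (a :* b :* d)) ≈-refl _ _ _ _ ⟩
  cube (∏ z Q) * (∏ z Q³ * ∏ (z * Q) Q³ * ∏ (z * Q * Q) Q³)
    ≈⟨ *-cong ≈-refl (∏-triple z Q Q0) ⟨
  cube (∏ z Q) * ∏ z Q ∎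
  where
  open ≈R
  Q³ = Q * Q * Q
  Q³0 = *-zero-head (Q * Q) Q (*-zero-head Q Q Q0)
  finite : ∀ n → norm (prod z Q (triple n)) ≈ prod z Q³ n * prod (z * Q) Q³ n * cube (prod z Q n)
  finite n = ≈-trans (norm-cong (≈-trans (prod-triple z Q n)
      (*-cong (*-cong (prod-cong ≈-refl (≈-sym DQ) n) (prod-cong ≈-refl (≈-sym DQ) n)) (prod-cong (≈-sym Dz) (≈-sym DQ) n))))
    (≈-trans (norm-* _ _) (*-cong
      (≈-trans (norm-* _ _) (*-cong (norm-prod-inert Q inert₁ n) (norm-prod-inert Q inert₂ n)))
      (norm-prod-D z Q n)))
  norm≈ : ∀ n → norm (∏ z Q) ≈[ n ] ∏ z Q³ * ∏ (z * Q) Q³ * cube (∏ z Q)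
  norm≈ n = ≈[]E.trans (norm-cong[] (≈[]E.sym (prod≈[]∏ z Q Q0 (triple n))))
    (≈[]E.trans (≈⇒≈[] (finite n)) (*-cong[] (*-cong[] (prod≈[]∏ z Q³ Q³0 n) (prod≈[]∏ (z * Q) Q³ Q³0 n))
      (*-cong[] (*-cong[] p p) p)))
    where p = prod≈[]∏ z Q Q0 n

norm-E₁ : norm (E 1 1) * E 3 3 ≈ cube (E 1 1) * E 1 1
norm-E₁ = ≈-trans (*-cong ≈-refl (≈-sym (D-E 2 1 0))) (norm-∏ (X^-head 0)
  (≈-trans (D-X^ 2 1) (solve 1 (λ x → x :* (x :* (x :* con (+ 1))) := let y = x :* con (+ 1) in y :* y :* y) ≈-refl X))
  (≈-trans (D-‿- 3 (X ^ 1)) (≈-trans (-‿cong (D-X^ 2 1))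
    (solve 1 (λ x → :- (x :* (x :* (x :* con (+ 1)))) := let y = x :* con (+ 1) in :- y :* y :* y) ≈-refl X)))
  (Inert-resp (solve 1 (λ x → :- x := :- (x :* con (+ 1))) ≈-refl X) inert-X)
  (Inert-resp (solve 1 (λ x → :- (x :* x) := :- (x :* con (+ 1)) :* (x :* con (+ 1))) ≈-refl X) inert-X²))

norm-E₂ : norm (E 2 2) * E 6 6 ≈ cube (E 2 2) * E 2 2
norm-E₂ = ≈-trans (*-cong ≈-refl (≈-sym (D-E 2 2 1))) (norm-∏ (X^-head 1)
  (≈-trans (D-X^ 2 2) (solve 1 (λ x → let y = x :* (x :* con (+ 1)) in
     x :* (x :* (x :* (x :* (x :* (x :* con (+ 1)))))) := y :* y :* y) ≈-refl X))
  (≈-trans (D-‿- 3 (X ^ 2)) (≈-trans (-‿cong (D-X^ 2 2)) (solve 1 (λ x → let y = x :* (x :* con (+ 1)) in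
     :- (x :* (x :* (x :* (x :* (x :* (x :* con (+ 1))))))) := :- y :* y :* y) ≈-refl X)))
  (Inert-resp (solve 1 (λ x → :- (x :* x) := :- (x :* (x :* con (+ 1)))) ≈-refl X) inert-X²)
  (Inert-resp (solve 1 (λ x → let y = x :* (x :* con (+ 1)) in :- (x :* x :* x :* x) := :- y :* y) ≈-refl X) inert-X⁴))

-- Partial theta series and the Jacobi triple product

-- term z Q n = zⁿ Q^(n(n−1)/2)
term : FPS → FPS → ℕ → FPS
term z Q zero    = oneS
term z Q (suc n) = z * Q ^ n * term z Q n

thetaSum : FPS → FPS → ℕ → FPS
thetaSum z Q zero    = zeroS
thetaSum z Q (suc M) = thetaSum z Q M + term z Q M

+-identityʳ-≈ : ∀ f → f + zeroS ≈ f
+-identityʳ-≈ = solve 1 (λ f → f :+ con (+ 0) := f) ≈-refl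

term-order : ∀ z Q → z 0 ≡ + 0 → ∀ n → term z Q n ≈[ n ] zeroS
term-order z Q z0 zero    = mk≈[] λ _ ()
term-order z Q z0 (suc n) = ≈[]E.trans (*-order 1 n zQ≈0 (term-order z Q z0 n)) (zero[]-* (z * Q ^ n) ≈[]E.refl)
  where
  zQ≈0 : z * Q ^ n ≈[ 1 ] zeroS
  zQ≈0 = mk≈[] λ { zero _ → *-zero-head z (Q ^ n) z0 ; (suc _) (s≤s ()) }

opaque
  -- The half n ≥ 0 of a theta series. If zw = Q, the term of index -n is wⁿ Q^(n(n-1)/2), so the
  -- two-sided series is `Θ z Q` plus `Θ w Q`, less the doubly counted term 1.
  Θ : FPS → FPS → FPS
  Θ z Q n = thetaSum z Q (suc n) n

  Θ-at : ∀ z Q n → Θ z Q n ≡ thetaSum z Q (suc n) n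
  Θ-at z Q n = refl

  thetaSum≈[]Θ : ∀ z Q → z 0 ≡ + 0 → ∀ n → thetaSum z Q n ≈[ n ] Θ z Q
  thetaSum≈[]Θ z Q z0 = ≈[]-lim (thetaSum z Q) λ n → ≈[]E.trans
    (≈⇒≈[] (≈-sym (+-identityʳ-≈ (thetaSum z Q n))))
    (+-cong[] ≈[]E.refl (≈[]E.sym (term-order z Q z0 n)))

-- Sums over antidiagonals

opaque
  -- Both indices of p + r = n are passed on, so that the symmetric denominators of Gaussian
  -- binomials need no truncated subtraction.
  antidiagonal : ℕ → (ℕ → ℕ → FPS) → FPS
  antidiagonal zero    f = f 0 0
  antidiagonal (suc n) f = f 0 (suc n) + antidiagonal n (λ p r → f (suc p) r)

  antidiagonal-zero : ∀ f → antidiagonal 0 f ≈ f 0 0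
  antidiagonal-zero f = ≈-refl

  antidiagonal-suc : ∀ n f → antidiagonal (suc n) f ≈ f 0 (suc n) + antidiagonal n (λ p r → f (suc p) r)
  antidiagonal-suc n f = ≈-refl

  antidiagonal-cong[] : ∀ {m} n {f g} → (∀ p r → p ℕ.+ r ≡ n → f p r ≈[ m ] g p r) →
                        antidiagonal n f ≈[ m ] antidiagonal n g
  antidiagonal-cong[] zero    p = p 0 0 refl
  antidiagonal-cong[] (suc n) p = +-cong[] (p 0 (suc n) refl)
    (antidiagonal-cong[] n λ i j i+j → p (suc i) j (cong suc i+j))

  antidiagonal-cong : ∀ n {f g} → (∀ p r → f p r ≈ g p r) → antidiagonal n f ≈ antidiagonal n g
  antidiagonal-cong n p = ≈[]⇒≈ λ m → antidiagonal-cong[] n λ i j _ → ≈⇒≈[] (p i j)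

  antidiagonal-+ : ∀ n f g → antidiagonal n (λ p r → f p r + g p r) ≈ antidiagonal n f + antidiagonal n g
  antidiagonal-+ zero    f g = ≈-refl
  antidiagonal-+ (suc n) f g = ≈-trans (+-cong ≈-refl (antidiagonal-+ n (λ p r → f (suc p) r) (λ p r → g (suc p) r)))
    (solve 4 (λ a b c d → a :+ b :+ (c :+ d) := a :+ c :+ (b :+ d)) ≈-refl (f 0 (suc n)) (g 0 (suc n)) _ _)

  antidiagonal-* : ∀ n c f → c * antidiagonal n f ≈ antidiagonal n (λ p r → c * f p r)
  antidiagonal-* zero    c f = ≈-refl
  antidiagonal-* (suc n) c f = ≈-trans
    (solve 3 (λ c a b → c :* (a :+ b) := c :* a :+ c :* b) ≈-refl c (f 0 (suc n)) _)
    (+-cong ≈-refl (antidiagonal-* n c (λ p r → f (suc p) r)))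

  antidiagonal-^ : ∀ Q n f → Q ^ n * antidiagonal n f ≈ antidiagonal n (λ p r → Q ^ p * Q ^ r * f p r)
  antidiagonal-^ Q zero    f = *-cong (≈-sym (*-identityˡ oneS)) ≈-refl
  antidiagonal-^ Q (suc n) f = ≈-trans
    (solve 4 (λ q y a b → q :* y :* (a :+ b) := con (+ 1) :* (q :* y) :* a :+ q :* (y :* b)) ≈-refl Q (Q ^ n) (f 0 (suc n)) _)
    (+-cong ≈-refl (≈-trans (*-cong ≈-refl (antidiagonal-^ Q n (λ p r → f (suc p) r)))
      (≈-trans (antidiagonal-* n Q _) (antidiagonal-cong n λ p r →
        solve 4 (λ q a b c → q :* (a :* b :* c) := q :* a :* b :* c) ≈-refl Q (Q ^ p) (Q ^ r) (f (suc p) r)))))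

  antidiagonal-snoc : ∀ n f → antidiagonal (suc n) f ≈ antidiagonal n (λ p r → f p (suc r)) + f (suc n) 0
  antidiagonal-snoc zero    f = ≈-refl
  antidiagonal-snoc (suc n) f = ≈-trans (+-cong ≈-refl (antidiagonal-snoc n (λ p r → f (suc p) r)))
    (solve 3 (λ a b c → a :+ (b :+ c) := a :+ b :+ c) ≈-refl (f 0 (2 ℕ.+ n)) _ (f (2 ℕ.+ n) 0))

-- The factor `w` plays the role of Q/z. A finite form with i factors in `w` and j factors in `z` is
-- proved exactly, and then i = j = M tends to infinity.
module TripleProduct (z w Q : FPS) (zw : z * w ≈ Q) (z0 : z 0 ≡ + 0) (w0 : w 0 ≡ + 0) where

  private
    Q0 : Q 0 ≡ + 0
    Q0 = trans (sym (at zw 0)) (*-zero-head z w z0)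

    -Q0 : (- Q) 0 ≡ + 0
    -Q0 = trans (-‿at Q 0) (cong ℤ.-_ Q0)

    F I : ℕ → FPS
    F n = prod (- Q) Q n
    I n = invS (F n)

    F*I : ∀ n → F n * I n ≈ oneS
    F*I n = *-invS (F n) (prod-head (- Q) Q -Q0 n)

    I-step : ∀ n → (oneS + - Q ^ suc n) * I (suc n) ≈ I n
    I-step n = begin
      (oneS + - (Q * Q ^ n)) * I (suc n)
        ≈⟨ *-identityˡ _ ⟨
      oneS * ((oneS + - (Q * Q ^ n)) * I (suc n))
        ≈⟨ *-cong (F*I n) ≈-refl ⟨
      F n * I n * ((oneS + - (Q * Q ^ n)) * I (suc n))
        ≈⟨ solve 5 (λ f i q y j → f :* i :* ((con (+ 1) :- q :* y) :* j) := i :* (f :* (con (+ 1) :+ :- q :* y) :* j))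
             ≈-refl (F n) (I n) Q (Q ^ n) (I (suc n)) ⟩
      I n * (F (suc n) * I (suc n))
        ≈⟨ *-cong ≈-refl (F*I (suc n)) ⟩
      I n * oneS
        ≈⟨ *-identityʳ (I n) ⟩
      I n ∎
      where open ≈R

    -- `F n` is (Q; Q)_n, so `F n * S n g` is the sum of the `g p` weighted by the Gaussian
    -- binomials of n over p.
    S : ℕ → (ℕ → FPS) → FPS
    S n g = antidiagonal n (λ p r → I p * I r * g p)

    -- 1 − Q^(p+r) = (1 − Q^r) + Q^r (1 − Q^p), where the summands lower r and p respectively.
    S-right : ∀ n g → (oneS + - Q ^ suc n) * S (suc n) g ≈
              S n g + antidiagonal n (λ p r → I p * I r * (Q ^ r * g (suc p)))
    S-right n g = begin
      (oneS + - Q ^ suc n) * S (suc n) g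
        ≈⟨ solve 2 (λ y s → (con (+ 1) :- y) :* s := s :+ con (ℤ.- + 1) :* (y :* s)) ≈-refl (Q ^ suc n) (S (suc n) g) ⟩
      S (suc n) g + κ (ℤ.- + 1) * (Q ^ suc n * S (suc n) g)
        ≈⟨ +-cong ≈-refl (≈-trans (*-cong ≈-refl (antidiagonal-^ Q (suc n) _)) (antidiagonal-* (suc n) _ _)) ⟩
      S (suc n) g + antidiagonal (suc n) (λ p r → κ (ℤ.- + 1) * (Q ^ p * Q ^ r * (I p * I r * g p)))
        ≈⟨ antidiagonal-+ (suc n) _ _ ⟨
      antidiagonal (suc n) (λ p r → I p * I r * g p + κ (ℤ.- + 1) * (Q ^ p * Q ^ r * (I p * I r * g p)))
        ≈⟨ antidiagonal-cong (suc n) (λ p r → solve 5 (λ a b c x y →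
             a :* b :* c :+ con (ℤ.- + 1) :* (x :* y :* (a :* b :* c)) :=
             a :* ((con (+ 1) :- y) :* b) :* c :+ y :* ((con (+ 1) :- x) :* a) :* b :* c) ≈-refl (I p) (I r) (g p) (Q ^ p) (Q ^ r)) ⟩
      antidiagonal (suc n) (λ p r → I p * ((oneS + - Q ^ r) * I r) * g p + Q ^ r * ((oneS + - Q ^ p) * I p) * I r * g p)
        ≈⟨ antidiagonal-+ (suc n) _ _ ⟩
      antidiagonal (suc n) (λ p r → I p * ((oneS + - Q ^ r) * I r) * g p) +
      antidiagonal (suc n) (λ p r → Q ^ r * ((oneS + - Q ^ p) * I p) * I r * g p)
        ≈⟨ +-cong
             (≈-trans (antidiagonal-snoc n _) (≈-trans (+-cong
               (antidiagonal-cong n λ p r → *-cong (*-cong ≈-refl (I-step r)) ≈-refl)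
               (solve 3 (λ a b c → a :* ((con (+ 1) :- con (+ 1)) :* b) :* c := con (+ 0)) ≈-refl (I (suc n)) (I 0) (g (suc n))))
               (+-identityʳ-≈ _)))
             (≈-trans (antidiagonal-suc n _) (≈-trans (+-cong
               (solve 4 (λ a b c d → a :* ((con (+ 1) :- con (+ 1)) :* b) :* c :* d := con (+ 0)) ≈-refl (Q ^ suc n) (I 0) (I (suc n)) (g 0))
               (antidiagonal-cong n λ p r → ≈-trans (*-cong (*-cong (*-cong ≈-refl (I-step p)) ≈-refl) ≈-refl)
                 (solve 4 (λ y a b c → y :* a :* b :* c := a :* b :* (y :* c)) ≈-refl (Q ^ r) (I p) (I r) (g (suc p)))))
               (solve 1 (λ a → con (+ 0) :+ a := a) ≈-refl _))) ⟩
      S n g + antidiagonal n (λ p r → I p * I r * (Q ^ r * g (suc p))) ∎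
      where open ≈R

    -- The companion q-Pascal rule, from 1 - Q^(p+r) = (1 - Q^p) + Q^p (1 - Q^r).
    S-left : ∀ n g → (oneS + - Q ^ suc n) * S (suc n) g ≈
             antidiagonal n (λ p r → I p * I r * g (suc p)) + antidiagonal n (λ p r → I p * I r * (Q ^ p * g p))
    S-left n g = begin
      (oneS + - Q ^ suc n) * S (suc n) g
        ≈⟨ solve 2 (λ y s → (con (+ 1) :- y) :* s := s :+ con (ℤ.- + 1) :* (y :* s)) ≈-refl (Q ^ suc n) (S (suc n) g) ⟩
      S (suc n) g + κ (ℤ.- + 1) * (Q ^ suc n * S (suc n) g)
        ≈⟨ +-cong ≈-refl (≈-trans (*-cong ≈-refl (antidiagonal-^ Q (suc n) _)) (antidiagonal-* (suc n) _ _)) ⟩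
      S (suc n) g + antidiagonal (suc n) (λ p r → κ (ℤ.- + 1) * (Q ^ p * Q ^ r * (I p * I r * g p)))
        ≈⟨ antidiagonal-+ (suc n) _ _ ⟨
      antidiagonal (suc n) (λ p r → I p * I r * g p + κ (ℤ.- + 1) * (Q ^ p * Q ^ r * (I p * I r * g p)))
        ≈⟨ antidiagonal-cong (suc n) (λ p r → solve 5 (λ a b c x y →
             a :* b :* c :+ con (ℤ.- + 1) :* (x :* y :* (a :* b :* c)) :=
             (con (+ 1) :- x) :* a :* b :* c :+ a :* ((con (+ 1) :- y) :* b) :* (x :* c)) ≈-refl (I p) (I r) (g p) (Q ^ p) (Q ^ r)) ⟩
      antidiagonal (suc n) (λ p r → (oneS + - Q ^ p) * I p * I r * g p + I p * ((oneS + - Q ^ r) * I r) * (Q ^ p * g p))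
        ≈⟨ antidiagonal-+ (suc n) _ _ ⟩
      antidiagonal (suc n) (λ p r → (oneS + - Q ^ p) * I p * I r * g p) +
      antidiagonal (suc n) (λ p r → I p * ((oneS + - Q ^ r) * I r) * (Q ^ p * g p))
        ≈⟨ +-cong
             (≈-trans (antidiagonal-suc n _) (≈-trans (+-cong
               (solve 3 (λ b c d → (con (+ 1) :- con (+ 1)) :* b :* c :* d := con (+ 0)) ≈-refl (I 0) (I (suc n)) (g 0))
               (antidiagonal-cong n λ p r → *-cong (*-cong (I-step p) ≈-refl) ≈-refl))
               (solve 1 (λ a → con (+ 0) :+ a := a) ≈-refl _)))
             (≈-trans (antidiagonal-snoc n _) (≈-trans (+-cong
               (antidiagonal-cong n λ p r → *-cong (*-cong ≈-refl (I-step r)) ≈-refl)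
               (solve 3 (λ a b c → a :* ((con (+ 1) :- con (+ 1)) :* b) :* c := con (+ 0)) ≈-refl (I (suc n)) (I 0) _))
               (+-identityʳ-≈ _))) ⟩
      antidiagonal n (λ p r → I p * I r * g (suc p)) + antidiagonal n (λ p r → I p * I r * (Q ^ p * g p)) ∎
      where open ≈R

    -- shifted i p is the term of index p − i of the two-sided theta series.
    shifted : ℕ → ℕ → FPS
    shifted zero    p       = term z Q p
    shifted (suc i) zero    = term w Q (suc i)
    shifted (suc i) (suc p) = shifted i p

    -- Terms T_k of the two-sided series satisfy T_k = z Q^(k-1) T_(k-1) for every integer k; with k
    -- = p - i, multiplying by wQ^i and using zw = Q removes z.
    shifted-suc : ∀ i p → Q ^ p * shifted (suc i) p ≈ w * Q ^ i * shifted i p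
    shifted-suc zero zero = *-identityˡ _
    shifted-suc zero (suc p) = ≈-trans (*-cong (*-cong (≈-sym zw) ≈-refl) ≈-refl)
      (solve 4 (λ z w y t → z :* w :* y :* t := w :* con (+ 1) :* (z :* y :* t)) ≈-refl z w (Q ^ p) (term z Q p))
    shifted-suc (suc i) zero = *-identityˡ _
    shifted-suc (suc i) (suc p) = ≈-trans (*-assoc Q (Q ^ p) (shifted (suc i) p))
      (≈-trans (*-cong ≈-refl (shifted-suc i p))
      (solve 4 (λ q w y t → q :* (w :* y :* t) := w :* (q :* y) :* t) ≈-refl Q w (Q ^ i) (shifted i p)))

    -- The q-binomial theorem. The factor 1 - Q^(n+1) demanded by `S-right` is the one by which
    -- `F (suc n)` exceeds `F n`.
    binomial : ∀ n → prod z Q n ≈ F n * S n (term z Q)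
    binomial zero = ≈-sym (≈-trans (*-identityˡ _) (≈-trans (antidiagonal-zero _)
      (≈-trans (*-cong (*-cong I₀≈1 I₀≈1) ≈-refl) (solve 0 (con (+ 1) :* con (+ 1) :* con (+ 1) := con (+ 1)) ≈-refl))))
      where
      I₀≈1 : I 0 ≈ oneS
      I₀≈1 = ≈-trans (≈-sym (*-identityˡ (I 0))) (F*I 0)
    binomial (suc n) = ≈-sym (begin
      F n * (oneS + - Q * Q ^ n) * S (suc n) (term z Q)
        ≈⟨ solve 4 (λ f q y s → f :* (con (+ 1) :+ :- q :* y) :* s := f :* ((con (+ 1) :- q :* y) :* s)) ≈-refl (F n) Q (Q ^ n) (S (suc n) (term z Q)) ⟩
      F n * ((oneS + - Q ^ suc n) * S (suc n) (term z Q))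
        ≈⟨ *-cong ≈-refl (S-right n (term z Q)) ⟩
      F n * (S n (term z Q) + antidiagonal n (λ p r → I p * I r * (Q ^ r * (z * Q ^ p * term z Q p))))
        ≈⟨ *-cong ≈-refl (+-cong ≈-refl (≈-trans (antidiagonal-cong n λ p r →
             solve 6 (λ a b x y z t → a :* b :* (y :* (z :* x :* t)) := z :* (x :* y :* (a :* b :* t))) ≈-refl (I p) (I r) (Q ^ p) (Q ^ r) z (term z Q p))
             (≈-trans (≈-sym (antidiagonal-* n z _)) (*-cong ≈-refl (≈-sym (antidiagonal-^ Q n _)))))) ⟩
      F n * (S n (term z Q) + z * (Q ^ n * S n (term z Q)))
        ≈⟨ solve 4 (λ f s z y → f :* (s :+ z :* (y :* s)) := f :* s :* (con (+ 1) :+ z :* y)) ≈-refl (F n) (S n (term z Q)) z (Q ^ n) ⟩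
      F n * S n (term z Q) * (oneS + z * Q ^ n)
        ≈⟨ *-cong (binomial n) ≈-refl ⟨
      prod z Q (suc n) ∎)
      where open ≈R

    -- The finite form of the triple product: each factor 1 + wQ^i lowers all theta indices by one,
    -- starting from the q-binomial theorem at i = 0.
    finite : ∀ i j → prod z Q j * prod w Q i ≈ F (i ℕ.+ j) * S (i ℕ.+ j) (shifted i)
    finite zero    j = ≈-trans (*-identityʳ (prod z Q j)) (binomial j)
    finite (suc i) j = ≈-sym (begin
      F n * (oneS + - Q * Q ^ n) * S (suc n) (shifted (suc i))
        ≈⟨ solve 4 (λ f q y s → f :* (con (+ 1) :+ :- q :* y) :* s := f :* ((con (+ 1) :- q :* y) :* s)) ≈-refl (F n) Q (Q ^ n) (S (suc n) (shifted (suc i))) ⟩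
      F n * ((oneS + - Q ^ suc n) * S (suc n) (shifted (suc i)))
        ≈⟨ *-cong ≈-refl (S-left n (shifted (suc i))) ⟩
      F n * (S n (shifted i) + antidiagonal n (λ p r → I p * I r * (Q ^ p * shifted (suc i) p)))
        ≈⟨ *-cong ≈-refl (+-cong ≈-refl (≈-trans (antidiagonal-cong n λ p r → ≈-trans (*-cong ≈-refl (shifted-suc i p))
             (solve 4 (λ a b c t → a :* b :* (c :* t) := c :* (a :* b :* t)) ≈-refl (I p) (I r) (w * Q ^ i) (shifted i p)))
             (≈-sym (antidiagonal-* n (w * Q ^ i) _)))) ⟩
      F n * (S n (shifted i) + w * Q ^ i * S n (shifted i))
        ≈⟨ solve 3 (λ f s c → f :* (s :+ c :* s) := f :* s :* (con (+ 1) :+ c)) ≈-refl (F n) (S n (shifted i)) (w * Q ^ i) ⟩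
      F n * S n (shifted i) * (oneS + w * Q ^ i)
        ≈⟨ *-cong (finite i j) ≈-refl ⟨
      prod z Q j * prod w Q i * (oneS + w * Q ^ i)
        ≈⟨ *-assoc _ _ _ ⟩
      prod z Q j * prod w Q (suc i) ∎)
      where
      open ≈R
      n = i ℕ.+ j

    F*I≈[]1 : ∀ {a b} m → m ℕ.≤ a → m ℕ.≤ b → F a * I b ≈[ m ] oneS
    F*I≈[]1 {a} {b} m m≤a m≤b = ≈[]E.trans
      (*-cong[] (≈[]E.trans (≈[]-weaken m≤a (prod≈[]∏ (- Q) Q Q0 a)) (≈[]-weaken m≤b (≈[]E.sym (prod≈[]∏ (- Q) Q Q0 b)))) ≈[]E.refl)
      (≈⇒≈[] (F*I b))

    shifted-low : ∀ k p → shifted (p ℕ.+ k) p ≡ shifted k 0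
    shifted-low k zero    = refl
    shifted-low k (suc p) = shifted-low k p

    shifted-high : ∀ i k → shifted i (i ℕ.+ k) ≡ term z Q k
    shifted-high zero    k = refl
    shifted-high (suc i) k = shifted-high i k

    shifted-0 : ∀ k → shifted k 0 ≡ term w Q k
    shifted-0 zero    = refl
    shifted-0 (suc k) = refl

    shifted-order-low : ∀ k p → shifted (p ℕ.+ k) p ≈[ k ] zeroS
    shifted-order-low k p = subst (_≈[ k ] zeroS) (sym (trans (shifted-low k p) (shifted-0 k))) (term-order w Q w0 k)

    shifted-order-high : ∀ i k → shifted i (i ℕ.+ k) ≈[ k ] zeroS
    shifted-order-high i k = subst (_≈[ k ] zeroS) (sym (shifted-high i k)) (term-order z Q z0 k)

    -- Here a and b are the distances of p from 0 and of p from the centre M, or the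
    -- reflection of this; the errors in F (M + M) * I and in the theta term multiply.
    summand : ∀ M a b {x y t} → a ℕ.+ b ≡ M → F M * x ≈[ M ] oneS → F (M ℕ.+ M) * y ≈[ a ] oneS →
              t ≈[ b ] zeroS → F M * F (M ℕ.+ M) * (x * y * t) ≈[ M ] t
    summand M a b {x} {y} {t} a+b p q t0 = begin
      F M * F (M ℕ.+ M) * (x * y * t)
        ≈⟨ ≈⇒≈[] (solve 5 (λ f g x y t → f :* g :* (x :* y :* t) := f :* x :* (t :* (g :* y))) ≈-refl (F M) (F (M ℕ.+ M)) x y t) ⟩
      F M * x * (t * (F (M ℕ.+ M) * y))
        ≈⟨ *-cong[] p (subst (λ m → t * (F (M ℕ.+ M) * y) ≈[ m ] t * oneS) (trans (ℕ.+-comm b a) a+b) (*-order b a t0 q)) ⟩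
      oneS * (t * oneS)
        ≈⟨ ≈⇒≈[] (solve 1 (λ t → con (+ 1) :* (t :* con (+ 1)) := t) ≈-refl t) ⟩
      t ∎
      where open ≈[]R M

    summand-swap : ∀ M {x y t} → F M * F (M ℕ.+ M) * (x * y * t) ≈[ M ] t → F M * F (M ℕ.+ M) * (y * x * t) ≈[ M ] t
    summand-swap M p = ≈[]E.trans (≈⇒≈[] (*-cong ≈-refl (*-cong (*-comm _ _) ≈-refl))) p

    -- One of p, r is at least M, and its `I` is paired with `F M`; the smaller one is paired with
    -- `F (M + M)`, where its loss of precision equals the order of the theta term.
    summand′ : ∀ M p r → p ℕ.+ r ≡ M ℕ.+ M → F M * F (M ℕ.+ M) * (I p * I r * shifted M p) ≈[ M ] shifted M p
    summand′ M p r p+r with ℕ.≤-total p M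
    ... | inj₁ p≤M with ℕ.m≤n⇒∃[o]m+o≡n p≤M
    ...   | k , refl = summand-swap (p ℕ.+ k) (summand (p ℕ.+ k) p k refl
        (F*I≈[]1 (p ℕ.+ k) ℕ.≤-refl M≤r) (F*I≈[]1 p (ℕ.≤-trans (ℕ.m≤m+n p k) (ℕ.m≤m+n _ _)) ℕ.≤-refl)
        (shifted-order-low k p))
        where
        M≤r : p ℕ.+ k ℕ.≤ r
        M≤r = ℕ.+-cancelˡ-≤ p _ _ (subst (p ℕ.+ (p ℕ.+ k) ℕ.≤_) (sym p+r) (ℕ.+-monoˡ-≤ (p ℕ.+ k) (ℕ.m≤m+n p k)))
    summand′ M p r p+r | inj₂ M≤p with ℕ.m≤n⇒∃[o]m+o≡n M≤p
    ...   | k , refl = summand M r k r+k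
        (F*I≈[]1 M ℕ.≤-refl (ℕ.m≤m+n M k)) (F*I≈[]1 r (ℕ.≤-trans r≤M (ℕ.m≤m+n M M)) ℕ.≤-refl)
        (shifted-order-high M k)
        where
        r+k : r ℕ.+ k ≡ M
        r+k = trans (ℕ.+-comm r k) (ℕ.+-cancelˡ-≡ M _ _ (trans (sym (ℕ.+-assoc M k r)) p+r))
        r≤M : r ℕ.≤ M
        r≤M = subst (r ℕ.≤_) r+k (ℕ.m≤m+n r k)

    antidiagonal-shifted : ∀ i j → antidiagonal (i ℕ.+ j) (λ p _ → shifted i p) ≈
                           thetaSum z Q (suc j) + (thetaSum w Q (suc i) + - oneS)
    antidiagonal-shifted zero j = ≈-trans (go z j) (solve 1 (λ a → a := a :+ (con (+ 0) :+ con (+ 1) :- con (+ 1))) ≈-refl (thetaSum z Q (suc j)))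
      where
      go : ∀ z j → antidiagonal j (λ p _ → term z Q p) ≈ thetaSum z Q (suc j)
      go z zero    = ≈-trans (antidiagonal-zero _) (solve 0 (con (+ 1) := con (+ 0) :+ con (+ 1)) ≈-refl)
      go z (suc j) = ≈-trans (antidiagonal-snoc j _) (+-cong (go z j) ≈-refl)
    antidiagonal-shifted (suc i) j = ≈-trans (antidiagonal-suc (i ℕ.+ j) _) (≈-trans (+-cong ≈-refl (antidiagonal-shifted i j))
      (solve 3 (λ a b c → c :+ (a :+ (b :- con (+ 1))) := a :+ (b :+ c :- con (+ 1))) ≈-refl
        (thetaSum z Q (suc j)) (thetaSum w Q (suc i)) (term w Q (suc i))))

  tripleProduct : ∏ (- Q) Q * (∏ z Q * ∏ w Q) ≈ Θ z Q + (Θ w Q + - oneS)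
  tripleProduct = ≈[]⇒≈ λ M → let open ≈[]R M in begin
    ∏ (- Q) Q * (∏ z Q * ∏ w Q)
      ≈⟨ *-cong[] (prod≈[]∏ (- Q) Q Q0 M) (*-cong[] (prod≈[]∏ z Q Q0 M) (prod≈[]∏ w Q Q0 M)) ⟨
    F M * (prod z Q M * prod w Q M)
      ≈⟨ ≈⇒≈[] (≈-trans (*-cong ≈-refl (finite M M)) (≈-sym (*-assoc _ _ _))) ⟩
    F M * F (M ℕ.+ M) * S (M ℕ.+ M) (shifted M)
      ≈⟨ ≈⇒≈[] (antidiagonal-* (M ℕ.+ M) _ _) ⟩
    antidiagonal (M ℕ.+ M) (λ p r → F M * F (M ℕ.+ M) * (I p * I r * shifted M p))
      ≈⟨ antidiagonal-cong[] (M ℕ.+ M) (summand′ M) ⟩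
    antidiagonal (M ℕ.+ M) (λ p _ → shifted M p)
      ≈⟨ ≈⇒≈[] (antidiagonal-shifted M M) ⟩
    thetaSum z Q (suc M) + (thetaSum w Q (suc M) + - oneS)
      ≈⟨ +-cong[] (≈[]-weaken (ℕ.n≤1+n M) (thetaSum≈[]Θ z Q z0 (suc M)))
           (+-cong[] (≈[]-weaken (ℕ.n≤1+n M) (thetaSum≈[]Θ w Q w0 (suc M))) ≈[]E.refl) ⟩
    Θ z Q + (Θ w Q + - oneS) ∎

open TripleProduct public using (tripleProduct)

-- Sections of partial theta series

thetaSum-cong : ∀ {z z′ Q Q′} → z ≈ z′ → Q ≈ Q′ → ∀ M → thetaSum z Q M ≈ thetaSum z′ Q′ M
thetaSum-cong {z} {z′} {Q} {Q′} p q = go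
  where
  term-cong : ∀ n → term z Q n ≈ term z′ Q′ n
  term-cong zero    = ≈-refl
  term-cong (suc n) = *-cong (*-cong p (^-cong n q)) (term-cong n)
  go : ∀ M → thetaSum z Q M ≈ thetaSum z′ Q′ M
  go zero    = ≈-refl
  go (suc M) = +-cong (go M) (term-cong M)

Θ-cong : ∀ {z z′ Q Q′} → z ≈ z′ → Q ≈ Q′ → Θ z Q ≈ Θ z′ Q′
Θ-cong {z} {z′} {Q} {Q′} p q = mk≈ λ n →
  trans (Θ-at z Q n) (trans (at (thetaSum-cong p q (suc n)) n) (sym (Θ-at z′ Q′ n)))

D-term : ∀ d z Q n → D d (term z Q n) ≈ term (D d z) (D d Q) n
D-term d z Q zero    = D-κ d (+ 1)
D-term d z Q (suc n) = ≈-trans (D-* d (z * Q ^ n) (term z Q n))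
  (*-cong (≈-trans (D-* d z (Q ^ n)) (*-cong ≈-refl (D-^ d Q n))) (D-term d z Q n))

D-thetaSum : ∀ d z Q M → D d (thetaSum z Q M) ≈ thetaSum (D d z) (D d Q) M
D-thetaSum d z Q zero    = D-κ d (+ 0)
D-thetaSum d z Q (suc M) = ≈-trans (D-+ d (thetaSum z Q M) (term z Q M))
  (+-cong (D-thetaSum d z Q M) (D-term d z Q M))

D-Θ : ∀ d z Q → z 0 ≡ + 0 → D d (Θ z Q) ≈ Θ (D d z) (D d Q)
D-Θ d z Q z0 = ≈[]⇒≈ λ n → ≈[]E.trans (D-cong[] d (≈[]E.sym (thetaSum≈[]Θ z Q z0 n)))
  (≈[]E.trans (≈⇒≈[] (D-thetaSum d z Q n)) (thetaSum≈[]Θ (D d z) (D d Q) z0 n))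

term-scale : ∀ z Q s n → term (z * s) Q n ≈ s ^ n * term z Q n
term-scale z Q s zero    = ≈-sym (*-identityˡ oneS)
term-scale z Q s (suc n) = ≈-trans (*-cong ≈-refl (term-scale z Q s n))
  (solve 5 (λ z s q t y → z :* s :* q :* (y :* t) := s :* y :* (z :* q :* t)) ≈-refl z s (Q ^ n) (term z Q n) (s ^ n))

Θ-suc : ∀ z Q → z 0 ≡ + 0 → Θ z Q ≈ oneS + z * Θ (z * Q) Q
Θ-suc z Q z0 = ≈[]⇒≈ λ n → ≈[]E.trans
  (≈[]-weaken (ℕ.n≤1+n n) (≈[]E.sym (thetaSum≈[]Θ z Q z0 (suc n))))
  (≈[]E.trans (≈⇒≈[] (go n)) (+-cong[] ≈[]E.refl (*-cong[] ≈[]E.refl (thetaSum≈[]Θ (z * Q) Q (*-zero-head z Q z0) n))))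
  where
  go : ∀ n → thetaSum z Q (suc n) ≈ oneS + z * thetaSum (z * Q) Q n
  go zero    = solve 1 (λ z → con (+ 0) :+ con (+ 1) := con (+ 1) :+ z :* con (+ 0)) ≈-refl z
  go (suc n) = ≈-trans (+-cong (go n) (≈-trans (*-assoc z (Q ^ n) (term z Q n)) (*-cong ≈-refl (≈-sym (term-scale z Q Q n)))))
    (solve 3 (λ z a b → con (+ 1) :+ z :* a :+ z :* b := con (+ 1) :+ z :* (a :+ b)) ≈-refl z (thetaSum (z * Q) Q n) (term (z * Q) Q n))

Θ-double : ∀ z Q → z 0 ≡ + 0 → let B = Q * Q in
           Θ z Q ≈ Θ (z * z * Q) (B * B) + z * Θ (z * z * Q * B) (B * B)
Θ-double z Q z0 = ≈[]⇒≈ λ n → ≈[]E.trans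
  (≈[]-weaken (n≤double n) (≈[]E.sym (thetaSum≈[]Θ z Q z0 (double n))))
  (≈[]E.trans (≈⇒≈[] (go n)) (+-cong[] (thetaSum≈[]Θ z² (B * B) z²0 n)
    (*-cong[] ≈[]E.refl (thetaSum≈[]Θ (z² * B) (B * B) (*-zero-head z² B z²0) n))))
  where
  B = Q * Q
  z² = z * z * Q
  z²0 = *-zero-head (z * z) Q (*-zero-head z z z0)
  Q^ : ∀ n → Q ^ double n ≈ B ^ n
  Q^ n = ≈-trans (^-double Q n) (≈-sym (*-^ Q Q n))
  even : ∀ n → term z Q (double n) ≈ term z² (B * B) n
  even zero    = ≈-refl
  even (suc n) = ≈-trans
    (*-cong (*-cong ≈-refl (*-cong ≈-refl (Q^ n))) (*-cong (*-cong ≈-refl (Q^ n)) (even n)))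
    (≈-trans (solve 4 (λ z q y t → z :* (q :* y) :* (z :* y :* t) := z :* z :* q :* (y :* y) :* t) ≈-refl z Q (B ^ n) (term z² (B * B) n))
      (*-cong (*-cong ≈-refl (≈-sym (*-^ B B n))) ≈-refl))
  odd : ∀ n → term z Q (suc (double n)) ≈ z * term (z² * B) (B * B) n
  odd n = ≈-trans (*-cong (*-cong ≈-refl (Q^ n)) (even n)) (≈-trans (*-assoc z (B ^ n) _)
    (*-cong ≈-refl (≈-sym (term-scale z² (B * B) B n))))
  go : ∀ n → thetaSum z Q (double n) ≈ thetaSum z² (B * B) n + z * thetaSum (z² * B) (B * B) n
  go zero    = solve 1 (λ z → con (+ 0) := con (+ 0) :+ z :* con (+ 0)) ≈-refl z
  go (suc n) = ≈-trans (+-cong (+-cong (go n) (even n)) (odd n))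
    (solve 5 (λ z a b c d → a :+ z :* b :+ c :+ z :* d := a :+ c :+ z :* (b :+ d)) ≈-refl z _ _ _ _)

-- Split by n modulo 3. For n = 3m, n(n-1)/2 = 9·m(m-1)/2 + 3m, whence the base Q⁹ and the argument
-- z³Q³; the other classes bring in Q^(3m) and Q^(6m).
Θ-triple : ∀ z Q → z 0 ≡ + 0 → let C = Q * Q * Q ; z³ = z * z * z * C in
  Θ z Q ≈ Θ z³ (C * C * C) + z * Θ (z³ * C) (C * C * C) + z * z * Q * Θ (z³ * (C * C)) (C * C * C)
Θ-triple z Q z0 = ≈[]⇒≈ λ n → ≈[]E.trans
  (≈[]-weaken (n≤triple n) (≈[]E.sym (thetaSum≈[]Θ z Q z0 (triple n))))
  (≈[]E.trans (≈⇒≈[] (go n)) (+-cong[] (+-cong[] (thetaSum≈[]Θ z³ C³ z³0 n)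
    (*-cong[] ≈[]E.refl (thetaSum≈[]Θ (z³ * C) C³ (*-zero-head z³ C z³0) n)))
    (*-cong[] ≈[]E.refl (thetaSum≈[]Θ (z³ * (C * C)) C³ (*-zero-head z³ (C * C) z³0) n))))
  where
  C = Q * Q * Q
  C³ = C * C * C
  z³ = z * z * z * C
  z³0 = *-zero-head (z * z * z) C (*-zero-head (z * z) z (*-zero-head z z z0))
  cube^ : ∀ f n → (f * f * f) ^ n ≈ f ^ n * f ^ n * f ^ n
  cube^ f n = ≈-trans (*-^ (f * f) f n) (*-cong (*-^ f f n) ≈-refl)
  Q^ : ∀ n → Q ^ triple n ≈ C ^ n
  Q^ n = ≈-trans (^-triple Q n) (≈-sym (cube^ Q n))
  term₀ : ∀ n → term z Q (triple n) ≈ term z³ C³ n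
  term₀ zero    = ≈-refl
  term₀ (suc n) = ≈-trans
    (*-cong (*-cong ≈-refl (*-cong ≈-refl (*-cong ≈-refl (Q^ n))))
      (*-cong (*-cong ≈-refl (*-cong ≈-refl (Q^ n))) (*-cong (*-cong ≈-refl (Q^ n)) (term₀ n))))
    (≈-trans (solve 4 (λ z q y t → z :* (q :* (q :* y)) :* (z :* (q :* y) :* (z :* y :* t)) :=
        z :* z :* z :* (q :* q :* q) :* (y :* y :* y) :* t) ≈-refl z Q (C ^ n) (term z³ C³ n))
      (*-cong (*-cong ≈-refl (≈-sym (cube^ C n))) ≈-refl))
  term₁ : ∀ n → term z Q (1 ℕ.+ triple n) ≈ z * term (z³ * C) C³ n
  term₁ n = ≈-trans (*-cong (*-cong ≈-refl (Q^ n)) (term₀ n)) (≈-trans (*-assoc z (C ^ n) _)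
    (*-cong ≈-refl (≈-sym (term-scale z³ C³ C n))))
  term₂ : ∀ n → term z Q (2 ℕ.+ triple n) ≈ z * z * Q * term (z³ * (C * C)) C³ n
  term₂ n = ≈-trans (*-cong (*-cong ≈-refl (*-cong ≈-refl (Q^ n))) (*-cong (*-cong ≈-refl (Q^ n)) (term₀ n)))
    (≈-trans (solve 4 (λ z q y t → z :* (q :* y) :* (z :* y :* t) := z :* z :* q :* (y :* y :* t)) ≈-refl z Q (C ^ n) (term z³ C³ n))
    (*-cong ≈-refl (≈-trans (*-cong (≈-sym (*-^ C C n)) ≈-refl) (≈-sym (term-scale z³ C³ (C * C) n)))))
  go : ∀ n → thetaSum z Q (triple n) ≈ thetaSum z³ C³ n + z * thetaSum (z³ * C) C³ n
             + z * z * Q * thetaSum (z³ * (C * C)) C³ n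
  go zero    = solve 2 (λ z q → con (+ 0) := con (+ 0) :+ z :* con (+ 0) :+ z :* z :* q :* con (+ 0)) ≈-refl z Q
  go (suc n) = ≈-trans (+-cong (+-cong (+-cong (go n) (term₀ n)) (term₁ n)) (term₂ n))
    (solve 8 (λ z q a b c d e f → a :+ z :* b :+ z :* z :* q :* c :+ d :+ z :* e :+ z :* z :* q :* f :=
       a :+ d :+ z :* (b :+ e) :+ z :* z :* q :* (c :+ f)) ≈-refl z Q _ _ _ _ _ _)

-- Ramanujan's functions φ(−q), ψ(q), f(−q,−q⁵) and f(q,q²)

φ ψ f₋ f₊ : FPS
φ  = Θ (- X ^ 1) (X ^ 2) + (Θ (- X ^ 1) (X ^ 2) + - oneS)
ψ  = Θ (X ^ 1) (X ^ 1)
f₋ = Θ (- X ^ 5) (X ^ 6) + (Θ (- X ^ 1) (X ^ 6) + - oneS)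
f₊ = Θ (X ^ 2) (X ^ 3) + (Θ (X ^ 1) (X ^ 3) + - oneS)

private
  -- Evaluates definitionally to the power _^_ above, unlike the solver's own exponentiation.
  pow : ∀ {n} → Polynomial n → ℕ → Polynomial n
  pow p zero    = con (+ 1)
  pow p (suc k) = p :* pow p k

D-negX^ : ∀ d n → D (suc d) (- X ^ n) ≈ - X ^ (n ℕ.* suc d)
D-negX^ d n = ≈-trans (D-‿- (suc d) (X ^ n)) (-‿cong (D-X^ d n))

D-Θ⁻ : ∀ d a b → D (suc d) (Θ (- X ^ suc a) (X ^ b)) ≈ Θ (- X ^ (suc a ℕ.* suc d)) (X ^ (b ℕ.* suc d))
D-Θ⁻ d a b = ≈-trans (D-Θ (suc d) _ _ (-X^-head a)) (Θ-cong (D-negX^ d (suc a)) (D-X^ d b))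

D-Θ⁺ : ∀ d a b → D (suc d) (Θ (X ^ suc a) (X ^ b)) ≈ Θ (X ^ (suc a ℕ.* suc d)) (X ^ (b ℕ.* suc d))
D-Θ⁺ d a b = ≈-trans (D-Θ (suc d) _ _ (X^-head a)) (Θ-cong (D-X^ d (suc a)) (D-X^ d b))

D-two-sided : ∀ d a b → D d (a + (b + - oneS)) ≈ D d a + (D d b + - oneS)
D-two-sided d a b = ≈-trans (D-+ d a _) (+-cong ≈-refl (≈-trans (D-+ d b _) (+-cong ≈-refl
  (≈-trans (D-‿- d oneS) (-‿cong (D-κ d (+ 1)))))))

-- φ(-q) sums (-1)ⁿ q^(n²) over all integers. Multiples of 3 give φ(-q⁹); the classes 1 and -1
-- contribute equally by n ↦ -n, hence the factor 2.
φ-trisection : φ ≈ D 3 (D 3 φ) + - (κ (+ 2) * X * D 3 f₋)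
φ-trisection = begin
  φ
    ≈⟨ +-cong split (+-cong split ≈-refl) ⟩
  S + (S + - oneS)
    ≈⟨ solve 4 (λ X a b c → let s = a :+ :- pow X 1 :* b :+ pow X 4 :* c in
         s :+ (s :- con (+ 1)) :=
         a :+ (a :- con (+ 1)) :- con (+ 2) :* X :* (b :+ (con (+ 1) :+ :- pow X 3 :* c :- con (+ 1))))
         ≈-refl X A₉ A₁₅ A₂₁ ⟩
  A₉ + (A₉ + - oneS) + - (κ (+ 2) * X * (A₁₅ + (oneS + - X ^ 3 * A₂₁ + - oneS)))
    ≈⟨ +-cong (≈-sym (≈-trans (D-cong 3 (≈-trans (D-two-sided 3 _ _) (+-cong (D-Θ⁻ 2 0 2) (+-cong (D-Θ⁻ 2 0 2) ≈-refl))))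
         (≈-trans (D-two-sided 3 _ _) (+-cong (D-Θ⁻ 2 2 6) (+-cong (D-Θ⁻ 2 2 6) ≈-refl)))))
         (-‿cong (*-cong ≈-refl (≈-sym (≈-trans (D-two-sided 3 _ _) (+-cong (D-Θ⁻ 2 4 6)
           -- The class n ≡ 2 supplies this half of `D 3 f₋` without its constant term, which
           -- `Θ-suc` splits off.
           (+-cong (≈-trans (D-Θ⁻ 2 0 6) (≈-trans (Θ-suc (- X ^ 3) (X ^ 18) (-X^-head 2))
             (+-cong ≈-refl (*-cong ≈-refl (Θ-cong (solve 1 (λ X → :- pow X 3 :* pow X 18 := :- pow X 21) ≈-refl X) ≈-refl))))) ≈-refl)))))) ⟩
  D 3 (D 3 φ) + - (κ (+ 2) * X * D 3 f₋) ∎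
  where
  open ≈R
  A₉  = Θ (- X ^ 9) (X ^ 18)
  A₁₅ = Θ (- X ^ 15) (X ^ 18)
  A₂₁ = Θ (- X ^ 21) (X ^ 18)
  S = A₉ + - X ^ 1 * A₁₅ + X ^ 4 * A₂₁
  q¹⁸ = solve 1 (λ X → let q = pow X 2 ; c = q :* q :* q in c :* c :* c := pow X 18) ≈-refl X
  split : Θ (- X ^ 1) (X ^ 2) ≈ S
  split = ≈-trans (Θ-triple (- X ^ 1) (X ^ 2) (-X^-head 0)) (+-cong (+-cong
    (Θ-cong (solve 1 (λ X → let z = :- pow X 1 ; q = pow X 2 ; c = q :* q :* q in z :* z :* z :* c := :- pow X 9) ≈-refl X) q¹⁸)
    (*-cong ≈-refl (Θ-cong (solve 1 (λ X → let z = :- pow X 1 ; q = pow X 2 ; c = q :* q :* q in z :* z :* z :* c :* c := :- pow X 15) ≈-refl X) q¹⁸)))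
    (*-cong (solve 1 (λ X → let z = :- pow X 1 ; q = pow X 2 in z :* z :* q := pow X 4) ≈-refl X)
      (Θ-cong (solve 1 (λ X → let z = :- pow X 1 ; q = pow X 2 ; c = q :* q :* q in z :* z :* z :* c :* (c :* c) := :- pow X 21) ≈-refl X) q¹⁸)))

-- The exponents are the triangular numbers n(n+1)/2. The class n = 3m + 1 gives q·ψ(q⁹), and the
-- classes 0 and 2 are the two halves of f(q³, q⁶).
ψ-trisection : ψ ≈ D 3 f₊ + X * D 3 (D 3 ψ)
ψ-trisection = begin
  ψ
    ≈⟨ split ⟩
  Θ (X ^ 6) (X ^ 9) + X ^ 1 * Θ (X ^ 9) (X ^ 9) + X ^ 3 * Θ (X ^ 12) (X ^ 9)
    ≈⟨ solve 4 (λ X a b c → a :+ pow X 1 :* b :+ pow X 3 :* c :=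
         a :+ (con (+ 1) :+ pow X 3 :* c :- con (+ 1)) :+ X :* b) ≈-refl X _ _ _ ⟩
  Θ (X ^ 6) (X ^ 9) + (oneS + X ^ 3 * Θ (X ^ 12) (X ^ 9) + - oneS) + X * Θ (X ^ 9) (X ^ 9)
    ≈⟨ +-cong (≈-sym (≈-trans (D-two-sided 3 _ _) (+-cong (D-Θ⁺ 2 1 3) (+-cong (≈-trans (D-Θ⁺ 2 0 3)
         (≈-trans (Θ-suc (X ^ 3) (X ^ 9) (X^-head 2)) (+-cong ≈-refl (*-cong ≈-refl
           (Θ-cong (solve 1 (λ X → pow X 3 :* pow X 9 := pow X 12) ≈-refl X) ≈-refl))))) ≈-refl))))
         (*-cong ≈-refl (≈-sym (≈-trans (D-cong 3 (D-Θ⁺ 2 0 1)) (D-Θ⁺ 2 2 3)))) ⟩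
  D 3 f₊ + X * D 3 (D 3 ψ) ∎
  where
  open ≈R
  q⁹ = solve 1 (λ X → let q = pow X 1 ; c = q :* q :* q in c :* c :* c := pow X 9) ≈-refl X
  split = ≈-trans (Θ-triple (X ^ 1) (X ^ 1) (X^-head 0)) (+-cong (+-cong
    (Θ-cong (solve 1 (λ X → let q = pow X 1 ; c = q :* q :* q in q :* q :* q :* c := pow X 6) ≈-refl X) q⁹)
    (*-cong ≈-refl (Θ-cong (solve 1 (λ X → let q = pow X 1 ; c = q :* q :* q in q :* q :* q :* c :* c := pow X 9) ≈-refl X) q⁹)))
    (*-cong (solve 1 (λ X → let q = pow X 1 in q :* q :* q := pow X 3) ≈-refl X)
      (Θ-cong (solve 1 (λ X → let q = pow X 1 ; c = q :* q :* q in q :* q :* q :* c :* (c :* c) := pow X 12) ≈-refl X) q⁹)))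

-- Product forms of the theta functions

E₁≈ : E 1 1 ≈ E 1 2 * E 2 2
E₁≈ = E-double 1 0

φ-product : φ * E 2 2 ≈ E 1 1 * E 1 1
φ-product = begin
  φ * E 2 2
    ≈⟨ *-cong (≈-sym (tripleProduct (- X ^ 1) (- X ^ 1) (X ^ 2)
         (solve 1 (λ X → :- pow X 1 :* :- pow X 1 := pow X 2) ≈-refl X) (-X^-head 0) (-X^-head 0))) ≈-refl ⟩
  E 2 2 * (E 1 2 * E 1 2) * E 2 2
    ≈⟨ solve 2 (λ a b → a :* (b :* b) :* a := b :* a :* (b :* a)) ≈-refl (E 2 2) (E 1 2) ⟩
  E 1 2 * E 2 2 * (E 1 2 * E 2 2)
    ≈⟨ *-cong E₁≈ E₁≈ ⟨
  E 1 1 * E 1 1 ∎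
  where open ≈R

f₋-product : f₋ * E 2 2 * E 3 3 ≈ E 6 6 * E 6 6 * E 1 1
f₋-product = begin
  f₋ * E 2 2 * E 3 3
    ≈⟨ *-cong (*-cong (≈-sym (tripleProduct (- X ^ 5) (- X ^ 1) (X ^ 6)
         (solve 1 (λ X → :- pow X 5 :* :- pow X 1 := pow X 6) ≈-refl X) (-X^-head 4) (-X^-head 0))) ≈-refl) (E-double 3 2) ⟩
  E 6 6 * (E 5 6 * E 1 6) * E 2 2 * (E 3 6 * E 6 6)
    ≈⟨ solve 5 (λ a b c d e → a :* (b :* c) :* d :* (e :* a) := a :* a :* (c :* e :* b :* d)) ≈-refl (E 6 6) (E 5 6) (E 1 6) (E 2 2) (E 3 6) ⟩
  E 6 6 * E 6 6 * (E 1 6 * E 3 6 * E 5 6 * E 2 2)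
    ≈⟨ *-cong ≈-refl (≈-trans E₁≈ (*-cong (E-triple 1 1) ≈-refl)) ⟨
  E 6 6 * E 6 6 * E 1 1 ∎
  where open ≈R

private
  -- Pairing 1 + y with 1 - y removes the products with plus signs, leaving only products of the
  -- form `E`.
  conjugate : ∀ a b → ∏ (X ^ a) (X ^ suc b) * E a (suc b) ≈ E (a ℕ.+ a) (suc b ℕ.+ suc b)
  conjugate a b = ≈-trans (∏-conjugate (X ^ a) (X ^ suc b) (X^-head b))
    (∏-cong (-‿cong (≈-sym (^-+ X a a))) (≈-sym (^-+ X (suc b) (suc b))))

f₊-product : f₊ * E 1 1 * E 6 6 ≈ E 3 3 * E 3 3 * E 2 2
f₊-product = begin
  f₊ * E 1 1 * E 6 6
    ≈⟨ *-cong (*-cong (≈-sym (tripleProduct (X ^ 2) (X ^ 1) (X ^ 3)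
         (solve 1 (λ X → pow X 2 :* pow X 1 := pow X 3) ≈-refl X) (X^-head 1) (X^-head 0))) (E-triple 1 0)) ≈-refl ⟩
  E 3 3 * (∏ (X ^ 2) (X ^ 3) * ∏ (X ^ 1) (X ^ 3)) * (E 1 3 * E 2 3 * E 3 3) * E 6 6
    ≈⟨ solve 6 (λ a b c d e f → a :* (b :* c) :* (d :* e :* a) :* f := a :* a :* (c :* d :* (b :* e) :* f))
         ≈-refl (E 3 3) (∏ (X ^ 2) (X ^ 3)) (∏ (X ^ 1) (X ^ 3)) (E 1 3) (E 2 3) (E 6 6) ⟩
  E 3 3 * E 3 3 * (∏ (X ^ 1) (X ^ 3) * E 1 3 * (∏ (X ^ 2) (X ^ 3) * E 2 3) * E 6 6)
    ≈⟨ *-cong ≈-refl (*-cong (*-cong (conjugate 1 2) (conjugate 2 2)) ≈-refl) ⟩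
  E 3 3 * E 3 3 * (E 2 6 * E 4 6 * E 6 6)
    ≈⟨ *-cong ≈-refl (E-triple 2 1) ⟨
  E 3 3 * E 3 3 * E 2 2 ∎
  where open ≈R

-- As defined, ψ is a one-sided sum and not yet of the shape in the triple product; separating even
-- and odd indices turns it into the two-sided f(q, q³).
ψ-product : ψ * E 1 1 ≈ E 2 2 * E 2 2
ψ-product = begin
  ψ * E 1 1
    ≈⟨ *-cong two-sided (≈-trans E₁≈ (*-cong (E-double 1 1) ≈-refl)) ⟩
  E 4 4 * (∏ (X ^ 3) (X ^ 4) * ∏ (X ^ 1) (X ^ 4)) * (E 1 4 * E 3 4 * E 2 2)
    ≈⟨ solve 6 (λ a b c d e f → a :* (b :* c) :* (d :* e :* f) := c :* d :* (b :* e) :* a :* f)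
         ≈-refl (E 4 4) (∏ (X ^ 3) (X ^ 4)) (∏ (X ^ 1) (X ^ 4)) (E 1 4) (E 3 4) (E 2 2) ⟩
  ∏ (X ^ 1) (X ^ 4) * E 1 4 * (∏ (X ^ 3) (X ^ 4) * E 3 4) * E 4 4 * E 2 2
    ≈⟨ *-cong (*-cong (*-cong (conjugate 1 3) (conjugate 3 3)) ≈-refl) ≈-refl ⟩
  E 2 8 * E 6 8 * E 4 4 * E 2 2
    ≈⟨ *-cong (≈-trans (E-double 2 1) (*-cong (E-double 2 3) ≈-refl)) ≈-refl ⟨
  E 2 2 * E 2 2 ∎
  where
  open ≈R
  q⁴ = solve 1 (λ X → let b = pow X 1 :* pow X 1 in b :* b := pow X 4) ≈-refl X
  two-sided : ψ ≈ E 4 4 * (∏ (X ^ 3) (X ^ 4) * ∏ (X ^ 1) (X ^ 4))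
  two-sided = begin
    ψ
      ≈⟨ Θ-double (X ^ 1) (X ^ 1) (X^-head 0) ⟩
    _ ≈⟨ +-cong (Θ-cong (solve 1 (λ X → let q = pow X 1 in q :* q :* q := pow X 3) ≈-refl X) q⁴)
           (*-cong ≈-refl (Θ-cong (solve 1 (λ X → let q = pow X 1 in q :* q :* q :* (q :* q) := pow X 1 :* pow X 4) ≈-refl X) q⁴)) ⟩
    Θ (X ^ 3) (X ^ 4) + X ^ 1 * Θ (X ^ 1 * X ^ 4) (X ^ 4)
      ≈⟨ solve 2 (λ a b → a :+ b := a :+ (con (+ 1) :+ b :- con (+ 1))) ≈-refl _ _ ⟩
    Θ (X ^ 3) (X ^ 4) + (oneS + X ^ 1 * Θ (X ^ 1 * X ^ 4) (X ^ 4) + - oneS)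
      ≈⟨ +-cong ≈-refl (+-cong (Θ-suc (X ^ 1) (X ^ 4) (X^-head 0)) ≈-refl) ⟨
    Θ (X ^ 3) (X ^ 4) + (Θ (X ^ 1) (X ^ 4) + - oneS)
      ≈⟨ tripleProduct (X ^ 3) (X ^ 1) (X ^ 4) (solve 1 (λ X → pow X 3 :* pow X 1 := pow X 4) ≈-refl X) (X^-head 2) (X^-head 0) ⟨
    E 4 4 * (∏ (X ^ 3) (X ^ 4) * ∏ (X ^ 1) (X ^ 4)) ∎

-- The generating function of PD

bounded : ℕ → FPS
bounded k n = + pdAux k n

X^*-shift : ∀ j f n → (X ^ j * f) (j ℕ.+ n) ≡ f n
X^*-shift zero    f n = at (*-identityˡ f) n
X^*-shift (suc j) f n = trans (at (*-assoc X (X ^ j) f) (suc (j ℕ.+ n)))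
  (trans (X*-suc (X ^ j * f) (j ℕ.+ n)) (X^*-shift j f n))

X^*-below : ∀ j f n → n ℕ.< j → (X ^ j * f) n ≡ + 0
X^*-below (suc j) f zero    _         = *-zero-head (X ^ suc j) f (X^-head j)
X^*-below (suc j) f (suc n) (s≤s n<j) = trans (at (*-assoc X (X ^ j) f) (suc n))
  (trans (X*-suc (X ^ j * f) n) (X^*-below j f n n<j))

weightSum : FPS → ℕ → FPS
weightSum x zero    = zeroS
weightSum x (suc L) = weightSum x L + κ (+ weight L) * x ^ L

-- The multiplicities removed by the filter have m(k+1) > n and contribute 0 to coefficient n, so
-- the filtered sum is a coefficient of an ordinary product.
bounded-suc : ∀ k n → bounded (suc k) n ≡ (weightSum (X ^ suc k) (suc n) * bounded k) n
bounded-suc k n = trans (filtered (upTo (suc n))) (sums (suc n))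
  where
  K = suc k
  summand : ℕ → FPS
  summand m = κ (+ weight m) * (X ^ (m ℕ.* K) * bounded k)
  F : ℕ → ℕ
  F m = weight m ℕ.* pdAux k (n ∸ m ℕ.* K)
  summand-yes : ∀ m → m ℕ.* K ℕ.≤ n → + F m ≡ summand m n
  summand-yes m p = trans (ℤ.pos-* (weight m) _) (sym (trans (κ-* (+ weight m) _ n)
    (cong (+ weight m ℤ.*_) (trans (cong (X ^ (m ℕ.* K) * bounded k) (sym (ℕ.m+[n∸m]≡n p)))
      (X^*-shift (m ℕ.* K) (bounded k) (n ∸ m ℕ.* K))))))
  summand-no : ∀ m → ¬ m ℕ.* K ℕ.≤ n → summand m n ≡ + 0
  summand-no m p = trans (κ-* (+ weight m) _ n) (trans (cong (+ weight m ℤ.*_)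
    (X^*-below (m ℕ.* K) (bounded k) n (ℕ.≰⇒> p))) (ℤ.*-zeroʳ (+ weight m)))
  filtered : ∀ ms → + sumℕ (map F (filter (λ m → m ℕ.* K ℕ.≤? n) ms)) ≡ sumℤ (map (λ m → summand m n) ms)
  filtered [] = refl
  filtered (m ∷ ms) with m ℕ.* K ℕ.≤? n
  ... | yes p = trans (cong (λ l → + sumℕ (map F l)) (List.filter-accept (λ m → m ℕ.* K ℕ.≤? n) {m} {ms} p))
                  (trans (ℤ.pos-+ (F m) _) (cong₂ ℤ._+_ (summand-yes m p) (filtered ms)))
  ... | no p  = trans (cong (λ l → + sumℕ (map F l)) (List.filter-reject (λ m → m ℕ.* K ℕ.≤? n) {m} {ms} p))
                  (trans (filtered ms) (sym (trans (cong (λ x → x ℤ.+ sumℤ (map (λ m → summand m n) ms)) (summand-no m p)) (ℤ.+-identityˡ _))))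
  sumℤ-++ : ∀ xs x → sumℤ (xs ++ x ∷ []) ≡ sumℤ xs ℤ.+ x
  sumℤ-++ []       x = ℤ.+-comm x (+ 0)
  sumℤ-++ (y ∷ xs) x = trans (cong (λ s → y ℤ.+ s) (sumℤ-++ xs x)) (sym (ℤ.+-assoc y (sumℤ xs) x))
  sums : ∀ L → sumℤ (map (λ m → summand m n) (upTo L)) ≡ (weightSum (X ^ K) L * bounded k) n
  sums zero    = sym (at (zeroˡ (bounded k)) n)
  sums (suc L) = trans (cong (λ l → sumℤ (map (λ m → summand m n) l)) (sym (List.upTo-∷ʳ L)))
    (trans (cong sumℤ (List.map-++ (λ m → summand m n) (upTo L) (L ∷ [])))
    (trans (sumℤ-++ (map (λ m → summand m n) (upTo L)) (summand L n))
    (trans (cong (λ x → x ℤ.+ summand L n) (sums L)) (trans (sym (+-at _ _ n)) (at (≈-trans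
      (+-cong ≈-refl (*-cong ≈-refl (*-cong (^-* X L K) ≈-refl)))
      (solve 4 (λ s c x p → s :* p :+ c :* (x :* p) := (s :+ c :* x) :* p) ≈-refl
        (weightSum (X ^ K) L) (κ (+ weight L)) ((X ^ K) ^ L) (bounded k))) n)))))

κ-suc : ∀ n → κ (+ suc n) ≈ oneS + κ (+ n)
κ-suc n = mk≈ λ m → trans (at (κ≈const (+ suc n)) m)
  (sym (trans (+-at oneS (κ (+ n)) m) (trans (cong (λ c → oneS m ℤ.+ c) (at (κ≈const (+ n)) m)) (go m))))
  where
  go : ∀ m → oneS m ℤ.+ const (+ n) m ≡ const (+ suc n) m
  go zero    = refl
  go (suc m) = refl

-- In the limit 1 + x + 2x² + 3x³ + ... = (1 - x + x²)/(1 - x)²; the term with x^(L+1) is the exact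
-- remainder. The leading 1 is `weight zero`, a part size that does not occur.
weightSum-closed : ∀ x L → (oneS + - x) * (oneS + - x) * weightSum x (suc L) ≈
  oneS + - x + x * x + x ^ suc L * (κ (+ L) * x + - (oneS + κ (+ L)))
weightSum-closed x zero = solve 1 (λ x → (con (+ 1) :- x) :* (con (+ 1) :- x) :* (con (+ 0) :+ con (+ 1) :* con (+ 1)) :=
  con (+ 1) :- x :+ x :* x :+ x :* con (+ 1) :* (con (+ 0) :* x :- (con (+ 1) :+ con (+ 0)))) ≈-refl x
weightSum-closed x (suc L) = ≈-trans
  (solve 4 (λ x s c y → (con (+ 1) :- x) :* (con (+ 1) :- x) :* (s :+ c :* y) :=
     (con (+ 1) :- x) :* (con (+ 1) :- x) :* s :+ (con (+ 1) :- x) :* (con (+ 1) :- x) :* (c :* y)) ≈-refl x _ _ (x ^ suc L))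
  (≈-trans (+-cong (weightSum-closed x L) (*-cong ≈-refl (*-cong (κ-suc L) ≈-refl)))
  (≈-trans (solve 3 (λ x y l → con (+ 1) :- x :+ x :* x :+ y :* (l :* x :- (con (+ 1) :+ l))
      :+ (con (+ 1) :- x) :* (con (+ 1) :- x) :* ((con (+ 1) :+ l) :* y) :=
    con (+ 1) :- x :+ x :* x :+ x :* y :* ((con (+ 1) :+ l) :* x :- (con (+ 1) :+ (con (+ 1) :+ l)))) ≈-refl x (x ^ suc L) (κ (+ L)))
  (+-cong ≈-refl (*-cong ≈-refl (+-cong (*-cong (≈-sym (κ-suc L)) ≈-refl) (-‿cong (+-cong ≈-refl (≈-sym (κ-suc L)))))))))

bounded-step : ∀ k → let x = X ^ suc k in
  (oneS + - x) * (oneS + - x) * bounded (suc k) ≈ (oneS + - x + x * x) * bounded k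
bounded-step k = ≈[]⇒≈ λ L → let open ≈[]R L in begin
  (oneS + - x) * (oneS + - x) * bounded (suc k)
    ≈⟨ *-cong[] ≈[]E.refl (≈[]-weaken (ℕ.n≤1+n L) (bounded≈ L)) ⟩
  (oneS + - x) * (oneS + - x) * (weightSum x (suc L) * bounded k)
    ≈⟨ ≈⇒≈[] (≈-trans (≈-sym (*-assoc _ _ _)) (*-cong (weightSum-closed x L) ≈-refl)) ⟩
  (oneS + - x + x * x + x ^ suc L * (κ (+ L) * x + - (oneS + κ (+ L)))) * bounded k
    ≈⟨ *-cong[] (+-cong[] ≈[]E.refl (≈[]E.trans (≈⇒≈[] (*-comm _ _))
         (zero[]-* _ (≈[]-weaken (ℕ.n≤1+n L) (^-order (suc L) (X^-head k)))))) ≈[]E.refl ⟩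
  (oneS + - x + x * x + zeroS) * bounded k
    ≈⟨ ≈⇒≈[] (*-cong (+-identityʳ-≈ _) ≈-refl) ⟩
  (oneS + - x + x * x) * bounded k ∎
  where
  x = X ^ suc k
  W : ℕ → FPS
  W L = weightSum x L * bounded k
  W-cauchy : ∀ L → W L ≈[ L ] W (suc L)
  W-cauchy L = *-cong[] (≈[]E.trans (≈⇒≈[] (≈-sym (+-identityʳ-≈ _)))
    (+-cong[] ≈[]E.refl (≈[]E.sym (zero[]-* (κ (+ weight L)) (^-order L (X^-head k)))))) ≈[]E.refl
  bounded≈ : ∀ L → bounded (suc k) ≈[ suc L ] W (suc L)
  bounded≈ L = mk≈[] λ n n<L → trans (bounded-suc k n) (sym (below (≈[]-lim W W-cauchy (suc L)) n n<L))

PDS : FPS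
PDS n = + PD n

-- Parts larger than k leave the coefficients up to k unchanged: modulo q^(k+1) both factors in
-- `bounded-step` become 1.
bounded≈[]PDS : ∀ n → bounded n ≈[ n ] PDS
bounded≈[]PDS n = ≈[]E.trans (≈[]-lim bounded (λ k → ≈[]-weaken (ℕ.n≤1+n k) (step k)) n)
  (≈⇒≈[] (mk≈ λ m → sym (below (step m) m ℕ.≤-refl)))
  where
  step : ∀ k → bounded k ≈[ suc k ] bounded (suc k)
  step k = begin
    bounded k
      ≈⟨ ≈⇒≈[] (solve 1 (λ b → b := (con (+ 1) :- con (+ 0) :+ con (+ 0) :* con (+ 0)) :* b) ≈-refl (bounded k)) ⟩
    (oneS + - zeroS + zeroS * zeroS) * bounded k
      ≈⟨ *-cong[] (+-cong[] (+-cong[] ≈[]E.refl (-‿cong[] x≈0)) (*-cong[] x≈0 x≈0)) ≈[]E.refl ⟨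
    (oneS + - x + x * x) * bounded k
      ≈⟨ ≈⇒≈[] (bounded-step k) ⟨
    (oneS + - x) * (oneS + - x) * bounded (suc k)
      ≈⟨ *-cong[] (*-cong[] (+-cong[] ≈[]E.refl (-‿cong[] x≈0)) (+-cong[] ≈[]E.refl (-‿cong[] x≈0))) ≈[]E.refl ⟩
    (oneS + - zeroS) * (oneS + - zeroS) * bounded (suc k)
      ≈⟨ ≈⇒≈[] (solve 1 (λ b → (con (+ 1) :- con (+ 0)) :* (con (+ 1) :- con (+ 0)) :* b := b) ≈-refl (bounded (suc k))) ⟩
    bounded (suc k) ∎
    where
    open ≈[]R (suc k)
    x = X ^ suc k
    x≈0 : x ≈[ suc k ] zeroS
    x≈0 = ^-order (suc k) refl

-- Since (1 + x)(1 - x + x²) = 1 + x³, the local factor (1 - x + x²)/(1 - x)² equals (1 - x⁶)/((1 -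
-- x)(1 - x²)(1 - x³)).
bounded-product : ∀ M → let p j = prod (- X ^ j) (X ^ j) M in bounded M * p 1 * p 2 * p 3 ≈ p 6
bounded-product zero = ≈-trans
  (*-cong (*-cong (*-cong (mk≈ λ { zero → refl ; (suc n) → refl }) ≈-refl) ≈-refl) ≈-refl)
  (solve 0 (con (+ 1) :* con (+ 1) :* con (+ 1) :* con (+ 1) := con (+ 1)) ≈-refl)
bounded-product (suc M) = begin
  bounded (suc M) * (p 1 * f 1) * (p 2 * f 2) * (p 3 * f 3)
    ≈⟨ *-cong (*-cong (*-cong ≈-refl (*-cong ≈-refl (f≈ 1))) (*-cong ≈-refl (f≈ 2))) (*-cong ≈-refl (f≈ 3)) ⟩
  bounded (suc M) * (p 1 * (oneS + - x ^ 1)) * (p 2 * (oneS + - x ^ 2)) * (p 3 * (oneS + - x ^ 3))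
    ≈⟨ solve 5 (λ b p q s x →
         b :* (p :* (con (+ 1) :- x :* con (+ 1))) :* (q :* (con (+ 1) :- x :* (x :* con (+ 1))))
           :* (s :* (con (+ 1) :- x :* (x :* (x :* con (+ 1))))) :=
         (con (+ 1) :- x) :* (con (+ 1) :- x) :* b
           :* (p :* q :* s :* ((con (+ 1) :- x) :* (con (+ 1) :+ x) :* (con (+ 1) :+ x :+ x :* x))))
         ≈-refl (bounded (suc M)) (p 1) (p 2) (p 3) x ⟩
  (oneS + - x) * (oneS + - x) * bounded (suc M) * (p 1 * p 2 * p 3 * ((oneS + - x) * (oneS + x) * (oneS + x + x * x)))
    ≈⟨ *-cong (bounded-step M) ≈-refl ⟩
  (oneS + - x + x * x) * bounded M * (p 1 * p 2 * p 3 * ((oneS + - x) * (oneS + x) * (oneS + x + x * x)))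
    ≈⟨ solve 5 (λ b p q s x →
         (con (+ 1) :- x :+ x :* x) :* b
           :* (p :* q :* s :* ((con (+ 1) :- x) :* (con (+ 1) :+ x) :* (con (+ 1) :+ x :+ x :* x))) :=
         b :* p :* q :* s :* (con (+ 1) :- x :* (x :* (x :* (x :* (x :* (x :* con (+ 1))))))))
         ≈-refl (bounded M) (p 1) (p 2) (p 3) x ⟩
  bounded M * p 1 * p 2 * p 3 * (oneS + - x ^ 6)
    ≈⟨ *-cong (bounded-product M) (≈-sym (f≈ 6)) ⟩
  p 6 * f 6 ∎
  where
  open ≈R
  x = X ^ suc M
  p f : ℕ → FPS
  p j = prod (- X ^ j) (X ^ j) M
  f j = oneS + - X ^ j * (X ^ j) ^ M
  f≈ : ∀ j → f j ≈ oneS + - x ^ j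
  f≈ j = +-cong ≈-refl (≈-trans (solve 2 (λ a b → :- a :* b := :- (a :* b)) ≈-refl (X ^ j) ((X ^ j) ^ M))
    (-‿cong (≈-trans (≈-sym (^-* X (suc M) j)) (≈-trans (mk≈ λ n → cong (λ e → (X ^ e) n) (ℕ.*-comm (suc M) j)) (^-* X j (suc M))))))

PDS-product : PDS * E 1 1 * E 2 2 * E 3 3 ≈ E 6 6
PDS-product = ≈[]⇒≈ λ n → ≈[]E.trans
  (≈[]E.sym (*-cong[] (*-cong[] (*-cong[] (bounded≈[]PDS n) (p n 0)) (p n 1)) (p n 2)))
  (≈[]E.trans (≈⇒≈[] (bounded-product n)) (p n 5))
  where
  p : ∀ n j → prod (- X ^ suc j) (X ^ suc j) n ≈[ n ] E (suc j) (suc j)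
  p n j = prod≈[]∏ (- X ^ suc j) (X ^ suc j) (X^-head j) n

-- Integer powers and eta quotients

inverse-unique : ∀ {u v w} → u * v ≈ oneS → u * w ≈ oneS → v ≈ w
inverse-unique {u} {v} {w} p q = begin
  v             ≈⟨ *-identityʳ v ⟨
  v * oneS      ≈⟨ *-cong ≈-refl q ⟨
  v * (u * w)   ≈⟨ solve 3 (λ u v w → v :* (u :* w) := u :* v :* w) ≈-refl u v w ⟩
  u * v * w     ≈⟨ *-cong p ≈-refl ⟩
  oneS * w      ≈⟨ *-identityˡ w ⟩
  w             ∎
  where open ≈R

zpow : FPS → ℤ → FPS
zpow f (+ n)        = f ^ n
zpow f (ℤ.-[1+ n ]) = invS f ^ suc n

zpow-+ : ∀ f → f 0 ≡ + 1 → ∀ i j → zpow f i * zpow f j ≈ zpow f (i ℤ.+ j)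
zpow-+ f f0 = go
  where
  open ≈R
  f*inv : f * invS f ≈ oneS
  f*inv = *-invS f f0
  up : ∀ i → f * zpow f i ≈ zpow f (ℤ.suc i)
  up (+ n)              = ≈-refl
  up (ℤ.-[1+ zero ])    = ≈-trans (*-cong ≈-refl (*-identityʳ (invS f))) f*inv
  up (ℤ.-[1+ suc n ])   = ≈-trans (≈-sym (*-assoc f (invS f) _)) (≈-trans (*-cong f*inv ≈-refl) (*-identityˡ _))
  down : ∀ i → invS f * zpow f i ≈ zpow f (ℤ.pred i)
  down (+ zero)         = ≈-refl
  down (+ suc n)        = ≈-trans (≈-sym (*-assoc (invS f) f _)) (≈-trans (*-cong (≈-trans (*-comm _ _) f*inv) ≈-refl) (*-identityˡ _))
  down (ℤ.-[1+ n ])     = ≈-refl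
  go : ∀ i j → zpow f i * zpow f j ≈ zpow f (i ℤ.+ j)
  go (+ zero) j = ≈-trans (*-identityˡ _) (mk≈ λ n → cong (λ k → zpow f k n) (sym (ℤ.+-identityˡ j)))
  go (+ suc m) j = begin
    f * f ^ m * zpow f j          ≈⟨ *-assoc f (f ^ m) _ ⟩
    f * (f ^ m * zpow f j)        ≈⟨ *-cong ≈-refl (go (+ m) j) ⟩
    f * zpow f (+ m ℤ.+ j)        ≈⟨ up (+ m ℤ.+ j) ⟩
    zpow f (ℤ.suc (+ m ℤ.+ j))    ≈⟨ mk≈ (λ n → cong (λ k → zpow f k n) (sym (ℤ.+-assoc (+ 1) (+ m) j))) ⟩
    zpow f (+ suc m ℤ.+ j)        ∎
  go (ℤ.-[1+ zero ]) j = ≈-trans (*-cong (*-identityʳ (invS f)) ≈-refl) (down j)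
  go (ℤ.-[1+ suc m ]) j = begin
    invS f * invS f ^ suc m * zpow f j      ≈⟨ *-assoc (invS f) _ _ ⟩
    invS f * (invS f ^ suc m * zpow f j)    ≈⟨ *-cong ≈-refl (go (ℤ.-[1+ m ]) j) ⟩
    invS f * zpow f (ℤ.-[1+ m ] ℤ.+ j)      ≈⟨ down (ℤ.-[1+ m ] ℤ.+ j) ⟩
    zpow f (ℤ.pred (ℤ.-[1+ m ] ℤ.+ j))      ≈⟨ mk≈ (λ n → cong (λ k → zpow f k n) (sym (ℤ.+-assoc ℤ.-1ℤ (ℤ.-[1+ m ]) j))) ⟩
    zpow f (ℤ.-[1+ suc m ] ℤ.+ j)           ∎

^-head : ∀ f → f 0 ≡ + 1 → ∀ n → (f ^ n) 0 ≡ + 1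
^-head f f0 zero    = refl
^-head f f0 (suc n) = trans (*-head f (f ^ n)) (cong₂ ℤ._*_ f0 (^-head f f0 n))

zpow-head : ∀ f → f 0 ≡ + 1 → ∀ i → zpow f i 0 ≡ + 1
zpow-head f f0 (+ n)        = ^-head f f0 n
zpow-head f f0 (ℤ.-[1+ n ]) = ^-head (invS f) refl (suc n)

D-zpow : ∀ k i → D 2 (zpow (E (suc k) (suc k)) i) ≈ zpow (E (suc k ℕ.* 2) (suc k ℕ.* 2)) i
D-zpow k = go
  where
  e₁ = E (suc k) (suc k)
  e₂ = E (suc k ℕ.* 2) (suc k ℕ.* 2)
  De : D 2 e₁ ≈ e₂
  De = D-E 1 (suc k) k
  Dinv : D 2 (invS e₁) ≈ invS e₂
  Dinv = inverse-unique {e₂}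
    (≈-trans (*-cong (≈-sym De) ≈-refl) (≈-trans (≈-sym (D-* 2 e₁ (invS e₁)))
      (≈-trans (D-cong 2 (*-invS e₁ (E-head k (suc k)))) (D-κ 2 (+ 1)))))
    (*-invS e₂ (E-head (suc (k ℕ.* 2)) (suc k ℕ.* 2)))
  go : ∀ i → D 2 (zpow e₁ i) ≈ zpow e₂ i
  go (+ j)        = ≈-trans (D-^ 2 e₁ j) (^-cong j De)
  go (ℤ.-[1+ j ]) = ≈-trans (D-^ 2 (invS e₁) (suc j)) (^-cong (suc j) Dinv)

-- One entry for each divisor 1, 2, 3, 4, 6, 12. With explicit integers as entries, equality of eta
-- quotients is settled by evaluating `⊞` and `neg`.
Exponents : Set
Exponents = Vec ℤ 6

infixl 6 _⊞_
_⊞_ : Exponents → Exponents → Exponents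
_⊞_ = Vec.zipWith ℤ._+_

-- With f_k = (q^k; q^k)_∞, this is f₁^a f₂^b f₃^c f₄^d f₆^e f₁₂^g.
opaque
  η : Exponents → FPS
  η (a ∷ b ∷ c ∷ d ∷ e ∷ g ∷ []) =
    zpow (E 1 1) a * zpow (E 2 2) b * zpow (E 3 3) c * zpow (E 4 4) d * zpow (E 6 6) e * zpow (E 12 12) g

  η-* : ∀ s t → η s * η t ≈ η (s ⊞ t)
  η-* (a ∷ b ∷ c ∷ d ∷ e ∷ g ∷ []) (a′ ∷ b′ ∷ c′ ∷ d′ ∷ e′ ∷ g′ ∷ []) = ≈-trans
    (solve 12 (λ a b c d e g a′ b′ c′ d′ e′ g′ →
      a :* b :* c :* d :* e :* g :* (a′ :* b′ :* c′ :* d′ :* e′ :* g′) :=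
      (a :* a′) :* (b :* b′) :* (c :* c′) :* (d :* d′) :* (e :* e′) :* (g :* g′)) ≈-refl
      (zpow (E 1 1) a) (zpow (E 2 2) b) (zpow (E 3 3) c) (zpow (E 4 4) d) (zpow (E 6 6) e) (zpow (E 12 12) g)
      (zpow (E 1 1) a′) (zpow (E 2 2) b′) (zpow (E 3 3) c′) (zpow (E 4 4) d′) (zpow (E 6 6) e′) (zpow (E 12 12) g′))
    (*-cong (*-cong (*-cong (*-cong (*-cong
      (zpow-+ (E 1 1) (E-head 0 1) a a′) (zpow-+ (E 2 2) (E-head 1 2) b b′)) (zpow-+ (E 3 3) (E-head 2 3) c c′))
      (zpow-+ (E 4 4) (E-head 3 4) d d′)) (zpow-+ (E 6 6) (E-head 5 6) e e′)) (zpow-+ (E 12 12) (E-head 11 12) g g′))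

  η-head : ∀ s → η s 0 ≡ + 1
  η-head (a ∷ b ∷ c ∷ d ∷ e ∷ g ∷ []) =
    times (times (times (times (times
      (zpow-head (E 1 1) (E-head 0 1) a) (zpow-head (E 2 2) (E-head 1 2) b)) (zpow-head (E 3 3) (E-head 2 3) c))
      (zpow-head (E 4 4) (E-head 3 4) d)) (zpow-head (E 6 6) (E-head 5 6) e)) (zpow-head (E 12 12) (E-head 11 12) g)
    where
    times : ∀ {f g} → f 0 ≡ + 1 → g 0 ≡ + 1 → (f * g) 0 ≡ + 1
    times {f} {g} p q = trans (*-head f g) (cong₂ ℤ._*_ p q)

  η-zero : η (+ 0 ∷ + 0 ∷ + 0 ∷ + 0 ∷ + 0 ∷ + 0 ∷ []) ≈ oneS
  η-zero = solve 0 (con (+ 1) :* con (+ 1) :* con (+ 1) :* con (+ 1) :* con (+ 1) :* con (+ 1) := con (+ 1)) ≈-refl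

  E₁≈η : E 1 1 ≈ η (+ 1 ∷ + 0 ∷ + 0 ∷ + 0 ∷ + 0 ∷ + 0 ∷ [])
  E₁≈η = solve 1 (λ x → x := x :* con (+ 1) :* con (+ 1) :* con (+ 1) :* con (+ 1) :* con (+ 1) :* con (+ 1)) ≈-refl (E 1 1)

  E₂≈η : E 2 2 ≈ η (+ 0 ∷ + 1 ∷ + 0 ∷ + 0 ∷ + 0 ∷ + 0 ∷ [])
  E₂≈η = solve 1 (λ x → x := con (+ 1) :* (x :* con (+ 1)) :* con (+ 1) :* con (+ 1) :* con (+ 1) :* con (+ 1)) ≈-refl (E 2 2)

  E₃≈η : E 3 3 ≈ η (+ 0 ∷ + 0 ∷ + 1 ∷ + 0 ∷ + 0 ∷ + 0 ∷ [])
  E₃≈η = solve 1 (λ x → x := con (+ 1) :* con (+ 1) :* (x :* con (+ 1)) :* con (+ 1) :* con (+ 1) :* con (+ 1)) ≈-refl (E 3 3)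

  E₄≈η : E 4 4 ≈ η (+ 0 ∷ + 0 ∷ + 0 ∷ + 1 ∷ + 0 ∷ + 0 ∷ [])
  E₄≈η = solve 1 (λ x → x := con (+ 1) :* con (+ 1) :* con (+ 1) :* (x :* con (+ 1)) :* con (+ 1) :* con (+ 1)) ≈-refl (E 4 4)

  E₆≈η : E 6 6 ≈ η (+ 0 ∷ + 0 ∷ + 0 ∷ + 0 ∷ + 1 ∷ + 0 ∷ [])
  E₆≈η = solve 1 (λ x → x := con (+ 1) :* con (+ 1) :* con (+ 1) :* con (+ 1) :* (x :* con (+ 1)) :* con (+ 1)) ≈-refl (E 6 6)

  E₁₂≈η : E 12 12 ≈ η (+ 0 ∷ + 0 ∷ + 0 ∷ + 0 ∷ + 0 ∷ + 1 ∷ [])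
  E₁₂≈η = solve 1 (λ x → x := con (+ 1) :* con (+ 1) :* con (+ 1) :* con (+ 1) :* con (+ 1) :* (x :* con (+ 1))) ≈-refl (E 12 12)

  -- The substitution q ↦ q² doubles every index; the exponents of f₄ and f₁₂ are kept at 0 so that
  -- f₈ and f₂₄ do not arise.
  D₂-η : ∀ a b c e → D 2 (η (a ∷ b ∷ c ∷ + 0 ∷ e ∷ + 0 ∷ [])) ≈ η (+ 0 ∷ a ∷ + 0 ∷ b ∷ c ∷ e ∷ [])
  D₂-η a b c e = ≈-trans (D-* 2 _ _) (≈-trans (*-cong (≈-trans (D-* 2 _ _) (*-cong (≈-trans (D-* 2 _ _) (*-cong
      (≈-trans (D-* 2 _ _) (*-cong (≈-trans (D-* 2 _ _) (*-cong (D-zpow 0 a) (D-zpow 1 b))) (D-zpow 2 c)))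
      (D-κ 2 (+ 1)))) (D-zpow 5 e))) (D-κ 2 (+ 1)))
    (solve 4 (λ a b c e → a :* b :* c :* con (+ 1) :* e :* con (+ 1) :=
       con (+ 1) :* a :* con (+ 1) :* b :* c :* e) ≈-refl _ _ _ _))

neg : Exponents → Exponents
neg = Vec.map (λ i → ℤ.- i)

η-neg : ∀ s → η s * η (neg s) ≈ oneS
η-neg s@(a ∷ b ∷ c ∷ d ∷ e ∷ g ∷ []) = ≈-trans (η-* s (neg s)) (≈-trans (mk≈ λ n → cong (λ t → η t n) zeros) η-zero)
  where
  zeros : s ⊞ neg s ≡ + 0 ∷ + 0 ∷ + 0 ∷ + 0 ∷ + 0 ∷ + 0 ∷ []
  zeros rewrite ℤ.+-inverseʳ a | ℤ.+-inverseʳ b | ℤ.+-inverseʳ c | ℤ.+-inverseʳ d | ℤ.+-inverseʳ e | ℤ.+-inverseʳ g = refl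

η-divide : ∀ {f} s t → f * η s ≈ η t → f ≈ η (t ⊞ neg s)
η-divide {f} s t p = begin
  f                      ≈⟨ *-identityʳ f ⟨
  f * oneS               ≈⟨ *-cong ≈-refl (η-neg s) ⟨
  f * (η s * η (neg s))  ≈⟨ *-assoc f (η s) _ ⟨
  f * η s * η (neg s)    ≈⟨ *-cong p ≈-refl ⟩
  η t * η (neg s)        ≈⟨ η-* t (neg s) ⟩
  η (t ⊞ neg s)          ∎
  where open ≈R

η-mul : ∀ {f g} s t → f ≈ η s → g ≈ η t → f * g ≈ η (s ⊞ t)
η-mul s t p q = ≈-trans (*-cong p q) (η-* s t)

η-pow : ∀ {f} s n → f ≈ η s → f ^ n ≈ η (Vec.map (λ i → + n ℤ.* i) s)
η-pow {f} s@(a ∷ b ∷ c ∷ d ∷ e ∷ g ∷ []) zero p = ≈-sym η-zero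
η-pow {f} s@(a ∷ b ∷ c ∷ d ∷ e ∷ g ∷ []) (suc n) p = ≈-trans (η-mul s _ p (η-pow s n p))
  (mk≈ λ k → cong (λ t → η t k) sums)
  where
  sums : s ⊞ Vec.map (λ i → + n ℤ.* i) s ≡ Vec.map (λ i → + suc n ℤ.* i) s
  sums rewrite ℤ.suc-* (+ n) a | ℤ.suc-* (+ n) b | ℤ.suc-* (+ n) c | ℤ.suc-* (+ n) d | ℤ.suc-* (+ n) e | ℤ.suc-* (+ n) g = refl

η-invS : ∀ {f} s → f ≈ η s → invS f ≈ η (neg s)
η-invS {f} s p = inverse-unique (*-invS f (trans (at p 0) (η-head s))) (≈-trans (*-cong p ≈-refl) (η-neg s))

infix 9 ⁻_
⁻_ : ℕ → ℤ
⁻ n = ℤ.- + n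

⟨_∣_∣_∣_∣_∣_⟩ : (a b c d e g : ℤ) → Exponents
⟨ a ∣ b ∣ c ∣ d ∣ e ∣ g ⟩ = a ∷ b ∷ c ∷ d ∷ e ∷ g ∷ []

-- Eta quotients of the theta functions and their norms

private
  e₁ e₂ e₃ e₆ : Exponents
  e₁ = ⟨ + 1 ∣ + 0 ∣ + 0 ∣ + 0 ∣ + 0 ∣ + 0 ⟩
  e₂ = ⟨ + 0 ∣ + 1 ∣ + 0 ∣ + 0 ∣ + 0 ∣ + 0 ⟩
  e₃ = ⟨ + 0 ∣ + 0 ∣ + 1 ∣ + 0 ∣ + 0 ∣ + 0 ⟩
  e₆ = ⟨ + 0 ∣ + 0 ∣ + 0 ∣ + 0 ∣ + 1 ∣ + 0 ⟩

φ≈η : φ ≈ η ⟨ + 2 ∣ ⁻ 1 ∣ + 0 ∣ + 0 ∣ + 0 ∣ + 0 ⟩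
φ≈η = η-divide e₂ (e₁ ⊞ e₁) (≈-trans (*-cong ≈-refl (≈-sym E₂≈η)) (≈-trans φ-product (η-mul e₁ e₁ E₁≈η E₁≈η)))

ψ≈η : ψ ≈ η ⟨ ⁻ 1 ∣ + 2 ∣ + 0 ∣ + 0 ∣ + 0 ∣ + 0 ⟩
ψ≈η = η-divide e₁ (e₂ ⊞ e₂) (≈-trans (*-cong ≈-refl (≈-sym E₁≈η)) (≈-trans ψ-product (η-mul e₂ e₂ E₂≈η E₂≈η)))

f₋≈η : f₋ ≈ η ⟨ + 1 ∣ ⁻ 1 ∣ ⁻ 1 ∣ + 0 ∣ + 2 ∣ + 0 ⟩
f₋≈η = η-divide (e₂ ⊞ e₃) (e₆ ⊞ e₆ ⊞ e₁) (≈-trans (*-cong ≈-refl (≈-sym (η-mul e₂ e₃ E₂≈η E₃≈η)))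
  (≈-trans (≈-sym (*-assoc f₋ (E 2 2) (E 3 3))) (≈-trans f₋-product (η-mul (e₆ ⊞ e₆) e₁ (η-mul e₆ e₆ E₆≈η E₆≈η) E₁≈η))))

f₊≈η : f₊ ≈ η ⟨ ⁻ 1 ∣ + 1 ∣ + 2 ∣ + 0 ∣ ⁻ 1 ∣ + 0 ⟩
f₊≈η = η-divide (e₁ ⊞ e₆) (e₃ ⊞ e₃ ⊞ e₂) (≈-trans (*-cong ≈-refl (≈-sym (η-mul e₁ e₆ E₁≈η E₆≈η)))
  (≈-trans (≈-sym (*-assoc f₊ (E 1 1) (E 6 6))) (≈-trans f₊-product (η-mul (e₃ ⊞ e₃) e₂ (η-mul e₃ e₃ E₃≈η E₃≈η) E₂≈η))))

D₃-E₁ : D 3 (E 1 1) ≈ E 3 3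
D₃-E₁ = D-E 2 1 0

D₃-E₂ : D 3 (E 2 2) ≈ E 6 6
D₃-E₂ = D-E 2 2 1

D₃φ≈η : D 3 φ ≈ η ⟨ + 0 ∣ + 0 ∣ + 2 ∣ + 0 ∣ ⁻ 1 ∣ + 0 ⟩
D₃φ≈η = η-divide e₆ (e₃ ⊞ e₃) (begin
  D 3 φ * η e₆              ≈⟨ *-cong ≈-refl (≈-trans D₃-E₂ E₆≈η) ⟨
  D 3 φ * D 3 (E 2 2)       ≈⟨ D-* 3 φ (E 2 2) ⟨
  D 3 (φ * E 2 2)           ≈⟨ D-cong 3 φ-product ⟩
  D 3 (E 1 1 * E 1 1)       ≈⟨ D-* 3 (E 1 1) (E 1 1) ⟩
  D 3 (E 1 1) * D 3 (E 1 1) ≈⟨ η-mul e₃ e₃ (≈-trans D₃-E₁ E₃≈η) (≈-trans D₃-E₁ E₃≈η) ⟩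
  η (e₃ ⊞ e₃)               ∎)
  where open ≈R

D₃ψ≈η : D 3 ψ ≈ η ⟨ + 0 ∣ + 0 ∣ ⁻ 1 ∣ + 0 ∣ + 2 ∣ + 0 ⟩
D₃ψ≈η = η-divide e₃ (e₆ ⊞ e₆) (begin
  D 3 ψ * η e₃              ≈⟨ *-cong ≈-refl (≈-trans D₃-E₁ E₃≈η) ⟨
  D 3 ψ * D 3 (E 1 1)       ≈⟨ D-* 3 ψ (E 1 1) ⟨
  D 3 (ψ * E 1 1)           ≈⟨ D-cong 3 ψ-product ⟩
  D 3 (E 2 2 * E 2 2)       ≈⟨ D-* 3 (E 2 2) (E 2 2) ⟩
  D 3 (E 2 2) * D 3 (E 2 2) ≈⟨ η-mul e₆ e₆ (≈-trans D₃-E₂ E₆≈η) (≈-trans D₃-E₂ E₆≈η) ⟩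
  η (e₆ ⊞ e₆)               ∎)
  where open ≈R

norm-E₁≈η : norm (E 1 1) ≈ η ⟨ + 4 ∣ + 0 ∣ ⁻ 1 ∣ + 0 ∣ + 0 ∣ + 0 ⟩
norm-E₁≈η = η-divide e₃ (e₁ ⊞ e₁ ⊞ e₁ ⊞ e₁) (≈-trans (*-cong ≈-refl (≈-sym E₃≈η)) (≈-trans norm-E₁
  (η-mul (e₁ ⊞ e₁ ⊞ e₁) e₁ (η-mul (e₁ ⊞ e₁) e₁ (η-mul e₁ e₁ E₁≈η E₁≈η) E₁≈η) E₁≈η)))

norm-E₂≈η : norm (E 2 2) ≈ η ⟨ + 0 ∣ + 4 ∣ + 0 ∣ + 0 ∣ ⁻ 1 ∣ + 0 ⟩
norm-E₂≈η = η-divide e₆ (e₂ ⊞ e₂ ⊞ e₂ ⊞ e₂) (≈-trans (*-cong ≈-refl (≈-sym E₆≈η)) (≈-trans norm-E₂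
  (η-mul (e₂ ⊞ e₂ ⊞ e₂) e₂ (η-mul (e₂ ⊞ e₂) e₂ (η-mul e₂ e₂ E₂≈η E₂≈η) E₂≈η) E₂≈η)))

norm-φ≈η : norm φ ≈ η ⟨ + 8 ∣ ⁻ 4 ∣ ⁻ 2 ∣ + 0 ∣ + 1 ∣ + 0 ⟩
norm-φ≈η = η-divide n₂ (n₁ ⊞ n₁) (≈-trans (*-cong ≈-refl (≈-sym norm-E₂≈η)) (≈-trans (≈-sym (norm-* φ (E 2 2)))
  (≈-trans (norm-cong φ-product) (≈-trans (norm-* (E 1 1) (E 1 1)) (η-mul n₁ n₁ norm-E₁≈η norm-E₁≈η)))))
  where
  n₁ = ⟨ + 4 ∣ + 0 ∣ ⁻ 1 ∣ + 0 ∣ + 0 ∣ + 0 ⟩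
  n₂ = ⟨ + 0 ∣ + 4 ∣ + 0 ∣ + 0 ∣ ⁻ 1 ∣ + 0 ⟩

norm-ψ≈η : norm ψ ≈ η ⟨ ⁻ 4 ∣ + 8 ∣ + 1 ∣ + 0 ∣ ⁻ 2 ∣ + 0 ⟩
norm-ψ≈η = η-divide n₁ (n₂ ⊞ n₂) (≈-trans (*-cong ≈-refl (≈-sym norm-E₁≈η)) (≈-trans (≈-sym (norm-* ψ (E 1 1)))
  (≈-trans (norm-cong ψ-product) (≈-trans (norm-* (E 2 2) (E 2 2)) (η-mul n₂ n₂ norm-E₂≈η norm-E₂≈η)))))
  where
  n₁ = ⟨ + 4 ∣ + 0 ∣ ⁻ 1 ∣ + 0 ∣ + 0 ∣ + 0 ⟩
  n₂ = ⟨ + 0 ∣ + 4 ∣ + 0 ∣ + 0 ∣ ⁻ 1 ∣ + 0 ⟩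

φ-weave : φ ≈ weave (D 3 φ) (κ (⁻ 2) * f₋) zeroS
φ-weave = ≈-trans φ-trisection (≈-trans
  (solve 3 (λ X p q → p :- con (+ 2) :* X :* q := p :+ X :* (con (⁻ 2) :* q) :+ X :* X :* con (+ 0)) ≈-refl X (D 3 (D 3 φ)) (D 3 f₋))
  (≈-sym (+-cong (+-cong ≈-refl (*-cong ≈-refl (≈-trans (D-* 3 (κ (⁻ 2)) f₋) (*-cong (D-κ 3 (⁻ 2)) ≈-refl))))
    (*-cong ≈-refl (D-κ 3 (+ 0))))))

ψ-weave : ψ ≈ weave f₊ (D 3 ψ) zeroS
ψ-weave = ≈-trans ψ-trisection (≈-trans
  (solve 3 (λ X p q → p :+ X :* q := p :+ X :* q :+ X :* X :* con (+ 0)) ≈-refl X (D 3 f₊) (D 3 (D 3 ψ)))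
  (≈-sym (+-cong ≈-refl (*-cong ≈-refl (D-κ 3 (+ 0))))))

-- Relations of level 6

level-divide : ∀ {A B C} y a b c → A ≈ η a → B ≈ η b → C ≈ η c → A + y * B ≈ C →
               oneS + y * η (b ⊞ neg a) ≈ η (c ⊞ neg a)
level-divide {A} {B} {C} y a b c p q s h = begin
  oneS + y * η (b ⊞ neg a)
    ≈⟨ +-cong (≈-trans (*-cong p ≈-refl) (η-neg a)) (*-cong ≈-refl (≈-trans (*-cong q ≈-refl) (η-* b (neg a)))) ⟨
  A * η (neg a) + y * (B * η (neg a))
    ≈⟨ solve 4 (λ A B y i → A :* i :+ y :* (B :* i) := (A :+ y :* B) :* i) ≈-refl A B y (η (neg a)) ⟩
  (A + y * B) * η (neg a)
    ≈⟨ *-cong h ≈-refl ⟩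
  C * η (neg a)
    ≈⟨ η-mul c (neg a) s ≈-refl ⟩
  η (c ⊞ neg a) ∎
  where open ≈R

-- x is a Hauptmodul of level 6, x₂ is x(q²) and r is a Hauptmodul of level 12. It turns out that
-- u = 1 + r, v = 1 − r, V = 1 − 3r and W = 1 + 3r.
x r u v V W x₂ : FPS
x  = X * η ⟨ + 3 ∣ ⁻ 3 ∣ ⁻ 9 ∣ + 0 ∣ + 9 ∣ + 0 ⟩
x₂ = X * X * η ⟨ + 0 ∣ + 3 ∣ + 0 ∣ ⁻ 3 ∣ ⁻ 9 ∣ + 9 ⟩
r  = X * η ⟨ + 0 ∣ + 2 ∣ + 0 ∣ ⁻ 4 ∣ ⁻ 2 ∣ + 4 ⟩
u  = η ⟨ ⁻ 1 ∣ + 2 ∣ + 3 ∣ ⁻ 3 ∣ ⁻ 2 ∣ + 1 ⟩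
v  = η ⟨ + 1 ∣ ⁻ 1 ∣ ⁻ 3 ∣ ⁻ 2 ∣ + 7 ∣ ⁻ 2 ⟩
V  = η ⟨ + 3 ∣ + 0 ∣ ⁻ 1 ∣ ⁻ 3 ∣ + 0 ∣ + 1 ⟩
W  = η ⟨ ⁻ 3 ∣ + 9 ∣ + 1 ∣ ⁻ 6 ∣ ⁻ 3 ∣ + 2 ⟩

-- Two evaluations of the norm of φ(-q): the trisection gives P³ - 8qQ³, the product form an eta
-- quotient. Division by P³ leaves x = qQ³/P³.
1-8x : oneS + κ (⁻ 8) * x ≈ η ⟨ + 8 ∣ ⁻ 4 ∣ ⁻ 8 ∣ + 0 ∣ + 4 ∣ + 0 ⟩
1-8x = ≈-trans (+-cong ≈-refl (≈-sym (*-assoc _ _ _)))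
  (level-divide (κ (⁻ 8) * X) (p ⊞ p ⊞ p) (q ⊞ q ⊞ q) ⟨ + 8 ∣ ⁻ 4 ∣ ⁻ 2 ∣ + 0 ∣ + 1 ∣ + 0 ⟩
    (η-mul (p ⊞ p) p (η-mul p p D₃φ≈η D₃φ≈η) D₃φ≈η) (η-mul (q ⊞ q) q (η-mul q q f₋≈η f₋≈η) f₋≈η) norm-φ≈η
    (≈-sym (≈-trans (norm-weave φ-weave) (solve 3 (λ X a f → let b = con (⁻ 2) :* f ; c = con (+ 0) in
      a :* a :* a :+ X :* (b :* b :* b) :+ X :* X :* (c :* c :* c) :- con (+ 3) :* X :* (a :* b :* c) :=
      a :* a :* a :+ con (⁻ 8) :* X :* (f :* f :* f)) ≈-refl X (D 3 φ) f₋))))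
  where
  p = ⟨ + 0 ∣ + 0 ∣ + 2 ∣ + 0 ∣ ⁻ 1 ∣ + 0 ⟩
  q = ⟨ + 1 ∣ ⁻ 1 ∣ ⁻ 1 ∣ + 0 ∣ + 2 ∣ + 0 ⟩

-- The same comparison for ψ, after division by R³. That qS³/R³ is again `x` is visible from the
-- exponents, and it ties the two norm relations together.
1+x : oneS + x ≈ η ⟨ ⁻ 1 ∣ + 5 ∣ ⁻ 5 ∣ + 0 ∣ + 1 ∣ + 0 ⟩
1+x = level-divide X (p ⊞ p ⊞ p) (q ⊞ q ⊞ q) ⟨ ⁻ 4 ∣ + 8 ∣ + 1 ∣ + 0 ∣ ⁻ 2 ∣ + 0 ⟩
    (η-mul (p ⊞ p) p (η-mul p p f₊≈η f₊≈η) f₊≈η) (η-mul (q ⊞ q) q (η-mul q q D₃ψ≈η D₃ψ≈η) D₃ψ≈η) norm-ψ≈η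
    (≈-sym (≈-trans (norm-weave ψ-weave) (solve 3 (λ X a b → let c = con (+ 0) in
      a :* a :* a :+ X :* (b :* b :* b) :+ X :* X :* (c :* c :* c) :- con (+ 3) :* X :* (a :* b :* c) :=
      a :* a :* a :+ X :* (b :* b :* b)) ≈-refl X f₊ (D 3 ψ))))
  where
  p = ⟨ ⁻ 1 ∣ + 1 ∣ + 2 ∣ + 0 ∣ ⁻ 1 ∣ + 0 ⟩
  q = ⟨ + 0 ∣ + 0 ∣ ⁻ 1 ∣ + 0 ∣ + 2 ∣ + 0 ⟩

-- Relations of level 12

D₂-x : D 2 x ≈ x₂
D₂-x = ≈-trans (D-* 2 X _) (*-cong (≈-trans (D-X 1) (solve 1 (λ X → X :* (X :* con (+ 1)) := X :* X) ≈-refl X))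
  (D₂-η (+ 3) (⁻ 3) (⁻ 9) (+ 9)))

1-8x₂ : oneS + κ (⁻ 8) * x₂ ≈ η ⟨ + 0 ∣ + 8 ∣ + 0 ∣ ⁻ 4 ∣ ⁻ 8 ∣ + 4 ⟩
1-8x₂ = begin
  oneS + κ (⁻ 8) * x₂           ≈⟨ +-cong (D-κ 2 (+ 1)) (≈-trans (D-* 2 _ _) (*-cong (D-κ 2 (⁻ 8)) D₂-x)) ⟨
  D 2 oneS + D 2 (κ (⁻ 8) * x)  ≈⟨ D-+ 2 _ _ ⟨
  D 2 (oneS + κ (⁻ 8) * x)      ≈⟨ D-cong 2 1-8x ⟩
  D 2 (η ⟨ + 8 ∣ ⁻ 4 ∣ ⁻ 8 ∣ + 0 ∣ + 4 ∣ + 0 ⟩)       ≈⟨ D₂-η (+ 8) (⁻ 4) (⁻ 8) (+ 4) ⟩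
  η ⟨ + 0 ∣ + 8 ∣ + 0 ∣ ⁻ 4 ∣ ⁻ 8 ∣ + 4 ⟩             ∎
  where open ≈R

1+x₂ : oneS + x₂ ≈ η ⟨ + 0 ∣ ⁻ 1 ∣ + 0 ∣ + 5 ∣ ⁻ 5 ∣ + 1 ⟩
1+x₂ = begin
  oneS + x₂                  ≈⟨ +-cong (D-κ 2 (+ 1)) D₂-x ⟨
  D 2 oneS + D 2 x           ≈⟨ D-+ 2 _ _ ⟨
  D 2 (oneS + x)             ≈⟨ D-cong 2 1+x ⟩
  D 2 (η ⟨ ⁻ 1 ∣ + 5 ∣ ⁻ 5 ∣ + 0 ∣ + 1 ∣ + 0 ⟩)    ≈⟨ D₂-η (⁻ 1) (+ 5) (⁻ 5) (+ 1) ⟩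
  η ⟨ + 0 ∣ ⁻ 1 ∣ + 0 ∣ + 5 ∣ ⁻ 5 ∣ + 1 ⟩          ∎
  where open ≈R

-- A pure comparison of exponents. Once u and v are known it reads x = r(1 - r)/(1 + r)².
u*u*x≈r*v : u * u * x ≈ r * v
u*u*x≈r*v = ≈-trans (solve 3 (λ X a b → a :* a :* (X :* b) := X :* (a :* a :* b)) ≈-refl X u _)
  (≈-trans (*-cong ≈-refl (≈-trans (*-cong (η-* _ _) ≈-refl) (≈-trans (η-* _ _) (≈-sym (η-* _ _))))) (≈-sym (*-assoc X _ v)))

-- By exponents `W` is u²(1 + x), and likewise V² is u²(1 - 8x); the relation just proved then
-- replaces u²x by rv.
W≈ : W ≈ u * u + r * v
W≈ = begin
  W                        ≈⟨ ≈-trans (*-cong (η-* _ _) ≈-refl) (η-* _ _) ⟨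
  u * u * η ⟨ ⁻ 1 ∣ + 5 ∣ ⁻ 5 ∣ + 0 ∣ + 1 ∣ + 0 ⟩ ≈⟨ *-cong ≈-refl 1+x ⟨
  u * u * (oneS + x)       ≈⟨ solve 2 (λ a b → a :* (con (+ 1) :+ b) := a :+ a :* b) ≈-refl (u * u) x ⟩
  u * u + u * u * x        ≈⟨ +-cong ≈-refl u*u*x≈r*v ⟩
  u * u + r * v            ∎
  where open ≈R

V*V≈ : V * V ≈ u * u + κ (⁻ 8) * (r * v)
V*V≈ = begin
  V * V                          ≈⟨ η-* _ _ ⟩
  η ⟨ + 6 ∣ + 0 ∣ ⁻ 2 ∣ ⁻ 6 ∣ + 0 ∣ + 2 ⟩              ≈⟨ ≈-trans (*-cong (η-* _ _) ≈-refl) (η-* _ _) ⟨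
  u * u * η ⟨ + 8 ∣ ⁻ 4 ∣ ⁻ 8 ∣ + 0 ∣ + 4 ∣ + 0 ⟩      ≈⟨ *-cong ≈-refl 1-8x ⟨
  u * u * (oneS + κ (⁻ 8) * x)   ≈⟨ solve 2 (λ a b → a :* (con (+ 1) :+ con (⁻ 8) :* b) := a :+ con (⁻ 8) :* (a :* b)) ≈-refl (u * u) x ⟩
  u * u + κ (⁻ 8) * (u * u * x)  ≈⟨ +-cong ≈-refl (*-cong ≈-refl u*u*x≈r*v) ⟩
  u * u + κ (⁻ 8) * (r * v)      ∎
  where open ≈R

r*r≈ : r * r ≈ X * X * η ⟨ + 0 ∣ + 4 ∣ + 0 ∣ ⁻ 8 ∣ ⁻ 4 ∣ + 8 ⟩
r*r≈ = ≈-trans (solve 2 (λ X a → X :* a :* (X :* a) := X :* X :* (a :* a)) ≈-refl X _) (*-cong ≈-refl (η-* _ _))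

-- Both sides are inverse to 1 + x₂: the left by exponents, the right because r²(1 + x₂) = x₂, that
-- is, x₂ = r²/(1 - r²).
u*v≈ : u * v ≈ oneS + - (r * r)
u*v≈ = inverse-unique {oneS + x₂}
  (≈-trans (*-cong 1+x₂ (η-* _ _)) (≈-trans (η-* _ _) η-zero))
  (begin
    (oneS + x₂) * (oneS + - (r * r))
      ≈⟨ solve 2 (λ a b → (con (+ 1) :+ a) :* (con (+ 1) :- b) := con (+ 1) :+ a :- b :* (con (+ 1) :+ a)) ≈-refl x₂ (r * r) ⟩
    oneS + x₂ + - (r * r * (oneS + x₂))
      ≈⟨ +-cong ≈-refl (-‿cong (≈-trans (*-cong r*r≈ 1+x₂) (≈-trans (*-assoc _ _ _) (*-cong ≈-refl (η-* _ _))))) ⟩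
    oneS + x₂ + - x₂
      ≈⟨ solve 1 (λ a → con (+ 1) :+ a :- a := con (+ 1)) ≈-refl x₂ ⟩
    oneS ∎)
  where open ≈R

-- By exponents VW = (1 - 8x₂)·uv, and x₂·uv = r²; hence 1 - r² - 8r².
V*W≈ : V * W ≈ oneS + κ (⁻ 9) * (r * r)
V*W≈ = begin
  V * W                                        ≈⟨ η-* _ _ ⟩
  η ⟨ + 0 ∣ + 9 ∣ + 0 ∣ ⁻ 9 ∣ ⁻ 3 ∣ + 3 ⟩                            ≈⟨ ≈-trans (*-cong ≈-refl (η-* _ _)) (η-* _ _) ⟨
  η ⟨ + 0 ∣ + 8 ∣ + 0 ∣ ⁻ 4 ∣ ⁻ 8 ∣ + 4 ⟩ * (u * v)                  ≈⟨ *-cong 1-8x₂ ≈-refl ⟨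
  (oneS + κ (⁻ 8) * x₂) * (u * v)              ≈⟨ solve 2 (λ a b → (con (+ 1) :+ con (⁻ 8) :* a) :* b := b :+ con (⁻ 8) :* (a :* b)) ≈-refl x₂ (u * v) ⟩
  u * v + κ (⁻ 8) * (x₂ * (u * v))             ≈⟨ +-cong u*v≈ (*-cong ≈-refl (≈-trans (*-cong ≈-refl (η-* _ _))
                                                   (≈-trans (*-assoc _ _ _) (≈-trans (*-cong ≈-refl (η-* _ _)) (≈-sym r*r≈))))) ⟩
  oneS + - (r * r) + κ (⁻ 8) * (r * r)         ≈⟨ solve 1 (λ s → con (+ 1) :- s :+ con (⁻ 8) :* s := con (+ 1) :+ con (⁻ 9) :* s) ≈-refl (r * r) ⟩
  oneS + κ (⁻ 9) * (r * r)                     ∎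
  where open ≈R

≈-from-difference : ∀ {f g} → f + - g ≈ zeroS → f ≈ g
≈-from-difference {f} {g} p = ≈-trans (solve 2 (λ f g → f := f :- g :+ g) ≈-refl f g)
  (≈-trans (+-cong p ≈-refl) (solve 1 (λ g → con (+ 0) :+ g := g) ≈-refl g))

-- Eliminating v, V and W leaves a cubic equation for c = u³ with roots (1 + r)³, −(1 − r)³ and
-- −8r³; the constant term of u selects the first one.
u≈1+r : u ≈ oneS + r
-- The factors cancelled have constant terms 3, 2 and 1, because `r` vanishes at q = 0 while `u`
-- starts with 1. In particular the unwanted roots are excluded.
u≈1+r = ≈-from-difference (*-cancel-zero _ _ (nonzero (+ 3) quadratic (λ ()))
  (≈-trans (solve 2 (λ u r → let s = con (+ 1) :+ r in
     (u :* u :+ u :* s :+ s :* s) :* (u :- s) := u :* u :* u :- s :* s :* s) ≈-refl u r)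
  (*-cancel-zero _ _ (nonzero (+ 2) linear₁ (λ ())) (*-cancel-zero _ _ (nonzero (+ 1) linear₂ (λ ())) cubic))))
  where
  open ≈R
  s t c : FPS
  s = oneS + r
  t = oneS + - r
  c = u * u * u
  u≈1 : u ≈[ 1 ] oneS
  u≈1 = mk≈[] λ { zero _ → η-head _ ; (suc _) (s≤s ()) }
  r≈0 : r ≈[ 1 ] zeroS
  r≈0 = mk≈[] λ { zero _ → *-zero-head X _ refl ; (suc _) (s≤s ()) }
  s≈1 : s ≈[ 1 ] oneS
  s≈1 = ≈[]E.trans (+-cong[] ≈[]E.refl r≈0) (≈⇒≈[] (+-identityʳ-≈ oneS))
  t≈1 : t ≈[ 1 ] oneS
  t≈1 = ≈[]E.trans (+-cong[] ≈[]E.refl (-‿cong[] r≈0)) (≈⇒≈[] (solve 0 (con (+ 1) :- con (+ 0) := con (+ 1)) ≈-refl))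
  c≈1 : c ≈[ 1 ] oneS * oneS * oneS
  c≈1 = *-cong[] (*-cong[] u≈1 u≈1) u≈1
  nonzero : ∀ {f} k → f ≈[ 1 ] κ k → κ k 0 ≢ + 0 → f 0 ≢ + 0
  nonzero k p k≢0 f0 = k≢0 (trans (sym (below p 0 (s≤s z≤n))) f0)
  quadratic : u * u + u * s + s * s ≈[ 1 ] κ (+ 3)
  quadratic = ≈[]E.trans (+-cong[] (+-cong[] (*-cong[] u≈1 u≈1) (*-cong[] u≈1 s≈1)) (*-cong[] s≈1 s≈1))
    (≈⇒≈[] (solve 0 (con (+ 1) :* con (+ 1) :+ con (+ 1) :* con (+ 1) :+ con (+ 1) :* con (+ 1) := con (+ 3)) ≈-refl))
  linear₁ : c + t * t * t ≈[ 1 ] κ (+ 2)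
  linear₁ = ≈[]E.trans (+-cong[] c≈1 (*-cong[] (*-cong[] t≈1 t≈1) t≈1))
    (≈⇒≈[] (solve 0 (con (+ 1) :* con (+ 1) :* con (+ 1) :+ con (+ 1) :* con (+ 1) :* con (+ 1) := con (+ 2)) ≈-refl))
  linear₂ : c + κ (+ 8) * (r * r * r) ≈[ 1 ] κ (+ 1)
  linear₂ = ≈[]E.trans (+-cong[] c≈1 (*-cong[] ≈[]E.refl (*-cong[] (*-cong[] r≈0 r≈0) r≈0)))
    (≈⇒≈[] (solve 0 (con (+ 1) :* con (+ 1) :* con (+ 1) :+ con (+ 8) :* (con (+ 0) :* con (+ 0) :* con (+ 0)) := con (+ 1)) ≈-refl))
  k a : FPS
  k = oneS + κ (⁻ 9) * (r * r)
  a = r * (oneS + - (r * r))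
  eliminated : c * (k * k) ≈ (c + κ (⁻ 8) * a) * (c + a) * (c + a)
  eliminated = begin
    c * (k * k)
      ≈⟨ *-cong ≈-refl (*-cong V*W≈ V*W≈) ⟨
    c * (V * W * (V * W))
      ≈⟨ solve 3 (λ c V W → c :* (V :* W :* (V :* W)) := c :* (V :* V :* W :* W)) ≈-refl c V W ⟩
    c * (V * V * W * W)
      ≈⟨ *-cong ≈-refl (*-cong (*-cong V*V≈ W≈) W≈) ⟩
    c * ((u * u + κ (⁻ 8) * (r * v)) * (u * u + r * v) * (u * u + r * v))
      -- The factor c = u³ gives one u to each of the three factors, so that `v` occurs only in the
      -- known product uv.
      ≈⟨ solve 3 (λ u r v → let p = r :* v in
           u :* u :* u :* ((u :* u :+ con (⁻ 8) :* p) :* (u :* u :+ p) :* (u :* u :+ p)) :=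
           (u :* u :* u :+ con (⁻ 8) :* (r :* (u :* v))) :* (u :* u :* u :+ r :* (u :* v)) :* (u :* u :* u :+ r :* (u :* v)))
           ≈-refl u r v ⟩
    (c + κ (⁻ 8) * (r * (u * v))) * (c + r * (u * v)) * (c + r * (u * v))
      ≈⟨ *-cong (*-cong (+-cong ≈-refl (*-cong ≈-refl (*-cong ≈-refl u*v≈))) (+-cong ≈-refl (*-cong ≈-refl u*v≈)))
           (+-cong ≈-refl (*-cong ≈-refl u*v≈)) ⟩
    (c + κ (⁻ 8) * a) * (c + a) * (c + a) ∎
  cubic : (c + κ (+ 8) * (r * r * r)) * ((c + t * t * t) * (c + - (s * s * s))) ≈ zeroS
  cubic = begin
    (c + κ (+ 8) * (r * r * r)) * ((c + t * t * t) * (c + - (s * s * s)))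
      ≈⟨ solve 2 (λ r c → let s = con (+ 1) :+ r ; t = con (+ 1) :- r ; a = r :* (con (+ 1) :- r :* r)
                              k = con (+ 1) :+ con (⁻ 9) :* (r :* r) in
           (c :+ con (+ 8) :* (r :* r :* r)) :* ((c :+ t :* t :* t) :* (c :- s :* s :* s)) :=
           (c :+ con (⁻ 8) :* a) :* (c :+ a) :* (c :+ a) :- c :* (k :* k)) ≈-refl r c ⟩
    (c + κ (⁻ 8) * a) * (c + a) * (c + a) + - (c * (k * k))
      ≈⟨ +-cong ≈-refl (-‿cong eliminated) ⟩
    _ ≈⟨ solve 1 (λ a → a :- a := con (+ 0)) ≈-refl ((c + κ (⁻ 8) * a) * (c + a) * (c + a)) ⟩
    zeroS ∎

v≈1-r : v ≈ oneS + - r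
v≈1-r = ≈-from-difference (*-cancel-zero u _ u≢0 (begin
  u * (v + - (oneS + - r))                         ≈⟨ solve 3 (λ u v r → u :* (v :- (con (+ 1) :- r)) := u :* v :- u :* (con (+ 1) :- r)) ≈-refl u v r ⟩
  u * v + - (u * (oneS + - r))                     ≈⟨ +-cong u*v≈ (-‿cong (*-cong u≈1+r ≈-refl)) ⟩
  oneS + - (r * r) + - ((oneS + r) * (oneS + - r)) ≈⟨ solve 1 (λ r → con (+ 1) :- r :* r :- (con (+ 1) :+ r) :* (con (+ 1) :- r) := con (+ 0)) ≈-refl r ⟩
  zeroS ∎))
  where
  open ≈R
  u≢0 : u 0 ≢ + 0
  u≢0 p with trans (sym (η-head ⟨ ⁻ 1 ∣ + 2 ∣ + 3 ∣ ⁻ 3 ∣ ⁻ 2 ∣ + 1 ⟩)) p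
  ... | ()

level-12 : u * u + κ (⁻ 2) * (r * v) ≈ oneS + κ (+ 3) * (r * r)
level-12 = ≈-trans (+-cong (*-cong u≈1+r u≈1+r) (*-cong ≈-refl (*-cong ≈-refl v≈1-r)))
  (solve 1 (λ r → (con (+ 1) :+ r) :* (con (+ 1) :+ r) :+ con (⁻ 2) :* (r :* (con (+ 1) :- r)) :=
    con (+ 1) :+ con (+ 3) :* (r :* r)) ≈-refl r)

-- The subseries of PD on multiples of 3

PDS≈η : PDS ≈ η ⟨ ⁻ 1 ∣ ⁻ 1 ∣ ⁻ 1 ∣ + 0 ∣ + 1 ∣ + 0 ⟩
PDS≈η = η-divide (e₁ ⊞ e₂ ⊞ e₃) e₆ (≈-trans (*-cong ≈-refl (≈-sym (η-mul (e₁ ⊞ e₂) e₃ (η-mul e₁ e₂ E₁≈η E₂≈η) E₃≈η)))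
  (≈-trans (solve 4 (λ p a b c → p :* (a :* b :* c) := p :* a :* b :* c) ≈-refl PDS (E 1 1) (E 2 2) (E 3 3))
  (≈-trans PDS-product E₆≈η)))

-- This is f₂/f₁. Its image f₆/f₃ under q ↦ q³ is the product of `PDS` with φ and ψ.
quotient : FPS
quotient = η ⟨ ⁻ 1 ∣ + 1 ∣ + 0 ∣ + 0 ∣ + 0 ∣ + 0 ⟩

D₃-quotient : D 3 quotient ≈ η ⟨ + 0 ∣ + 0 ∣ ⁻ 1 ∣ + 0 ∣ + 1 ∣ + 0 ⟩
D₃-quotient = η-divide e₃ e₆ (begin
  D 3 quotient * η e₃        ≈⟨ *-cong ≈-refl (≈-trans D₃-E₁ E₃≈η) ⟨
  D 3 quotient * D 3 (E 1 1) ≈⟨ D-* 3 quotient (E 1 1) ⟨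
  D 3 (quotient * E 1 1)     ≈⟨ D-cong 3 (≈-trans (η-mul ⟨ ⁻ 1 ∣ + 1 ∣ + 0 ∣ + 0 ∣ + 0 ∣ + 0 ⟩ e₁ ≈-refl E₁≈η) (≈-sym E₂≈η)) ⟩
  D 3 (E 2 2)                ≈⟨ ≈-trans D₃-E₂ E₆≈η ⟩
  η e₆                       ∎)
  where open ≈R

-- Multiplying `PDS` by φ, ψ and their conjugates shows that `D 3 N * PDS` is a series in q³ times
-- the conjugates. Only the section 0 of `conj φ * conj ψ` then has to be expanded.
sect₀-PDS : sect 0 PDS ≈ η ⟨ ⁻ 5 ∣ ⁻ 5 ∣ + 3 ∣ + 6 ∣ + 1 ∣ ⁻ 2 ⟩ * (oneS + κ (+ 3) * (r * r))
sect₀-PDS = begin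
  sect 0 PDS
    ≈⟨ *-identityʳ _ ⟨
  sect 0 PDS * oneS
    ≈⟨ *-cong ≈-refl (≈-trans (*-cong N≈ ≈-refl) (η-neg n)) ⟨
  sect 0 PDS * (N * η (neg n))
    ≈⟨ solve 3 (λ a b c → a :* (b :* c) := b :* a :* c) ≈-refl (sect 0 PDS) N (η (neg n)) ⟩
  N * sect 0 PDS * η (neg n)
    ≈⟨ *-cong (sect₀-D* N PDS) ≈-refl ⟨
  sect 0 (D 3 N * PDS) * η (neg n)
    ≈⟨ *-cong (sect-cong 0 (≈-trans D-N (*-cong ≈-refl conjugates))) ≈-refl ⟩
  sect 0 (D 3 quotient * weave _ _ _) * η (neg n)
    ≈⟨ *-cong (≈-trans (sect₀-D* quotient _) (*-cong ≈-refl (sect₀ ≈-refl))) ≈-refl ⟩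
  quotient * _ * η (neg n)
    -- Here `o` is the vanishing third section of φ and of ψ, and `B` the second section of φ.
    ≈⟨ *-cong (*-cong ≈-refl (solve 5 (λ X P f R S → let B = con (⁻ 2) :* f ; o = con (+ 0) in
         (P :* P :- X :* (B :* o)) :* (R :* R :- X :* (S :* o))
           :+ X :* ((X :* (o :* o) :- P :* B) :* (S :* S :- R :* o))
           :+ X :* ((B :* B :- P :* o) :* (X :* (o :* o) :- R :* S)) :=
         P :* P :* R :* R :+ con (+ 2) :* X :* (P :* f :* S :* S) :+ con (⁻ 4) :* X :* (f :* f :* R :* S))
         ≈-refl X (D 3 φ) f₋ f₊ (D 3 ψ))) ≈-refl ⟩
  quotient * (D 3 φ * D 3 φ * f₊ * f₊ + κ (+ 2) * X * (D 3 φ * f₋ * D 3 ψ * D 3 ψ) + κ (⁻ 4) * X * (f₋ * f₋ * f₊ * D 3 ψ)) * η (neg n)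
    ≈⟨ *-cong (*-cong ≈-refl (+-cong (+-cong
         (η-mul (a ⊞ a ⊞ b) b (η-mul (a ⊞ a) b (η-mul a a D₃φ≈η D₃φ≈η) f₊≈η) f₊≈η)
         (*-cong ≈-refl (η-mul (a ⊞ d ⊞ e) e (η-mul (a ⊞ d) e (η-mul a d D₃φ≈η f₋≈η) D₃ψ≈η) D₃ψ≈η)))
         (*-cong ≈-refl (η-mul (d ⊞ d ⊞ b) e (η-mul (d ⊞ d) b (η-mul d d f₋≈η f₋≈η) f₊≈η) D₃ψ≈η)))) ≈-refl ⟩
  quotient * (η ⟨ ⁻ 2 ∣ + 2 ∣ + 8 ∣ + 0 ∣ ⁻ 4 ∣ + 0 ⟩ + κ (+ 2) * X * η ⟨ + 1 ∣ ⁻ 1 ∣ ⁻ 1 ∣ + 0 ∣ + 5 ∣ + 0 ⟩ + κ (⁻ 4) * X * η ⟨ + 1 ∣ ⁻ 1 ∣ ⁻ 1 ∣ + 0 ∣ + 5 ∣ + 0 ⟩) * η (neg n)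
    -- The two terms with `X` carry the same eta quotient, so 2 and -4 combine to -2.
    ≈⟨ solve 5 (λ X h p q m → h :* (p :+ con (+ 2) :* X :* q :+ con (⁻ 4) :* X :* q) :* m :=
         h :* p :* m :+ con (⁻ 2) :* (X :* (h :* q :* m))) ≈-refl X quotient _ _ (η (neg n)) ⟩
  quotient * η ⟨ ⁻ 2 ∣ + 2 ∣ + 8 ∣ + 0 ∣ ⁻ 4 ∣ + 0 ⟩ * η (neg n) + κ (⁻ 2) * (X * (quotient * η ⟨ + 1 ∣ ⁻ 1 ∣ ⁻ 1 ∣ + 0 ∣ + 5 ∣ + 0 ⟩ * η (neg n)))
    -- Dividing by the prefactor `pre` of the right-hand side is what produces `u` and `v`: the
    -- exponents left over are those of u² and of rv.
    ≈⟨ +-cong (≈-trans (*-cong (η-* _ _) ≈-refl) (≈-trans (η-* _ _) (≈-sym (≈-trans (*-cong ≈-refl (η-* _ _)) (η-* _ _)))))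
         (*-cong ≈-refl (*-cong ≈-refl (≈-trans (*-cong (η-* _ _) ≈-refl) (≈-trans (η-* _ _)
           (≈-sym (≈-trans (*-cong ≈-refl (η-* _ _)) (η-* _ _))))))) ⟩
  pre * (u * u) + κ (⁻ 2) * (X * (pre * (η ⟨ + 0 ∣ + 2 ∣ + 0 ∣ ⁻ 4 ∣ ⁻ 2 ∣ + 4 ⟩ * v)))
    ≈⟨ solve 5 (λ X p u a v → p :* (u :* u) :+ con (⁻ 2) :* (X :* (p :* (a :* v))) :=
         p :* (u :* u :+ con (⁻ 2) :* (X :* a :* v))) ≈-refl X pre u _ v ⟩
  pre * (u * u + κ (⁻ 2) * (r * v))
    ≈⟨ *-cong ≈-refl level-12 ⟩
  pre * (oneS + κ (+ 3) * (r * r)) ∎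
  where
  open ≈R
  pre N : FPS
  pre = η ⟨ ⁻ 5 ∣ ⁻ 5 ∣ + 3 ∣ + 6 ∣ + 1 ∣ ⁻ 2 ⟩
  N = norm φ * norm ψ
  n a b d e : Exponents
  n = ⟨ + 4 ∣ + 4 ∣ ⁻ 1 ∣ + 0 ∣ ⁻ 1 ∣ + 0 ⟩
  a = ⟨ + 0 ∣ + 0 ∣ + 2 ∣ + 0 ∣ ⁻ 1 ∣ + 0 ⟩
  b = ⟨ ⁻ 1 ∣ + 1 ∣ + 2 ∣ + 0 ∣ ⁻ 1 ∣ + 0 ⟩
  d = ⟨ + 1 ∣ ⁻ 1 ∣ ⁻ 1 ∣ + 0 ∣ + 2 ∣ + 0 ⟩
  e = ⟨ + 0 ∣ + 0 ∣ ⁻ 1 ∣ + 0 ∣ + 2 ∣ + 0 ⟩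
  N≈ : N ≈ η n
  N≈ = η-mul ⟨ + 8 ∣ ⁻ 4 ∣ ⁻ 2 ∣ + 0 ∣ + 1 ∣ + 0 ⟩ ⟨ ⁻ 4 ∣ + 8 ∣ + 1 ∣ + 0 ∣ ⁻ 2 ∣ + 0 ⟩ norm-φ≈η norm-ψ≈η
  D-N : D 3 N * PDS ≈ D 3 quotient * (conj φ * conj ψ)
  D-N = begin
    D 3 N * PDS
      ≈⟨ *-cong (≈-trans (D-* 3 (norm φ) (norm ψ)) (*-cong (≈-sym (*-conj φ)) (≈-sym (*-conj ψ)))) ≈-refl ⟩
    φ * conj φ * (ψ * conj ψ) * PDS
      ≈⟨ solve 5 (λ a b c d p → a :* b :* (c :* d) :* p := p :* (a :* c) :* (b :* d)) ≈-refl φ (conj φ) ψ (conj ψ) PDS ⟩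
    PDS * (φ * ψ) * (conj φ * conj ψ)
      ≈⟨ *-cong (≈-trans (η-mul ⟨ ⁻ 1 ∣ ⁻ 1 ∣ ⁻ 1 ∣ + 0 ∣ + 1 ∣ + 0 ⟩ ⟨ + 1 ∣ + 1 ∣ + 0 ∣ + 0 ∣ + 0 ∣ + 0 ⟩ PDS≈η (η-mul ⟨ + 2 ∣ ⁻ 1 ∣ + 0 ∣ + 0 ∣ + 0 ∣ + 0 ⟩ ⟨ ⁻ 1 ∣ + 2 ∣ + 0 ∣ + 0 ∣ + 0 ∣ + 0 ⟩ φ≈η ψ≈η)) (≈-sym D₃-quotient)) ≈-refl ⟩
    D 3 quotient * (conj φ * conj ψ) ∎
  conjugates : conj φ * conj ψ ≈ weave _ _ _
  conjugates = ≈-trans (*-cong (conjOf-cong (sect₀ φ-weave) (sect₁ φ-weave) (sect₂ φ-weave))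
                               (conjOf-cong (sect₀ ψ-weave) (sect₁ ψ-weave) (sect₂ ψ-weave)))
                       (weave-* _ _ _ _ _ _)

-- The right-hand side

⊗≈ : ∀ {f f′ g g′} → f ≈ f′ → g ≈ g′ → f ⊗ g ≈ f′ * g′
⊗≈ p q = ≈-trans (⊗-cong p q) (⊗≈* _ _)

⊕≈ : ∀ {f f′ g g′} → f ≈ f′ → g ≈ g′ → f ⊕ g ≈ f′ + g′
⊕≈ {f} {f′} {g} {g′} p q = ≈-trans (⊕≈+ f g) (+-cong p q)

^S≈ : ∀ {f g} n → f ≈ g → f ^S n ≈ g ^ n
^S≈ zero    p = ≈-refl
^S≈ (suc n) p = ⊗≈ p (^S≈ n p)

private
  ⊗≈η : ∀ {f g} s t → f ≈ η s → g ≈ η t → f ⊗ g ≈ η (s ⊞ t)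
  ⊗≈η s t p q = ≈-trans (⊗≈ p q) (η-* s t)

  poch-pow : ∀ k {s} n → E k k ≈ η s → poch k k ^S n ≈ η (Vec.map (λ i → + n ℤ.* i) s)
  poch-pow k {s} n p = ≈-trans (^S≈ n (poch≈E k k)) (η-pow s n p)

E₃₆≈η : E 3 6 ≈ η ⟨ + 0 ∣ + 0 ∣ + 1 ∣ + 0 ∣ ⁻ 1 ∣ + 0 ⟩
E₃₆≈η = η-divide e₆ e₃ (≈-trans (*-cong ≈-refl (≈-sym E₆≈η)) (≈-trans (≈-sym (E-double 3 2)) E₃≈η))

-- The two products are taken together, which the equal exponents 5 in the theorem permit: the
-- factors of f₁ with exponents prime to 6 are f₁ divided by those with exponents even or an odd
-- multiple of 3.
E₁₆*E₅₆≈η : E 1 6 * E 5 6 ≈ η ⟨ + 1 ∣ ⁻ 1 ∣ ⁻ 1 ∣ + 0 ∣ + 1 ∣ + 0 ⟩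
E₁₆*E₅₆≈η = η-divide (⟨ + 0 ∣ + 0 ∣ + 1 ∣ + 0 ∣ ⁻ 1 ∣ + 0 ⟩ ⊞ e₂) e₁ (begin
  E 1 6 * E 5 6 * η (⟨ + 0 ∣ + 0 ∣ + 1 ∣ + 0 ∣ ⁻ 1 ∣ + 0 ⟩ ⊞ e₂)   ≈⟨ *-cong ≈-refl (η-mul ⟨ + 0 ∣ + 0 ∣ + 1 ∣ + 0 ∣ ⁻ 1 ∣ + 0 ⟩ e₂ E₃₆≈η E₂≈η) ⟨
  E 1 6 * E 5 6 * (E 3 6 * E 2 2)         ≈⟨ solve 4 (λ a b c d → a :* b :* (c :* d) := a :* c :* b :* d) ≈-refl (E 1 6) (E 5 6) (E 3 6) (E 2 2) ⟩
  E 1 6 * E 3 6 * E 5 6 * E 2 2           ≈⟨ ≈-trans E₁≈ (*-cong (E-triple 1 1) ≈-refl) ⟨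
  E 1 1                                   ≈⟨ E₁≈η ⟩
  η e₁                                    ∎)
  where open ≈R

odd-part≈η : poch 1 6 ^S 5 ⊗ poch 3 6 ^S 2 ⊗ poch 5 6 ^S 5 ≈ η ⟨ + 5 ∣ ⁻ 5 ∣ ⁻ 3 ∣ + 0 ∣ + 3 ∣ + 0 ⟩
odd-part≈η = begin
  poch 1 6 ^S 5 ⊗ poch 3 6 ^S 2 ⊗ poch 5 6 ^S 5
    ≈⟨ ⊗≈ (⊗≈ (^S≈ 5 (poch≈E 1 6)) (^S≈ 2 (poch≈E 3 6))) (^S≈ 5 (poch≈E 5 6)) ⟩
  E 1 6 ^ 5 * E 3 6 ^ 2 * E 5 6 ^ 5
    ≈⟨ solve 3 (λ a b c → a :* b :* c := a :* c :* b) ≈-refl (E 1 6 ^ 5) (E 3 6 ^ 2) (E 5 6 ^ 5) ⟩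
  E 1 6 ^ 5 * E 5 6 ^ 5 * E 3 6 ^ 2
    ≈⟨ *-cong (*-^ (E 1 6) (E 5 6) 5) ≈-refl ⟨
  (E 1 6 * E 5 6) ^ 5 * E 3 6 ^ 2
    ≈⟨ η-mul _ _ (η-pow ⟨ + 1 ∣ ⁻ 1 ∣ ⁻ 1 ∣ + 0 ∣ + 1 ∣ + 0 ⟩ 5 E₁₆*E₅₆≈η) (η-pow ⟨ + 0 ∣ + 0 ∣ + 1 ∣ + 0 ∣ ⁻ 1 ∣ + 0 ⟩ 2 E₃₆≈η) ⟩
  η ⟨ + 5 ∣ ⁻ 5 ∣ ⁻ 3 ∣ + 0 ∣ + 3 ∣ + 0 ⟩ ∎
  where open ≈R

-- The second summand in brackets is 3r² times the first, since r² = q² f₂⁴ f₁₂⁸/(f₄⁸ f₆⁴).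
right-hand-side :
  invS (poch 1 6 ^S 5 ⊗ poch 3 6 ^S 2 ⊗ poch 5 6 ^S 5)
    ⊗ ( poch 4 4 ^S 6 ⊗ poch 6 6 ^S 4 ⊗ invS (poch 2 2 ^S 10 ⊗ poch 12 12 ^S 2)
      ⊕ mono (+ 3) 2 ⊗ poch 12 12 ^S 6 ⊗ invS (poch 2 2 ^S 6 ⊗ poch 4 4 ^S 2))
  ≈ η ⟨ ⁻ 5 ∣ ⁻ 5 ∣ + 3 ∣ + 6 ∣ + 1 ∣ ⁻ 2 ⟩ * (oneS + κ (+ 3) * (r * r))
right-hand-side = begin
  _ ≈⟨ ⊗≈ (η-invS _ odd-part≈η) (⊕≈
         (⊗≈η _ _ (⊗≈η _ _ (poch-pow 4 6 E₄≈η) (poch-pow 6 4 E₆≈η))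
           (η-invS _ (⊗≈η _ _ (poch-pow 2 10 E₂≈η) (poch-pow 12 2 E₁₂≈η))))
         (⊗≈ (⊗≈ (mono≈ (+ 3) 2) (poch-pow 12 6 E₁₂≈η))
           (η-invS _ (⊗≈η _ _ (poch-pow 2 6 E₂≈η) (poch-pow 4 2 E₄≈η))))) ⟩
  η ⟨ ⁻ 5 ∣ + 5 ∣ + 3 ∣ + 0 ∣ ⁻ 3 ∣ + 0 ⟩ * (η ⟨ + 0 ∣ ⁻ 10 ∣ + 0 ∣ + 6 ∣ + 4 ∣ ⁻ 2 ⟩ + κ (+ 3) * X ^ 2 * η ⟨ + 0 ∣ + 0 ∣ + 0 ∣ + 0 ∣ + 0 ∣ + 6 ⟩ * η ⟨ + 0 ∣ ⁻ 6 ∣ + 0 ∣ ⁻ 2 ∣ + 0 ∣ + 0 ⟩)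
    ≈⟨ solve 5 (λ X a b c d → a :* (b :+ con (+ 3) :* (X :* (X :* con (+ 1))) :* c :* d) :=
         a :* b :+ con (+ 3) :* (X :* X) :* (a :* (c :* d))) ≈-refl X _ _ _ _ ⟩
  η ⟨ ⁻ 5 ∣ + 5 ∣ + 3 ∣ + 0 ∣ ⁻ 3 ∣ + 0 ⟩ * η ⟨ + 0 ∣ ⁻ 10 ∣ + 0 ∣ + 6 ∣ + 4 ∣ ⁻ 2 ⟩ + κ (+ 3) * (X * X) * (η ⟨ ⁻ 5 ∣ + 5 ∣ + 3 ∣ + 0 ∣ ⁻ 3 ∣ + 0 ⟩ * (η ⟨ + 0 ∣ + 0 ∣ + 0 ∣ + 0 ∣ + 0 ∣ + 6 ⟩ * η ⟨ + 0 ∣ ⁻ 6 ∣ + 0 ∣ ⁻ 2 ∣ + 0 ∣ + 0 ⟩))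
    ≈⟨ +-cong (η-* _ _) (*-cong ≈-refl (≈-trans (≈-trans (*-cong ≈-refl (η-* _ _)) (η-* _ _)) (≈-sym (η-* _ _)))) ⟩
  η ⟨ ⁻ 5 ∣ ⁻ 5 ∣ + 3 ∣ + 6 ∣ + 1 ∣ ⁻ 2 ⟩ + κ (+ 3) * (X * X) * (η ⟨ ⁻ 5 ∣ ⁻ 5 ∣ + 3 ∣ + 6 ∣ + 1 ∣ ⁻ 2 ⟩ * η ⟨ + 0 ∣ + 4 ∣ + 0 ∣ ⁻ 8 ∣ ⁻ 4 ∣ + 8 ⟩)
    ≈⟨ solve 3 (λ X a b → a :+ con (+ 3) :* (X :* X) :* (a :* b) := a :* (con (+ 1) :+ con (+ 3) :* (X :* X :* b))) ≈-refl X _ _ ⟩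
  η ⟨ ⁻ 5 ∣ ⁻ 5 ∣ + 3 ∣ + 6 ∣ + 1 ∣ ⁻ 2 ⟩ * (oneS + κ (+ 3) * (X * X * η ⟨ + 0 ∣ + 4 ∣ + 0 ∣ ⁻ 8 ∣ ⁻ 4 ∣ + 8 ⟩))
    ≈⟨ *-cong ≈-refl (+-cong ≈-refl (*-cong ≈-refl r*r≈)) ⟨
  η ⟨ ⁻ 5 ∣ ⁻ 5 ∣ + 3 ∣ + 6 ∣ + 1 ∣ ⁻ 2 ⟩ * (oneS + κ (+ 3) * (r * r)) ∎
  where open ≈R

3*n≡triple : ∀ n → 3 ℕ.* n ≡ triple n
3*n≡triple zero    = refl
3*n≡triple (suc n) = trans (ℕ.*-suc 3 n) (cong (3 ℕ.+_) (3*n≡triple n))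

theorem1p5 : ∀ (n : ℕ) →
    + PD (3 ℕ.* n)
    ≡ (invS (poch 1 6 ^S 5 ⊗ poch 3 6 ^S 2 ⊗ poch 5 6 ^S 5)
    ⊗ ( poch 4 4 ^S 6 ⊗ poch 6 6 ^S 4
    ⊗ invS (poch 2 2 ^S 10 ⊗ poch 12 12 ^S 2)
    ⊕ mono (+ 3) 2 ⊗ poch 12 12 ^S 6
    ⊗ invS (poch 2 2 ^S 6 ⊗ poch 4 4 ^S 2))) n
theorem1p5 n = trans (cong (λ m → + PD m) (3*n≡triple n))
  (at (≈-trans sect₀-PDS (≈-sym right-hand-side)) n)
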